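{- Let $H$ be a graph on $h$ vertices with pathwidth at most $2$, and suppose $h > 5$. Then there is a function $f_H(k) = 2^{O(h^2)}\cdot k^2 \cdot \log k$ such that for every graph $G$, if $k = \mathbf{pack}_H(G)$, then $k \le \mathbf{cover}_H(G) \le f_H(k)$.
   Context: All graphs are finite, undirected, without loops. For a graph $H$, $\mathcal{M}(H)$ denotes the set of all graphs that can be contracted to $H$ (i.e. $H$ is obtained from them by a sequence of edge contractions); members of $\mathcal{M}(H)$ are called models of $H$. For a graph $G$, $\mathbf{cover}_H(G)$ is the minimum number of vertices of $G$ meeting every subgraph of $G$ that belongs to $\mathcal{M}(H)$, and $\mathbf{pack}_H(G)$ is the maximum number of pairwise vertex-disjoint subgraphs of $G$ belonging to $\mathcal{M}(H)$. Logarithms are binary. The constant hidden in $O(h^2)$ does not depend on $H$ or $k$.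
   Formalization: The factor log k is replaced by the ceiling of log(k+1), since for k = 1 the stated bound would be 0 while the cover number is at least 1; for k ≥ 2 the two differ by at most a factor 2, absorbed in 2^{O(h^2)}. -}

module Defs where

open import Data.Nat using (ℕ; zero; suc; _+_; _*_; _^_; _≤_; _<_)
open import Data.Nat.Logarithm using (⌈log₂_⌉)
open import Data.Fin using (Fin; toℕ)
open import Data.Fin.Subset using (Subset; _∈_; ∣_∣)
open import Data.Product using (Σ; ∃; ∃-syntax; _×_; _,_)
open import Data.Sum using (_⊎_)
open import Relation.Nullary using (¬_)
open import Relation.Binary.PropositionalEquality using (_≡_; _≢_)
open import Function using (_⇔_)
open import Function.Definitions using (Injective; Surjective)

record Graph : Set₁ where
  field
    n     : ℕ
    Adj   : Fin n → Fin n → Set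
    sym   : ∀ {x y} → Adj x y → Adj y x
    irrefl : ∀ {x} → ¬ Adj x x
open Graph public

V : Graph → Set
V G = Fin (n G)

record Iso (G H : Graph) : Set where
  field
    φ     : V G → V H
    inj   : Injective _≡_ _≡_ φ
    surj  : Surjective _≡_ _≡_ φ
    adj⇔  : ∀ x y → Adj G x y ⇔ Adj H (φ x) (φ y)

-- G' is obtained from G by contracting the edge uv (with G' given on its
-- own vertex set Fin n', via the quotient map φ): φ is onto, identifies
-- exactly u and v, and the edges of G' are the images of edges of G that
-- do not become loops (parallel edges are merged, loops deleted).
record ContractionStep (G G' : Graph) : Set where
  field
    u v   : V G
    uv    : Adj G u v
    φ     : V G → V G'
    surj  : Surjective _≡_ _≡_ φ
    ident : ∀ x y → (φ x ≡ φ y) ⇔ (x ≡ y ⊎ (x ≡ u × y ≡ v) ⊎ (x ≡ v × y ≡ u))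
    adj⇔  : ∀ a b → Adj G' a b ⇔
              (a ≢ b × ∃[ x ] ∃[ y ] (φ x ≡ a × φ y ≡ b × Adj G x y))

data ContractsTo : Graph → Graph → Set₁ where
  done : ∀ {G H} → Iso G H → ContractsTo G H
  step : ∀ {G G' H} → ContractionStep G G' → ContractsTo G' H → ContractsTo G H

IsModel : Graph → Graph → Set₁
IsModel H G = ContractsTo G H

record Subgraph (G : Graph) : Set₁ where
  field
    K      : Graph
    ι      : V K → V G
    ι-inj  : Injective _≡_ _≡_ ι
    ι-adj  : ∀ {x y} → Adj K x y → Adj G (ι x) (ι y)
open Subgraph public

record ModelIn (H G : Graph) : Set₁ where
  field
    sub   : Subgraph G
    model : IsModel H (K sub)
open ModelIn public

Hits : (H G : Graph) → Subset (n G) → Set₁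
Hits H G S = (M : ModelIn H G) → ∃[ x ] (ι (sub M) x ∈ S)

record Packing (H G : Graph) (k : ℕ) : Set₁ where
  field
    model    : Fin k → ModelIn H G
    disjoint : ∀ i j → i ≢ j → ∀ x y →
               ι (sub (model i)) x ≢ ι (sub (model j)) y

IsCoverNumber : (H G : Graph) → ℕ → Set₁
IsCoverNumber H G m =
  (∃[ S ] (∣ S ∣ ≡ m × Hits H G S)) × (∀ S → Hits H G S → m ≤ ∣ S ∣)

IsPackNumber : (H G : Graph) → ℕ → Set₁
IsPackNumber H G k = Packing H G k × (∀ k' → Packing H G k' → k' ≤ k)

record PathDecomposition (w : ℕ) (G : Graph) : Set where
  field
    r        : ℕ
    bag      : Fin r → Subset (n G)
    width    : ∀ i → ∣ bag i ∣ ≤ suc w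
    vertex   : ∀ x → ∃[ i ] (x ∈ bag i)
    edge     : ∀ x y → Adj G x y → ∃[ i ] (x ∈ bag i × y ∈ bag i)
    interval : ∀ i j l x → toℕ i ≤ toℕ j → toℕ j ≤ toℕ l →
               x ∈ bag i → x ∈ bag l → x ∈ bag j

PathwidthAtMost : ℕ → Graph → Set
PathwidthAtMost w G = PathDecomposition w G

{-# OPTIONS --safe #-}

-- The proof avoids tree decompositions.  For a vertex set C call a chain any sequence of
-- disjoint connected sets outside C, consecutive ones adjacent, each containing one marked
-- vertex, such that every neighbour of C is marked.  Starting with C = V(G) and the empty
-- chain, one shrinks C, depth-first, as long as it stays "heavy" (contains many models),
-- lengthening the chain.  When the chain has 2M members, Menger's theorem is applied to the
-- marks of its first and second half: M disjoint paths through C give, by Erdős–Szekeres,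
-- a ladder with about √M subdivided rungs; a smaller separator splits C in two, and
-- if one of the two pieces is heavy its boundary is again marked by a shorter chain.
-- So one finds either a ladder, or a heavy C with at most 3M vertices separating it from the
-- rest and breaking it into light pieces.  A graph on h vertices of pathwidth at most 2 is a
-- minor of the ladder with h subdivided rungs, so M = ((k + 1)h)² + 1 suffices for k + 1
-- disjoint models, and for connected patterns induction on the packing number (heavy = more
-- than half of it) gives covers of size O(h²k²).  For disconnected H one argues component by
-- component, "heavy" meaning that some component has k + 1 disjoint models.
module Submission where

import Defs
open import Data.Bool using (Bool; true; false; not)
import Data.Bool.Properties as Bool
open import Data.Empty using (⊥; ⊥-elim)
open import Data.Unit using (⊤; tt)
open import Data.Fin using (Fin; zero; suc; toℕ; fromℕ<; opposite; punchIn; punchOut; inject≤; combine; splitAt; join)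
open import Data.Fin.Properties using (_≟_; any?; all?; toℕ<n; toℕ-fromℕ<; toℕ-injective; injective⇒≤; inject≤-injective; opposite-prop; opposite-involutive; combine-injectiveˡ; toℕ-combine; toℕ-inject≤; join-splitAt; punchOut-punchIn; punchIn-punchOut; punchOut-injective; punchOut-cong; punchInᵢ≢i)
open import Data.Fin.Subset using (Subset; _∈_; _∉_; _⊆_; ∣_∣; _∪_; ⁅_⁆; Nonempty) renaming (⊤ to full; ⊥ to empty)
open import Data.Fin.Subset.Properties using (_∈?_; _⊆?_; anySubset?; ∈⊤; ∉⊥)
import Data.Fin.Subset.Properties as Sub
open import Data.List using (List; []; _∷_; _++_; cartesianProduct; length; filter; allFin; lookup; map; take; drop)
open import Data.List.Properties using (length-++; filter-notAll; take++drop≡id; length-take; length-drop; length-map; map-++; length-tabulate; filter-≐)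
open import Data.List.Membership.Propositional using () renaming (_∈_ to _∈ˡ_)
open import Data.List.Membership.Propositional.Properties using (∈-filter⁺; ∈-filter⁻; ∈-allFin; ∈-++⁺ˡ; ∈-++⁺ʳ; ∈-++⁻; ∈-lookup; ∈-map⁺; ∈-map⁻; ∈-cartesianProduct⁺)
open import Data.List.Relation.Unary.All using (All; []; _∷_)
import Data.List.Relation.Unary.All as All
import Data.List.Relation.Unary.All.Properties as All
open import Data.List.Relation.Unary.AllPairs using (AllPairs; []; _∷_)
import Data.List.Relation.Unary.AllPairs.Properties as AllPairs
open import Data.List.Relation.Unary.Any using (here; there; index)
open import Data.List.Relation.Unary.Any.Properties using (lookup-index)
open import Data.List.Relation.Unary.Unique.Propositional.Properties using (filter⁺; allFin⁺)
open import Data.Maybe using (Maybe; just; nothing)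
open import Data.Maybe.Properties using (just-injective)
open import Data.Nat using (ℕ; zero; suc; _+_; _*_; _^_; _∸_; _≤_; _<_; z≤n; s≤s; _<?_; _≤?_)
import Data.Nat.Properties as ℕ
open import Data.Nat.Induction using (<-wellFounded)
open import Data.Nat.Logarithm using (⌈log₂_⌉; ⌈log₂⌉-mono-≤)
open import Data.Nat.Solver using (module +-*-Solver)
open import Data.Product using (Σ; Σ-syntax; ∃; ∃-syntax; _×_; _,_; proj₁; proj₂)
open import Data.Sum using (_⊎_; inj₁; inj₂; [_,_]′)
open import Data.Vec using ([]; _∷_; tabulate)
open import Data.Vec.Properties using (lookup⇒[]=; []=⇒lookup; lookup∘tabulate)
open import Function using (_∘_; id; Equivalence; mk⇔)
open import Induction.WellFounded using (Acc; acc)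
open import Relation.Binary.Definitions using (tri<; tri≈; tri>)
open import Relation.Binary.PropositionalEquality using (_≡_; _≢_; refl; trans; cong; cong₂; subst; subst₂) renaming (sym to ≡sym)
open import Relation.Nullary using (¬_; Dec; yes; no; does)
open import Relation.Nullary.Decidable using (_×-dec_; _⊎-dec_; ¬?; dec-true; decidable-stable; _→-dec_)

-- The obstacle is to keep a heavy `C` attached to a short chain. A separator that cuts `C` is not
-- by itself marked by disjoint connected sets. Only because the separation is chosen tight, with as
-- many disjoint paths to each half as it has vertices, can the bags be prolonged along these paths
-- up to it. Rungs are subdivided so that a new vertex of `H` can be put into the middle of a rung,
-- next to both rails, before it takes over one of them. Two rails suffice because a bag of the path
-- decomposition has three members: the next vertex and at most two older ones that still wait for
-- neighbours. For connected patterns, "more than half" leaves the outside of `C` and both pieces of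
-- the cut with at most half the packing number each, so that the squares of these numbers add up to
-- at most half of k² and the recursion costs only a constant factor. Adjacency is an arbitrary
-- relation. Whatever has to be decided is decided under double negation, which the final
-- inequality, being decidable, permits.

-- Counting in lists and in subsets of `Fin n`.

lookup-AllPairs : ∀ {a ℓ} {A : Set a} {R : A → A → Set ℓ} {xs} → AllPairs R xs →
  ∀ i j → toℕ i < toℕ j → R (lookup xs i) (lookup xs j)
lookup-AllPairs (r ∷ rs) zero (suc j) _ = All.lookup r (∈-lookup j)
lookup-AllPairs (r ∷ rs) (suc i) (suc j) (s≤s i<j) = lookup-AllPairs rs i j i<j

lookup-injective : ∀ {A : Set} {xs : List A} → AllPairs _≢_ xs →
  ∀ i j → lookup xs i ≡ lookup xs j → i ≡ j
lookup-injective ps i j eq with ℕ.<-cmp (toℕ i) (toℕ j)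
... | tri< i<j _ _ = ⊥-elim (lookup-AllPairs ps i j i<j eq)
... | tri≈ _ i≡j _ = toℕ-injective i≡j
... | tri> _ _ j<i = ⊥-elim (lookup-AllPairs ps j i j<i (≡sym eq))

length-injection : ∀ {A : Set} {k} (b : Fin k → A) (T : List A) →
  (∀ {i j} → b i ≡ b j → i ≡ j) → (∀ i → b i ∈ˡ T) → k ≤ length T
length-injection b T inj mem = injective⇒≤ {f = λ i → index (mem i)} λ {i} {j} eq →
  inj (trans (lookup-index (mem i)) (trans (cong (lookup T) eq) (≡sym (lookup-index (mem j)))))

-- Were `t` missed, the injection would fit into `T` without `t`, a list shorter than `k`. In this
-- way `k` disjoint paths are seen to use every vertex of a set of at most `k` vertices.
injection-onto : ∀ {n k} (b : Fin k → Fin n) (T : List (Fin n)) →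
  (∀ {i j} → b i ≡ b j → i ≡ j) → (∀ i → b i ∈ˡ T) → length T ≤ k →
  ∀ {t} → t ∈ˡ T → ∃[ i ] b i ≡ t
injection-onto b T inj mem len {t} t∈T with any? (λ i → b i ≟ t)
... | yes hit = hit
... | no miss = ⊥-elim (ℕ.<-irrefl refl (ℕ.<-≤-trans shorter (ℕ.≤-trans len
        (length-injection b T′ inj λ i → ∈-filter⁺ ≢t? (mem i) λ eq → miss (i , eq)))))
  where
  ≢t? = λ v → ¬? (v ≟ t)
  T′ = filter ≢t? T
  shorter : length T′ < length T
  shorter = filter-notAll ≢t? T (Data.List.Relation.Unary.Any.map (λ eq ne → ne (≡sym eq)) t∈T)

length-filter-mono : ∀ {A : Set} {P Q : A → Set} (P? : ∀ x → Dec (P x)) (Q? : ∀ x → Dec (Q x)) →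
  (∀ x → P x → Q x) → ∀ xs → length (filter P? xs) ≤ length (filter Q? xs)
length-filter-mono P? Q? imp [] = z≤n
length-filter-mono P? Q? imp (x ∷ xs) with P? x | Q? x
... | yes p | yes q = s≤s (length-filter-mono P? Q? imp xs)
... | yes p | no ¬q = ⊥-elim (¬q (imp x p))
... | no _  | yes q = ℕ.m≤n⇒m≤1+n (length-filter-mono P? Q? imp xs)
... | no _  | no _  = length-filter-mono P? Q? imp xs

module _ {n : ℕ} {P : Fin n → Set} (P? : ∀ x → Dec (P x)) where

  comprehension : Subset n
  comprehension = tabulate (λ x → does (P? x))

  ∈-comprehension⁺ : ∀ {x} → P x → x ∈ comprehension
  ∈-comprehension⁺ {x} p =
    lookup⇒[]= x comprehension (trans (lookup∘tabulate _ x) (dec-true (P? x) p))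

  ∈-comprehension⁻ : ∀ {x} → x ∈ comprehension → P x
  ∈-comprehension⁻ {x} x∈ with P? x | trans (≡sym (lookup∘tabulate (λ x → does (P? x)) x)) ([]=⇒lookup x∈)
  ... | yes p | _ = p
  ... | no _  | ()

module _ {n : ℕ} where

  remove? : ∀ (C : Subset n) v x → Dec (x ∈ C × x ≢ v)
  remove? C v x = (x ∈? C) ×-dec ¬? (x ≟ v)

  remove : Subset n → Fin n → Subset n
  remove C v = comprehension (remove? C v)

  ∈-remove⁻ : ∀ {C v x} → x ∈ remove C v → x ∈ C × x ≢ v
  ∈-remove⁻ {C} {v} = ∈-comprehension⁻ (remove? C v)

  ∈-remove⁺ : ∀ {C v x} → x ∈ C → x ≢ v → x ∈ remove C v
  ∈-remove⁺ {C} {v} x∈ ne = ∈-comprehension⁺ (remove? C v) (x∈ , ne)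

  ∣remove∣ : ∀ {C v} → v ∈ C → ∣ remove C v ∣ < ∣ C ∣
  ∣remove∣ {C} {v} v∈ = Sub.p⊂q⇒∣p∣<∣q∣
    ((λ x∈ → proj₁ (∈-remove⁻ x∈)) , v , v∈ , λ v∈′ → proj₂ (∈-remove⁻ v∈′) refl)

  distinct-members : ∀ {p : Subset n} {xs} → AllPairs _≢_ xs → All (_∈ p) xs → length xs ≤ ∣ p ∣
  distinct-members [] [] = z≤n
  distinct-members {p} {x ∷ xs} (ne ∷ nes) (x∈ ∷ xs∈) = ℕ.≤-<-trans
    (distinct-members nes (All.zipWith (λ (ne , y∈) → ∈-remove⁺ y∈ (ne ∘ ≡sym)) (ne , xs∈))) (∣remove∣ x∈)

  argmin : ∀ (ℓ : Fin n → ℕ) (R : Subset n) → Nonempty R → ∃[ v ] (v ∈ R × (∀ {w} → w ∈ R → ℓ v ≤ ℓ w))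
  argmin ℓ R (v , v∈) = descend v v∈ (<-wellFounded (ℓ v))
    where
    descend : ∀ v → v ∈ R → Acc _<_ (ℓ v) → ∃[ v ] (v ∈ R × (∀ {w} → w ∈ R → ℓ v ≤ ℓ w))
    descend v v∈ (acc rec) with any? (λ w → (w ∈? R) ×-dec (ℓ w <? ℓ v))
    ... | yes (w , w∈ , lt) = descend w w∈ (rec lt)
    ... | no none = v , v∈ , λ {w} w∈ → ℕ.≮⇒≥ (λ lt → none (w , w∈ , lt))

_∈ˡ?_ : ∀ {n} (v : Fin n) (T : List (Fin n)) → Dec (v ∈ˡ T)
v ∈ˡ? T = Data.List.Relation.Unary.Any.any? (v ≟_) T

-- Menger's theorem for vertex sets, by induction on the edges.

module Menger (n : ℕ) where

  V : Set
  V = Fin n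

  Edges : Set
  Edges = List (V × V)

  Step : Edges → V → V → Set
  Step E u v = (u , v) ∈ˡ E ⊎ (v , u) ∈ˡ E

  data Walk (E : Edges) (K : V → Set) : V → V → Set where
    nil  : ∀ {v} → K v → Walk E K v v
    cons : ∀ {u v w} → K u → Step E u v → Walk E K v w → Walk E K u w

  source : ∀ {E K u v} → Walk E K u v → K u
  source (nil k) = k
  source (cons k _ _) = k

  target : ∀ {E K u v} → Walk E K u v → K v
  target (nil k) = k
  target (cons _ _ w) = target w

  append : ∀ {E K u v w} → Walk E K u v → Walk E K v w → Walk E K u w
  append (nil _) w = w
  append (cons k s w′) w = cons k s (append w′ w)

  mapWalk : ∀ {E E′} {K K′ : V → Set} → (∀ {u v} → Step E u v → Step E′ u v) →
    (∀ {v} → K v → K′ v) → ∀ {u v} → Walk E K u v → Walk E′ K′ u v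
  mapWalk f g (nil k) = nil (g k)
  mapWalk f g (cons k s w) = cons (g k) (f s) (mapWalk f g w)

  -- Disjointness is imposed on sets `K i` containing the walks. Walks may thus revisit vertices,
  -- and cutting or gluing them only restricts or unites these sets.
  record Linkage (E : Edges) (A B : List V) (k : ℕ) : Set₁ where
    field
      a b  : Fin k → V
      K    : Fin k → V → Set
      a∈   : ∀ i → a i ∈ˡ A
      b∈   : ∀ i → b i ∈ˡ B
      walk : ∀ i → Walk E (K i) (a i) (b i)
      disj : ∀ {i j v} → K i v → K j v → i ≡ j

    a-inj : ∀ {i j} → a i ≡ a j → i ≡ j
    a-inj {i} {j} eq = disj (source (walk i)) (subst (K j) (≡sym eq) (source (walk j)))

    b-inj : ∀ {i j} → b i ≡ b j → i ≡ j
    b-inj {i} {j} eq = disj (target (walk i)) (subst (K j) (≡sym eq) (target (walk j)))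

  data Side : Set where
    left mid right : Side

  _≟ˢ_ : (s t : Side) → Dec (s ≡ t)
  left  ≟ˢ left  = yes refl
  left  ≟ˢ mid   = no λ ()
  left  ≟ˢ right = no λ ()
  mid   ≟ˢ left  = no λ ()
  mid   ≟ˢ mid   = yes refl
  mid   ≟ˢ right = no λ ()
  right ≟ˢ left  = no λ ()
  right ≟ˢ mid   = no λ ()
  right ≟ˢ right = yes refl

  mids : (V → Side) → List V
  mids σ = filter (λ v → σ v ≟ˢ mid) (allFin n)

  ∈-mids⁺ : ∀ σ {v} → σ v ≡ mid → v ∈ˡ mids σ
  ∈-mids⁺ σ {v} eq = ∈-filter⁺ (λ v → σ v ≟ˢ mid) (∈-allFin v) eq

  ∈-mids⁻ : ∀ σ {v} → v ∈ˡ mids σ → σ v ≡ mid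
  ∈-mids⁻ σ v∈ = proj₂ (∈-filter⁻ (λ v → σ v ≟ˢ mid) {xs = allFin n} v∈)

  mids-mono : ∀ σ τ → (∀ v → σ v ≡ mid → τ v ≡ mid) → length (mids σ) ≤ length (mids τ)
  mids-mono σ τ imp = length-filter-mono _ _ imp (allFin n)

  -- A separation as a three-colouring whose separator is the class `mid`; two separations can then
  -- be combined pointwise.
  record Sep (E : Edges) (A B : List V) (k : ℕ) : Set where
    field
      σ     : V → Side
      A≢R   : ∀ {v} → v ∈ˡ A → σ v ≢ right
      B≢L   : ∀ {v} → v ∈ˡ B → σ v ≢ left
      apart : ∀ {u v} → Step E u v → σ u ≡ left → σ v ≢ right
      order : length (mids σ) < k

  open Sep

  weakenSep : ∀ {E A B k l} → k ≤ l → Sep E A B k → Sep E A B l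
  weakenSep k≤l S = record { Sep S ; order = ℕ.<-≤-trans (order S) k≤l }

  flipSide : Side → Side
  flipSide left = right
  flipSide mid = mid
  flipSide right = left

  flipSide-invol : ∀ s → flipSide (flipSide s) ≡ s
  flipSide-invol left = refl
  flipSide-invol mid = refl
  flipSide-invol right = refl

  flipSide-to : ∀ {s t} → flipSide s ≡ t → s ≡ flipSide t
  flipSide-to {s} refl = ≡sym (flipSide-invol s)

  stepSym : ∀ {E u v} → Step E u v → Step E v u
  stepSym (inj₁ e) = inj₂ e
  stepSym (inj₂ e) = inj₁ e

  flipSep : ∀ {E A B k} → Sep E A B k → Sep E B A k
  flipSep S = record
    { σ = flipSide ∘ σ S
    ; A≢R = λ v∈ → B≢L S v∈ ∘ flipSide-to
    ; B≢L = λ v∈ → A≢R S v∈ ∘ flipSide-to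
    ; apart = λ s u v → apart S (stepSym s) (flipSide-to v) (flipSide-to u)
    ; order = ℕ.≤-<-trans (mids-mono (flipSide ∘ σ S) (σ S) (λ v → flipSide-to)) (order S)
    }

  maxS : Side → Side → Side
  maxS left  t     = t
  maxS mid   left  = mid
  maxS mid   mid   = mid
  maxS mid   right = right
  maxS right t     = right

  maxS-left : ∀ {s t} → maxS s t ≡ left → s ≡ left × t ≡ left
  maxS-left {left} refl = refl , refl
  maxS-left {mid} {left} ()
  maxS-left {mid} {mid} ()
  maxS-left {mid} {right} ()

  maxS-right : ∀ {s t} → maxS s t ≡ right → s ≡ right ⊎ t ≡ right
  maxS-right {left} eq = inj₂ eq
  maxS-right {mid} {right} eq = inj₂ refl
  maxS-right {right} eq = inj₁ refl

  maxS-mid : ∀ {s t} → maxS s t ≡ mid → (s ≡ mid → t ≢ left) → t ≡ mid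
  maxS-mid {left} eq h = eq
  maxS-mid {mid} {left} eq h = ⊥-elim (h refl refl)
  maxS-mid {mid} {mid} eq h = refl

  -- The colouring is the maximum for `left` < `mid` < `right`. A vertex that is `mid` in `S` lies
  -- in `T`, hence is not `left` in `S′`; so the new separator is contained in that of `S′`.
  uncross : ∀ {E A B T k l} (S : Sep E A B l) → (∀ {v} → v ∈ˡ mids (σ S) → v ∈ˡ T) →
    Sep E A T k → Sep E A B k
  uncross S ⊆T S′ = record
    { σ = λ v → maxS (σ S v) (σ S′ v)
    ; A≢R = λ v∈ eq → [ A≢R S v∈ , A≢R S′ v∈ ]′ (maxS-right eq)
    ; B≢L = λ v∈ eq → B≢L S v∈ (proj₁ (maxS-left eq))
    ; apart = λ s u v → [ apart S s (proj₁ (maxS-left u)) , apart S′ s (proj₂ (maxS-left u)) ]′ (maxS-right v)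
    ; order = ℕ.≤-<-trans (mids-mono _ (σ S′) λ v eq →
        maxS-mid {σ S v} eq (λ m → B≢L S′ (⊆T (∈-mids⁺ (σ S) m)))) (order S′)
    }

  flip-mids : ∀ (σ : V → Side) {v} → v ∈ˡ mids (flipSide ∘ σ) → v ∈ˡ mids σ
  flip-mids σ v∈ = ∈-mids⁺ σ (flipSide-to (∈-mids⁻ (flipSide ∘ σ) v∈))

  module Truncate {E A B k} (S : Sep E A B k) where

    prefix : ∀ {K : V → Set} {u t} → (∀ {v} → K v → σ S v ≡ mid → v ≡ t) → σ S u ≢ right →
      Walk E K u t → Walk E (λ v → K v × σ S v ≢ right) u t
    prefix end u≢R (nil k) = nil (k , u≢R)
    prefix {u = u} end u≢R (cons {v = v} k s w) with σ S u in eq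
    ... | left  = cons (k , λ e → case (trans (≡sym eq) e)) s (prefix end (apart S s eq) w)
      where case : left ≢ right
            case ()
    ... | mid with end k eq
    ...   | refl = nil (k , λ e → case (trans (≡sym eq) e))
      where case : mid ≢ right
            case ()
    prefix end u≢R (cons k s w) | right = ⊥-elim (u≢R refl)

    -- The recursion works from the far end: `inj₂` as long as no `left` vertex has been met. The
    -- vertex after the last `left` one is `mid` by `apart`, hence is `t`, and from there on the
    -- answer is `inj₁`.
    suffix : ∀ {K : V → Set} {u t b} → (∀ {v} → K v → σ S v ≡ mid → v ≡ t) → σ S b ≢ left →
      Walk E K u b → Walk E (λ v → K v × σ S v ≢ left) t b ⊎
                      (σ S u ≢ left × Walk E (λ v → K v × σ S v ≢ left) u b)
    suffix end b≢L (nil k) = inj₂ (b≢L , nil (k , b≢L))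
    suffix {u = u} end b≢L (cons {v = v} k s w) with suffix end b≢L w
    ... | inj₁ w′ = inj₁ w′
    ... | inj₂ (v≢L , w′) with σ S u ≟ˢ left
    ...   | no u≢L = inj₂ (u≢L , cons (k , u≢L) s w′)
    ...   | yes uL with σ S v in eq
    ...     | left = ⊥-elim (v≢L refl)
    ...     | right = ⊥-elim (apart S s uL eq)
    ...     | mid with end (source w) eq
    ...       | refl = inj₁ w′

    suffix′ : ∀ {K : V → Set} {t b} → (∀ {v} → K v → σ S v ≡ mid → v ≡ t) → σ S b ≢ left →
      Walk E K t b → Walk E (λ v → K v × σ S v ≢ left) t b
    suffix′ end b≢L w = [ id , proj₂ ]′ (suffix end b≢L w)

  module Glue {E′ E : Edges} (E′⊆E : ∀ {u v} → Step E′ u v → Step E u v) {A B k}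
    (S : Sep E′ A B k) {x y : V} (xL : σ S x ≡ left) (yR : σ S y ≡ right) (xy : Step E x y)
    (l₁ : Linkage E′ A (x ∷ mids (σ S)) k) (l₂ : Linkage E′ (y ∷ mids (σ S)) B k) where

    open Truncate S

    private
      module L₁ = Linkage l₁
      module L₂ = Linkage l₂

    -- By `order` the list `x ∷ mids (σ S)` has at most `k` members, so the `k` disjoint paths end
    -- in all of them.
    onto₁ : ∀ {t} → t ∈ˡ x ∷ mids (σ S) → ∃[ i ] L₁.b i ≡ t
    onto₁ = injection-onto L₁.b _ L₁.b-inj L₁.b∈ (order S)

    onto₂ : ∀ {t} → t ∈ˡ y ∷ mids (σ S) → ∃[ i ] L₂.a i ≡ t
    onto₂ = injection-onto L₂.a _ L₂.a-inj L₂.a∈ (order S)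

    mid-end₁ : ∀ {i v} → L₁.K i v → σ S v ≡ mid → v ≡ L₁.b i
    mid-end₁ {i} {v} kv m with onto₁ (there (∈-mids⁺ (σ S) m))
    ... | i′ , refl with L₁.disj kv (target (L₁.walk i′))
    ... | refl = refl

    mid-end₂ : ∀ {i v} → L₂.K i v → σ S v ≡ mid → v ≡ L₂.a i
    mid-end₂ {i} {v} kv m with onto₂ (there (∈-mids⁺ (σ S) m))
    ... | i′ , refl with L₂.disj kv (source (L₂.walk i′))
    ... | refl = refl

    -- A path ending in a separator vertex continues with the path that starts there; the one ending
    -- in `x` continues over the edge `xy`.
    Match : V → V → Set
    Match u v = (u ≡ v × σ S u ≡ mid) ⊎ (u ≡ x × v ≡ y)

    match : ∀ i → ∃[ j ] Match (L₁.b i) (L₂.a j)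
    match i with L₁.b∈ i
    ... | here eq = let j , eq′ = onto₂ (here refl) in j , inj₂ (eq , eq′)
    ... | there m = let j , eq′ = onto₂ (there m) in j , inj₁ (≡sym eq′ , ∈-mids⁻ (σ S) m)

    partner : Fin k → Fin k
    partner = proj₁ ∘ match

    K₁ K₂ : Fin k → V → Set
    K₁ i v = L₁.K i v × σ S v ≢ right
    K₂ i v = L₂.K i v × σ S v ≢ left

    w₁ : ∀ i → Walk E (K₁ i) (L₁.a i) (L₁.b i)
    w₁ i = mapWalk E′⊆E id (prefix mid-end₁ (A≢R S (L₁.a∈ i)) (L₁.walk i))

    w₂ : ∀ i → Walk E (K₂ i) (L₂.a i) (L₂.b i)
    w₂ i = mapWalk E′⊆E id (suffix′ mid-end₂ (B≢L S (L₂.b∈ i)) (L₂.walk i))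

    K : Fin k → V → Set
    K i v = K₁ i v ⊎ K₂ (partner i) v

    joined : ∀ i → Walk E (K i) (L₁.a i) (L₂.b (partner i))
    joined i with match i | mapWalk {K′ = K i} id inj₁ (w₁ i) | mapWalk {K′ = K i} id inj₂ (w₂ (partner i))
    ... | j , inj₁ (eq , _) | p | q = append p (subst (λ t → Walk E _ t _) (≡sym eq) q)
    ... | j , inj₂ (eq , eq′) | p | q =
      append p (cons (target p) (subst (λ u → Step E u _) (≡sym eq) (subst (Step E x) (≡sym eq′) xy)) q)

    y≢mid : ∀ {v} → v ≡ y → σ S v ≢ mid
    y≢mid refl m with trans (≡sym m) yR
    ... | ()

    partner-inj : ∀ {i j} → partner i ≡ partner j → i ≡ j
    partner-inj {i} {j} eq with match i | match j | eq
    ... | p , inj₁ (e , m) | .p , inj₁ (e′ , _) | refl = L₁.b-inj (trans e (≡sym e′))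
    ... | p , inj₁ (e , m) | .p , inj₂ (_ , e′) | refl = ⊥-elim (y≢mid (trans e e′) m)
    ... | p , inj₂ (_ , e) | .p , inj₁ (e′ , m) | refl = ⊥-elim (y≢mid (trans e′ e) m)
    ... | p , inj₂ (e , _) | .p , inj₂ (e′ , _) | refl = L₁.b-inj (trans e (≡sym e′))

    -- Truncated paths from the two sides can meet only in a `mid` vertex, which is the end of the
    -- one and the start of the other, so they are partners.
    mixed : ∀ {i j v} → K₁ i v → K₂ (partner j) v → i ≡ j
    mixed {i} {j} {v} (k , ≢R) (k′ , ≢L) with σ S v in eq
    ... | left = ⊥-elim (≢L refl)
    ... | right = ⊥-elim (≢R refl)
    ... | mid with match j | mid-end₁ k eq | mid-end₂ k′ eq
    ...   | p , inj₁ (e , _) | e₁ | e₂ = L₁.b-inj (trans (≡sym e₁) (trans e₂ (≡sym e)))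
    ...   | p , inj₂ (_ , e) | e₁ | e₂ = ⊥-elim (y≢mid (trans e₂ e) eq)

    glued : Linkage E A B k
    glued = record
      { a = L₁.a ; b = L₂.b ∘ partner ; K = K ; a∈ = L₁.a∈ ; b∈ = λ i → L₂.b∈ (partner i)
      ; walk = joined
      ; disj = λ
        { (inj₁ p) (inj₁ q) → L₁.disj (proj₁ p) (proj₁ q)
        ; (inj₁ p) (inj₂ q) → mixed p q
        ; (inj₂ p) (inj₁ q) → ≡sym (mixed q p)
        ; (inj₂ p) (inj₂ q) → partner-inj (L₂.disj (proj₁ p) (proj₁ q))
        }
      }

  weakenLinkage : ∀ {E′ E A B k} → (∀ {u v} → Step E′ u v → Step E u v) → Linkage E′ A B k → Linkage E A B k
  weakenLinkage f l = record { Linkage l ; walk = λ i → mapWalk f id (Linkage.walk l i) }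

  -- The induction step of Göring's proof, for an edge xy crossing a separation of the remaining graph.
  crossing : ∀ {E′ E A B k} → (∀ {u v} → Step E′ u v → Step E u v) → (S : Sep E′ A B k) →
    ∀ {x y} → σ S x ≡ left → σ S y ≡ right → Step E x y →
    (∀ A B → Linkage E′ A B k ⊎ Sep E′ A B k) →
    Linkage E A B k ⊎ Σ[ S′ ∈ Sep E′ A B k ] ((σ S′ x ≢ left × σ S′ y ≢ left) ⊎ (σ S′ x ≢ right × σ S′ y ≢ right))
  crossing {A = A} {B} E′⊆E S {x} {y} xL yR xy rec with rec A (x ∷ mids (σ S)) | rec (y ∷ mids (σ S)) B
  ... | inj₁ l₁ | inj₁ l₂ = inj₁ (Glue.glued E′⊆E S xL yR xy l₁ l₂)
  ... | inj₂ S′ | _ = inj₂ (uncross S there S′ , inj₁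
        ( (λ eq → B≢L S′ (here refl) (proj₂ (maxS-left {σ S x} eq)))
        , (λ eq → case (trans (≡sym yR) (proj₁ (maxS-left {σ S y} eq))))))
    where case : right ≢ left
          case ()
  ... | inj₁ _ | inj₂ S′ = inj₂ (flipSep (uncross (flipSep S) (there ∘ flip-mids (σ S)) (flipSep S′)) , inj₂
        ( (λ eq → case (trans (≡sym (cong flipSide xL)) (proj₁ (maxS-left {flipSide (σ S x)} (flipSide-to eq)))))
        , (λ eq → A≢R S′ (here refl) (flipSide-to (proj₂ (maxS-left {flipSide (σ S y)} (flipSide-to eq)))))))
    where case : right ≢ left
          case ()

  addEdge : ∀ {E A B k x y} (S : Sep E A B k) → ¬ (σ S x ≡ left × σ S y ≡ right) →
    ¬ (σ S x ≡ right × σ S y ≡ left) → Sep ((x , y) ∷ E) A B k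
  addEdge S ¬lr ¬rl = record { Sep S ; apart = λ
    { (inj₁ (here refl)) u v → ¬lr (u , v)
    ; (inj₁ (there e)) u v → apart S (inj₁ e) u v
    ; (inj₂ (here refl)) u v → ¬rl (v , u)
    ; (inj₂ (there e)) u v → apart S (inj₂ e) u v } }

  sideOf : List V → List V → V → Side
  sideOf A B v with v ∈ˡ? A | v ∈ˡ? B
  ... | yes _ | yes _ = mid
  ... | yes _ | no _  = left
  ... | no _  | _     = right

  sideOf-mid : ∀ A B v → sideOf A B v ≡ mid → v ∈ˡ A × v ∈ˡ B
  sideOf-mid A B v eq with v ∈ˡ? A | v ∈ˡ? B
  sideOf-mid A B v eq | yes a | yes b = a , b
  sideOf-mid A B v () | yes _ | no _
  sideOf-mid A B v () | no _  | _

  sideOf-right : ∀ A B {v} → v ∈ˡ A → sideOf A B v ≢ right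
  sideOf-right A B {v} a with v ∈ˡ? A | v ∈ˡ? B
  ... | yes _ | yes _ = λ ()
  ... | yes _ | no _  = λ ()
  ... | no ¬a | _     = ⊥-elim (¬a a)

  sideOf-left : ∀ A B {v} → v ∈ˡ B → sideOf A B v ≢ left
  sideOf-left A B {v} b with v ∈ˡ? A | v ∈ˡ? B
  ... | yes _ | yes _ = λ ()
  ... | yes _ | no ¬b = ⊥-elim (¬b b)
  ... | no _  | _     = λ ()

  edgeless : ∀ A B k → Linkage [] A B k ⊎ Sep [] A B k
  edgeless A B k with k ≤? length (filter (λ v → (v ∈ˡ? A) ×-dec (v ∈ˡ? B)) (allFin n))
  ... | yes k≤ = inj₁ (record
    { a = pick ; b = pick ; K = λ i v → v ≡ pick i
    ; a∈ = proj₁ ∘ both ; b∈ = proj₂ ∘ both ; walk = λ i → nil refl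
    ; disj = λ p q → inject≤-injective k≤ k≤ _ _ (lookup-injective unique _ _ (trans (≡sym p) q)) })
    where
    common = filter (λ v → (v ∈ˡ? A) ×-dec (v ∈ˡ? B)) (allFin n)
    unique = filter⁺ (λ v → (v ∈ˡ? A) ×-dec (v ∈ˡ? B)) (allFin⁺ n)
    pick : Fin k → V
    pick i = lookup common (inject≤ i k≤)
    both : ∀ i → pick i ∈ˡ A × pick i ∈ˡ B
    both i = proj₂ (∈-filter⁻ (λ v → (v ∈ˡ? A) ×-dec (v ∈ˡ? B)) {xs = allFin n} (∈-lookup (inject≤ i k≤)))
  ... | no k≰ = inj₂ (record
    { σ = sideOf A B ; A≢R = sideOf-right A B ; B≢L = sideOf-left A B
    ; apart = λ { (inj₁ ()) ; (inj₂ ()) }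
    ; order = ℕ.≤-<-trans (length-filter-mono _ _ (sideOf-mid A B) (allFin n)) (ℕ.≰⇒> k≰) })

  -- If the edge `xy` crosses the separation found without it, `crossing` yields either the linkage
  -- or a separation in which `x` and `y` avoid the same side, so that `xy` can be put back. The
  -- last two groups of clauses differ only in the direction in which `xy` crosses.
  menger : ∀ E A B k → Linkage E A B k ⊎ Sep E A B k
  menger [] A B k = edgeless A B k
  menger ((x , y) ∷ E) A B k with menger E A B k
  ... | inj₁ l = inj₁ (weakenLinkage (λ { (inj₁ e) → inj₁ (there e) ; (inj₂ e) → inj₂ (there e) }) l)
  ... | inj₂ S with (σ S x ≟ˢ left) ×-dec (σ S y ≟ˢ right) | (σ S x ≟ˢ right) ×-dec (σ S y ≟ˢ left)
  ...   | no ¬lr | no ¬rl = inj₂ (addEdge S ¬lr ¬rl)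
  ...   | yes (l , r) | _ with crossing (λ { (inj₁ e) → inj₁ (there e) ; (inj₂ e) → inj₂ (there e) }) S l r (inj₁ (here refl)) (λ A B → menger E A B k)
  ...     | inj₁ link = inj₁ link
  ...     | inj₂ (S′ , inj₁ (p , q)) = inj₂ (addEdge S′ (p ∘ proj₁) (q ∘ proj₂))
  ...     | inj₂ (S′ , inj₂ (p , q)) = inj₂ (addEdge S′ (q ∘ proj₂) (p ∘ proj₁))
  menger ((x , y) ∷ E) A B k | inj₂ S | no _ | yes (r , l) with crossing (λ { (inj₁ e) → inj₁ (there e) ; (inj₂ e) → inj₂ (there e) }) S l r (inj₂ (here refl)) (λ A B → menger E A B k)
  ...     | inj₁ link = inj₁ link
  ...     | inj₂ (S′ , inj₁ (p , q)) = inj₂ (addEdge S′ (q ∘ proj₁) (p ∘ proj₂))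
  ...     | inj₂ (S′ , inj₂ (p , q)) = inj₂ (addEdge S′ (p ∘ proj₂) (q ∘ proj₁))

  record TightSep (E : Edges) (A B : List V) (k : ℕ) : Set₁ where
    field
      sep : Sep E A B k
      toA : Linkage E (mids (σ sep)) A (length (mids (σ sep)))
      toB : Linkage E (mids (σ sep)) B (length (mids (σ sep)))

  -- If the separator is not completely linked to `A`, Menger's theorem gives a smaller separation
  -- between it and `A`, and uncrossing turns this into a smaller separation between `A` and `B`;
  -- likewise for `B`. The bound `k` on the order decreases each time.
  tighten : ∀ {E A B} k → Sep E A B k → TightSep E A B k
  tighten zero S with order S
  ... | ()
  tighten {E} {A} {B} (suc k) S
    with menger E (mids (σ S)) A (length (mids (σ S))) | menger E (mids (σ S)) B (length (mids (σ S)))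
  ... | inj₁ l₁ | inj₁ l₂ = record { sep = S ; toA = l₁ ; toB = l₂ }
  ... | inj₂ S′ | _ = lift (tighten k (weakenSep (ℕ.≤-pred (order S)) (uncross S id (flipSep S′))))
    where lift : TightSep E A B k → TightSep E A B (suc k)
          lift t = record { TightSep t ; sep = weakenSep (ℕ.n≤1+n k) (TightSep.sep t) }
  ... | inj₁ _ | inj₂ S′ = lift (tighten k (weakenSep (ℕ.≤-pred (order S))
        (flipSep (uncross (flipSep S) (flip-mids (σ S)) (flipSep S′)))))
    where lift : TightSep E A B k → TightSep E A B (suc k)
          lift t = record { TightSep t ; sep = weakenSep (ℕ.n≤1+n k) (TightSep.sep t) }

  mengerTight : ∀ E A B k → Linkage E A B k ⊎ TightSep E A B k
  mengerTight E A B k with menger E A B k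
  ... | inj₁ l = inj₁ l
  ... | inj₂ S = inj₂ (tighten k S)

-- The Erdős-Szekeres theorem for two relations on a list.

module ErdősSzekeres {A : Set} {_◁_ _▶_ : A → A → Set}
  (◁-trans : ∀ {x y z} → x ◁ y → y ◁ z → x ◁ z) where

  Comparable : A → A → Set
  Comparable x y = y ◁ x ⊎ x ▶ y

  -- Mirsky-style: the greedy ▶-chain D leaves a remainder R that loses one level of ◁.
  record Greedy (xs : List A) : Set where
    field
      D R     : List A
      lengths : length D + length R ≡ length xs
      D▶      : AllPairs _▶_ D
      D⊆      : All (_∈ˡ xs) D
      R⊆      : All (_∈ˡ xs) R
      R-comp  : AllPairs Comparable R
      below   : All (λ r → ∃[ d ] (d ∈ˡ D × d ◁ r)) R

  dichotomy : ∀ {x D} → All (Comparable x) D → All (x ▶_) D ⊎ ∃[ d ] (d ∈ˡ D × d ◁ x)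
  dichotomy [] = inj₁ []
  dichotomy (inj₁ d◁x ∷ _) = inj₂ (_ , here refl , d◁x)
  dichotomy (inj₂ x▶d ∷ cs) with dichotomy cs
  ... | inj₁ all = inj₁ (x▶d ∷ all)
  ... | inj₂ (d , d∈ , d◁x) = inj₂ (d , there d∈ , d◁x)

  greedy : ∀ xs → AllPairs Comparable xs → Greedy xs
  greedy [] [] = record { D = [] ; R = [] ; lengths = refl ; D▶ = [] ; D⊆ = [] ; R⊆ = [] ; R-comp = [] ; below = [] }
  greedy (x ∷ xs) (c ∷ cs) with greedy xs cs
  ... | g with dichotomy {x} (All.map (All.lookup c) (Greedy.D⊆ g))
  ...   | inj₁ all = record
    { D = x ∷ D ; R = R ; lengths = cong suc lengths ; D▶ = all ∷ D▶ ; D⊆ = here refl ∷ All.map there D⊆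
    ; R⊆ = All.map there R⊆ ; R-comp = R-comp
    ; below = All.map (λ (d , d∈ , lt) → d , there d∈ , lt) below }
    where open Greedy g
  ...   | inj₂ any = record
    { D = D ; R = x ∷ R ; lengths = trans (ℕ.+-suc (length D) (length R)) (cong suc lengths) ; D▶ = D▶
    ; D⊆ = All.map there D⊆ ; R⊆ = here refl ∷ All.map there R⊆
    ; R-comp = All.map (All.lookup c) R⊆ ∷ R-comp ; below = any ∷ below }
    where open Greedy g

  -- If `D` has at most `b` members, the remainder still has more than `a * b`. A chain for ◁ found
  -- there is prolonged by the member of `D` below its first element.
  erdős-szekeres : ∀ a b xs → AllPairs Comparable xs → a * b < length xs →
    (Σ[ ys ∈ List A ] (length ys ≡ suc a × All (_∈ˡ xs) ys × AllPairs _◁_ ys)) ⊎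
    (Σ[ ys ∈ List A ] (length ys ≡ suc b × AllPairs _▶_ ys))
  erdős-szekeres zero b (x ∷ xs) _ _ = inj₁ (x ∷ [] , refl , here refl ∷ [] , [] ∷ [])
  erdős-szekeres (suc a) b xs cs ab< with greedy xs cs
  ... | g with suc b ≤? length (Greedy.D g)
  ...   | yes b<D = inj₂ (take (suc b) D , trans (length-take (suc b) D) (ℕ.m≤n⇒m⊓n≡m b<D) , AllPairs.take⁺ (suc b) D▶)
    where open Greedy g
  ...   | no b≮D with erdős-szekeres a b R R-comp (ℕ.+-cancelˡ-< (length D) (a * b) (length R)
                        (ℕ.≤-<-trans (ℕ.+-monoˡ-≤ (a * b) (ℕ.≤-pred (ℕ.≰⇒> b≮D)))
                          (subst (b + a * b <_) (≡sym lengths) ab<)))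
    where open Greedy g
  ...     | inj₂ dec = inj₂ dec
  ...     | inj₁ (y ∷ ys , len , y∈ ∷ ys∈ , y◁ ∷ ys◁) with All.lookup (Greedy.below g) y∈
  ...       | d , d∈ , d◁y = inj₁ (d ∷ y ∷ ys , cong suc len
    , All.lookup (Greedy.D⊆ g) d∈ ∷ All.map (All.lookup (Greedy.R⊆ g)) (y∈ ∷ ys∈)
    , (d◁y ∷ All.map (◁-trans d◁y) y◁) ∷ y◁ ∷ ys◁)

-- Connected vertex sets and chains of them.

module Host {n : ℕ} (_~_ : Fin n → Fin n → Set) (~-sym : ∀ {u v} → u ~ v → v ~ u)
  (_~?_ : ∀ u v → Dec (u ~ v)) where

  V : Set
  V = Fin n

  -- Arbitrary predicates, so that unions, paths and merged blocks can be formed without decision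
  -- procedures; decidability of bags is assumed only in the translation to subgraphs.
  Bag : Set₁
  Bag = V → Set

  -- Connectedness in cut form: there is no nontrivial two-colouring without bichromatic edges.
  Conn : Bag → Set
  Conn K = ∀ (f : V → Bool) → (∀ {u v} → K u → K v → u ~ v → f u ≡ f v) →
    ∀ {u v} → K u → K v → f u ≡ f v

  Touch : Bag → Bag → Set
  Touch P Q = ∃[ u ] ∃[ v ] (P u × Q v × u ~ v)

  Apart : Bag → Bag → Set
  Apart P Q = ∀ v → P v → Q v → ⊥

  apart-sym : ∀ {P Q : Bag} → Apart P Q → Apart Q P
  apart-sym a v q p = a v p q

  apart-∪ : ∀ {P Q Q′ : Bag} → Apart P Q → Apart P Q′ → Apart P (λ v → Q v ⊎ Q′ v)
  apart-∪ a a′ v p (inj₁ q) = a v p q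
  apart-∪ a a′ v p (inj₂ q) = a′ v p q

  touch-sym : ∀ {P Q} → Touch P Q → Touch Q P
  touch-sym (u , v , p , q , e) = v , u , q , p , ~-sym e

  touch-⊆ : ∀ {P P′ Q Q′ : Bag} → (∀ {v} → P v → P′ v) → (∀ {v} → Q v → Q′ v) → Touch P Q → Touch P′ Q′
  touch-⊆ f g (u , v , p , q , e) = u , v , f p , g q , e

  conn-singleton : ∀ x → Conn (_≡ x)
  conn-singleton x f inv refl refl = refl

  conn-∪ : ∀ {P Q : Bag} → Conn P → Conn Q →
    (∀ (f : V → Bool) → (∀ {u v} → (P u ⊎ Q u) → (P v ⊎ Q v) → u ~ v → f u ≡ f v) →
       ∀ {u v} → P u → Q v → f u ≡ f v) →
    Conn (λ v → P v ⊎ Q v)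
  conn-∪ cP cQ bridge f inv (inj₁ p) (inj₁ p′) = cP f (λ a b → inv (inj₁ a) (inj₁ b)) p p′
  conn-∪ cP cQ bridge f inv (inj₁ p) (inj₂ q) = bridge f inv p q
  conn-∪ cP cQ bridge f inv (inj₂ q) (inj₁ p) = ≡sym (bridge f inv p q)
  conn-∪ cP cQ bridge f inv (inj₂ q) (inj₂ q′) = cQ f (λ a b → inv (inj₂ a) (inj₂ b)) q q′

  conn-∪-touch : ∀ {P Q : Bag} → Conn P → Conn Q → Touch P Q → Conn (λ v → P v ⊎ Q v)
  conn-∪-touch cP cQ (u , v , pu , qv , e) = conn-∪ cP cQ λ f inv p q →
    trans (cP f (λ a b → inv (inj₁ a) (inj₁ b)) p pu)
      (trans (inv (inj₁ pu) (inj₂ qv) e) (cQ f (λ a b → inv (inj₂ a) (inj₂ b)) qv q))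

  Touches : ∀ {M : Set} → Bag → List (Bag × M) → Set
  Touches Q [] = ⊤
  Touches Q ((Q′ , _) ∷ _) = Touch Q Q′

  data Chain {M : Set} : List (Bag × M) → Set₁ where
    []   : Chain []
    link : ∀ {Q m L} → Conn Q → Touches Q L → All (λ i → Apart Q (proj₁ i)) L → Chain L → Chain ((Q , m) ∷ L)

  chain-tail : ∀ {M : Set} {i : Bag × M} {L} → Chain (i ∷ L) → Chain L
  chain-tail (link _ _ _ ch) = ch

  absorb : Bag → List (Bag × V) → List (Bag × V)
  absorb Q [] = []
  absorb Q ((Q′ , x) ∷ L) = ((λ v → Q v ⊎ Q′ v) , x) ∷ L

  -- A bag without mark is united with the next bag that has one, so that consecutive bags still
  -- touch; unmarked bags at the end of the list are dropped.
  compress : List (Bag × Maybe V) → List (Bag × V)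
  compress [] = []
  compress ((Q , just x) ∷ L) = (Q , x) ∷ compress L
  compress ((Q , nothing) ∷ L) = absorb Q (compress L)

  marks : List (Bag × V) → List V
  marks = map proj₂

  marks-absorb : ∀ Q L → marks (absorb Q L) ≡ marks L
  marks-absorb Q [] = refl
  marks-absorb Q (_ ∷ L) = refl

  compress-marks : ∀ {Q x L} → (Q , just x) ∈ˡ L → x ∈ˡ marks (compress L)
  compress-marks (here refl) = here refl
  compress-marks {L = (Q , just x) ∷ L} (there m) = there (compress-marks m)
  compress-marks {L = (Q , nothing) ∷ L} (there m) =
    subst (_ ∈ˡ_) (≡sym (marks-absorb Q (compress L))) (compress-marks m)

  compress-marks⁻ : ∀ {x} L → x ∈ˡ marks (compress L) → ∃[ Q ] (Q , just x) ∈ˡ L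
  compress-marks⁻ ((Q , just x) ∷ L) (here refl) = Q , here refl
  compress-marks⁻ ((Q , just x) ∷ L) (there m) with compress-marks⁻ L m
  ... | Q′ , m′ = Q′ , there m′
  compress-marks⁻ ((Q , nothing) ∷ L) m with compress-marks⁻ L (subst (_ ∈ˡ_) (marks-absorb Q (compress L)) m)
  ... | Q′ , m′ = Q′ , there m′

  compress-all : ∀ {P : Bag → Set} → (∀ {Q Q′} → P Q → P Q′ → P (λ v → Q v ⊎ Q′ v)) →
    ∀ {L} → All (P ∘ proj₁) L → All (P ∘ proj₁) (compress L)
  compress-all ∪-closed {[]} [] = []
  compress-all ∪-closed {(Q , just x) ∷ L} (p ∷ ps) = p ∷ compress-all ∪-closed ps
  compress-all {P} ∪-closed {(Q , nothing) ∷ L} (p ∷ ps) = go (compress L) (compress-all ∪-closed ps)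
    where
    go : ∀ L → All (P ∘ proj₁) L → All (P ∘ proj₁) (absorb Q L)
    go [] [] = []
    go (_ ∷ L) (p′ ∷ ps′) = ∪-closed p p′ ∷ ps′

  Marked : Bag × V → Set
  Marked (Q , x) = Q x

  compress-marked : ∀ {L} → All (λ (Q , m) → ∀ x → m ≡ just x → Q x) L → All Marked (compress L)
  compress-marked {[]} [] = []
  compress-marked {(Q , just x) ∷ L} (p ∷ ps) = p x refl ∷ compress-marked ps
  compress-marked {(Q , nothing) ∷ L} (p ∷ ps) = go (compress L) (compress-marked ps)
    where
    go : ∀ L → All Marked L → All Marked (absorb Q L)
    go [] [] = []
    go (_ ∷ L) (p′ ∷ ps′) = inj₂ p′ ∷ ps′

  compress-touches : ∀ {Q} L → Touches Q L → Touches Q (compress L)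
  compress-touches [] t = t
  compress-touches ((Q′ , just x) ∷ L) t = t
  compress-touches {Q} ((Q′ , nothing) ∷ L) t = go (compress L)
    where
    go : ∀ L → Touches Q (absorb Q′ L)
    go [] = tt
    go (_ ∷ L) = touch-⊆ id inj₁ t

  compress-chain : ∀ {L} → Chain L → Chain (compress L)
  compress-chain {[]} [] = []
  compress-chain {(Q , just x) ∷ L} (link c t a ch) = link c (compress-touches L t)
    (compress-all apart-∪ a) (compress-chain ch)
  compress-chain {(Q , nothing) ∷ L} (link c t a ch) =
    go (compress L) (compress-touches L t) (compress-all apart-∪ a) (compress-chain ch)
    where
    go : ∀ L → Touches Q L → All (λ i → Apart Q (proj₁ i)) L → Chain L → Chain (absorb Q L)
    go [] _ _ _ = []
    go ((Q′ , x) ∷ []) t (a ∷ _) (link c′ t′ a′ ch′) = link (conn-∪-touch c c′ t) tt [] ch′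
    go ((Q′ , x) ∷ (Q″ , y) ∷ L) t (a ∷ as) (link c′ t′ a′ ch′) =
      link (conn-∪-touch c c′ t) (touch-⊆ inj₂ id t′)
        (All.zipWith (λ (p , q) → apart-sym (apart-∪ (apart-sym p) (apart-sym q))) (as , a′)) ch′

  marks-distinct : ∀ {L} → Chain L → All Marked L → AllPairs _≢_ (marks L)
  marks-distinct [] [] = []
  marks-distinct {(Q , x) ∷ L} (link _ _ a ch) (p ∷ ps) =
    All.map⁺ (All.zipWith (λ { (ap , q) refl → ap _ p q }) (a , ps)) ∷ marks-distinct ch ps

  -- Disjoint bags have distinct marks; the length of a chain is therefore controlled by where its
  -- marks can lie.
  length-chain≤ : ∀ {L} T → Chain L → All Marked L → (∀ {x} → x ∈ˡ marks L → x ∈ˡ T) → length L ≤ length T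
  length-chain≤ {L} T ch ps sub = subst (_≤ length T) (length-map proj₂ L)
    (length-injection (lookup (marks L)) T (lookup-injective (marks-distinct ch ps) _ _) (λ i → sub (∈-lookup i)))

  module Extend (Ext : V → Bag) (mark : V → Maybe V)
    (root : ∀ {x v} → Ext x v → Ext x x) (ext-conn : ∀ x → Conn (Ext x)) where

    extend : Bag × V → Bag × Maybe V
    extend (Q , x) = (λ v → Q v ⊎ Ext x v) , mark x

    extend-conn : ∀ {Q x} → Conn Q → Q x → Conn (λ v → Q v ⊎ Ext x v)
    extend-conn {Q} {x} c q = conn-∪ c (ext-conn x) λ f inv p e →
      trans (c f (λ a b → inv (inj₁ a) (inj₁ b)) p q)
        (ext-conn x f (λ a b → inv (inj₂ a) (inj₂ b)) (root e) e)

    extend-chain : ∀ {L} → Chain L → All Marked L →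
      (∀ {Q x Q′ y} → (Q , x) ∈ˡ L → (Q′ , y) ∈ˡ L → Apart Q Q′ → Apart (λ v → Q v ⊎ Ext x v) (λ v → Q′ v ⊎ Ext y v)) →
      Chain (map extend L)
    extend-chain [] [] ap = []
    extend-chain {(Q , x) ∷ L} (link c t a ch) (p ∷ ps) ap = link (extend-conn c p) (go L t)
      (All.map⁺ (All.tabulate (λ {i} i∈ → ap (here refl) (there i∈) (All.lookup a i∈))))
      (extend-chain ch ps (λ i∈ j∈ → ap (there i∈) (there j∈)))
      where
      go : ∀ L → Touches Q L → Touches (λ v → Q v ⊎ Ext x v) (map extend L)
      go [] _ = tt
      go (_ ∷ L) t = touch-⊆ inj₁ inj₁ t

  record FunChain (N : ℕ) (Q : Fin N → Bag) : Set where
    field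
      conn  : ∀ i → Conn (Q i)
      disj  : ∀ {i j v} → Q i v → Q j v → i ≡ j
      touch : ∀ {i j} → toℕ j ≡ suc (toℕ i) → Touch (Q i) (Q j)

  funChain : ∀ {M : Set} {L : List (Bag × M)} → Chain L → FunChain (length L) (λ i → proj₁ (lookup L i))
  funChain [] = record { conn = λ () ; disj = λ { {()} } ; touch = λ { {()} } }
  funChain {L = (Q , x) ∷ L} (link c t a ch) = record
    { conn = λ { zero → c ; (suc i) → conn i }
    ; disj = λ
      { {zero} {zero} p q → refl
      ; {zero} {suc j} p q → ⊥-elim (All.lookup a (∈-lookup j) _ p q)
      ; {suc i} {zero} p q → ⊥-elim (All.lookup a (∈-lookup i) _ q p)
      ; {suc i} {suc j} p q → cong suc (disj p q) }
    ; touch = λ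
      { {zero} {suc j} eq → first L t j (ℕ.suc-injective eq)
      ; {suc i} {suc j} eq → touch (ℕ.suc-injective eq) }
    }
    where
    open FunChain (funChain ch)
    first : ∀ L → Touches Q L → ∀ j → toℕ j ≡ 0 → Touch Q (proj₁ (lookup L j))
    first (_ ∷ L) t zero _ = t

  reverseChain : ∀ {N Q} → FunChain N Q → FunChain N (Q ∘ opposite)
  reverseChain {N} fc = record
    { conn = conn ∘ opposite
    ; disj = λ {i} {j} p q → trans (≡sym (opposite-involutive i)) (trans (cong opposite (disj p q)) (opposite-involutive j))
    ; touch = λ {i} {j} eq → touch-sym (touch (step i j eq))
    }
    where
    open FunChain fc
    step : ∀ (i j : Fin N) → toℕ j ≡ suc (toℕ i) → toℕ (opposite i) ≡ suc (toℕ (opposite j))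
    step i j eq = trans (opposite-prop i) (trans (cong (N ∸_) (≡sym eq))
      (trans (≡sym (ℕ.m∸n+n≡m {N ∸ toℕ j} {1} (ℕ.m<n⇒0<n∸m (toℕ<n j))))
        (trans (ℕ.+-comm (N ∸ toℕ j ∸ 1) 1)
          (cong suc (trans (ℕ.∸-+-assoc N (toℕ j) 1) (trans (cong (N ∸_) (ℕ.+-comm (toℕ j) 1)) (≡sym (opposite-prop j))))))))

  module SubChain {N M} {Q : Fin M → Bag} (fc : FunChain M Q) (p : Fin N → Fin M)
    (mono : ∀ {i j} → toℕ i < toℕ j → toℕ (p i) < toℕ (p j)) where
    open FunChain fc

    -- The indices from `p i` up to, but excluding, the next value of `p`. Quantifying over all
    -- later `j` lets the last block run to the end of the chain; bags before the first block are
    -- left out.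
    Block : Fin N → Fin M → Set
    Block i s = toℕ (p i) ≤ toℕ s × (∀ j → toℕ i < toℕ j → toℕ s < toℕ (p j))

    merged : Fin N → Bag
    merged i v = ∃[ s ] (Block i s × Q s v)

    first-block : ∀ i → Block i (p i)
    first-block i = ℕ.≤-refl , λ j → mono

    merged⊇ : ∀ {i v} → Q (p i) v → merged i v
    merged⊇ {i} q = p i , first-block i , q

    block-unique : ∀ {i j s} → Block i s → Block j s → i ≡ j
    block-unique {i} {j} (lo , hi) (lo′ , hi′) with ℕ.<-cmp (toℕ i) (toℕ j)
    ... | tri< i<j _ _ = ⊥-elim (ℕ.<⇒≱ (hi j i<j) lo′)
    ... | tri≈ _ eq _ = toℕ-injective eq
    ... | tri> _ _ j<i = ⊥-elim (ℕ.<⇒≱ (hi′ i j<i) lo)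

    pred-step : ∀ (s s′ : Fin M) d → toℕ s ≡ suc d + toℕ s′ → ∃[ t ] (toℕ t ≡ d + toℕ s′ × toℕ s ≡ suc (toℕ t))
    pred-step s s′ d eq = fromℕ< lt , toℕ-fromℕ< lt , trans eq (cong suc (≡sym (toℕ-fromℕ< lt)))
      where lt = ℕ.<-trans (subst (_ <_) (≡sym eq) (ℕ.n<1+n _)) (toℕ<n s)

    block-down : ∀ {i s s′} → Block i s → toℕ (p i) ≤ toℕ s′ → toℕ s′ ≤ toℕ s → Block i s′
    block-down (lo , hi) lo′ le = lo′ , λ j lt → ℕ.≤-<-trans le (hi j lt)

    down : ∀ {i} (f : V → Bool) → (∀ {u v} → merged i u → merged i v → u ~ v → f u ≡ f v) →
      ∀ d {s s′} → Block i s → Block i s′ → toℕ s ≡ d + toℕ s′ → ∀ {u v} → Q s u → Q s′ v → f u ≡ f v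
    down f inv zero {s} b b′ eq q q′ with toℕ-injective eq
    ... | refl = conn s f (λ k l → inv (s , b , k) (s , b , l)) q q′
    down f inv (suc d) {s} {s′} b b′ eq q q′ with pred-step s s′ d eq
    ... | t , eq₁ , eq₂
      with touch eq₂
         | block-down b (ℕ.≤-trans (proj₁ b′) (subst (toℕ s′ ≤_) (≡sym eq₁) (ℕ.m≤n+m _ d)))
             (subst (toℕ t ≤_) (≡sym eq₂) (ℕ.n≤1+n _))
    ...   | x , y , qx , qy , e | bt = trans (conn s f (λ k l → inv (s , b , k) (s , b , l)) q qy)
            (trans (≡sym (inv (t , bt , qx) (s , b , qy) e)) (down f inv d bt b′ eq₁ qx q′))

    merged-conn : ∀ i → Conn (merged i)
    merged-conn i f inv (s , b , q) (s′ , b′ , q′) with ℕ.≤-total (toℕ s′) (toℕ s)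
    ... | inj₁ le = down f inv (toℕ s ∸ toℕ s′) b b′ (≡sym (ℕ.m∸n+n≡m le)) q q′
    ... | inj₂ le = ≡sym (down f inv (toℕ s′ ∸ toℕ s) b′ b (≡sym (ℕ.m∸n+n≡m le)) q′ q)

    mono-≤ : ∀ {i j} → toℕ i ≤ toℕ j → toℕ (p i) ≤ toℕ (p j)
    mono-≤ {i} {j} le with ℕ.m≤n⇒m<n∨m≡n le
    ... | inj₁ lt = ℕ.<⇒≤ (mono lt)
    ... | inj₂ eq rewrite toℕ-injective {i = i} {j} eq = ℕ.≤-refl

    merged-touch : ∀ {i j} → toℕ j ≡ suc (toℕ i) → Touch (merged i) (merged j)
    merged-touch {i} {j} eq with mono {i} {j} (subst (toℕ i <_) (≡sym eq) ℕ.≤-refl)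
    ... | lt with pred-step (p j) (p i) (toℕ (p j) ∸ suc (toℕ (p i)))
                   (trans (≡sym (ℕ.m∸n+n≡m lt)) (ℕ.+-suc _ (toℕ (p i))))
    ...   | s , eq₁ , eq₂ = touch-⊆ (λ q → s , block , q) merged⊇ (touch eq₂)
      where
      block : Block i s
      block = subst (toℕ (p i) ≤_) (≡sym eq₁) (ℕ.m≤n+m _ _)
            , λ k i<k → ℕ.<-≤-trans (subst (toℕ s <_) (≡sym eq₂) ℕ.≤-refl)
                          (mono-≤ {j} {k} (subst (_≤ toℕ k) (≡sym eq) i<k))

    subChain : FunChain N merged
    subChain = record
      { conn = merged-conn
      ; disj = λ { (s , b , q) (s′ , b′ , q′) → block-unique b (subst (Block _) (disj q′ q) b′) }
      ; touch = merged-touch }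

-- The search state: lengthening the chain and shrinking `C`.

module Process {n : ℕ} (_~_ : Fin n → Fin n → Set) (~-sym : ∀ {u v} → u ~ v → v ~ u)
  (_~?_ : ∀ u v → Dec (u ~ v)) (U : Subset n) where

  open Host _~_ ~-sym _~?_
  open Menger n hiding (V)
  open Sep

  -- The parts `just true` and `just false` are the two rails, `nothing` is the subdividing vertex
  -- of the rung.
  record Ladder (N : ℕ) : Set₁ where
    field
      part : Maybe Bool → Fin N → Bag
      conn : ∀ a i → Conn (part a i)
      disj : ∀ {a b i j v} → part a i v → part b j v → a ≡ b × i ≡ j
      rail : ∀ s {i j} → toℕ j ≡ suc (toℕ i) → Touch (part (just s) i) (part (just s) j)
      rung : ∀ s i → Touch (part nothing i) (part (just s) i)
      inU  : ∀ {a i v} → part a i v → v ∈ U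

  record State (C : Subset n) (L : List (Bag × V)) : Set₁ where
    field
      chain  : Chain L
      marked : All Marked L
      inU    : All (λ (Q , _) → ∀ v → Q v → v ∈ U) L
      offC   : All (λ (Q , _) → ∀ v → Q v → v ∉ C) L
      C⊆U    : C ⊆ U
      bdry   : ∀ {u v} → u ∈ C → v ∈ U → v ∉ C → u ~ v → v ∈ˡ marks L

  record Grown (C : Subset n) (L : List (Bag × V)) : Set₁ where
    field
      v     : V
      v∈C   : v ∈ C
      L′    : List (Bag × V)
      state : State (remove C v) L′
      short : length L′ ≤ suc (length L)

  -- Depth-first search with the head of the chain as top of the stack. A mark without neighbour in
  -- `C` does not belong to the boundary and is popped; otherwise one of its neighbours in `C` is
  -- pushed, as a singleton bag touching the head.
  grow : ∀ {C L} → State C L → Nonempty C → Grown C L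
  grow {C} {[]} st (v , v∈) = record
    { v = v ; v∈C = v∈ ; L′ = ((_≡ v) , v) ∷ []
    ; state = record
      { chain = link (conn-singleton v) tt [] [] ; marked = refl ∷ []
      ; inU = (λ { _ refl → C⊆U v∈ }) ∷ [] ; offC = (λ { _ refl v∈′ → proj₂ (∈-remove⁻ v∈′) refl }) ∷ []
      ; C⊆U = C⊆U ∘ proj₁ ∘ ∈-remove⁻ ; bdry = bdry′ }
    ; short = ℕ.≤-refl }
    where
    open State st
    bdry′ : ∀ {u w} → u ∈ remove C v → w ∈ U → w ∉ remove C v → u ~ w → w ∈ˡ v ∷ []
    bdry′ {u} {w} u∈ w∈U w∉ e with w ≟ v
    ... | yes refl = here refl
    ... | no w≢v with bdry (proj₁ (∈-remove⁻ u∈)) w∈U (λ w∈ → w∉ (∈-remove⁺ w∈ w≢v)) e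
    ...   | ()
  grow {C} {(Q , x) ∷ L} st ne with any? (λ v → (v ∈? C) ×-dec (v ~? x))
  ... | no none = record { Grown (grow tail ne) ; short = ℕ.m≤n⇒m≤1+n (Grown.short (grow tail ne)) }
    where
    open State st
    tail : State C L
    tail = record
      { chain = chain-tail chain ; marked = All.tail marked ; inU = All.tail inU ; offC = All.tail offC
      ; C⊆U = C⊆U ; bdry = bdry′ }
      where
      bdry′ : ∀ {u v} → u ∈ C → v ∈ U → v ∉ C → u ~ v → v ∈ˡ marks L
      bdry′ {u} u∈ v∈ v∉ e with bdry u∈ v∈ v∉ e
      ... | here refl = ⊥-elim (none (u , u∈ , e))
      ... | there m = m
  ... | yes (v , v∈ , e) = record
    { v = v ; v∈C = v∈ ; L′ = ((_≡ v) , v) ∷ (Q , x) ∷ L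
    ; state = record
      { chain = link (conn-singleton v) (v , x , refl , All.head marked , e)
          (All.map (λ { off w refl k → off v k v∈ }) offC) chain
      ; marked = refl ∷ marked ; inU = (λ { _ refl → C⊆U v∈ }) ∷ inU
      ; offC = (λ { _ refl v∈′ → proj₂ (∈-remove⁻ v∈′) refl }) ∷ All.map (λ off w k w∈ → off w k (proj₁ (∈-remove⁻ w∈))) offC
      ; C⊆U = C⊆U ∘ proj₁ ∘ ∈-remove⁻ ; bdry = bdry′ }
    ; short = ℕ.≤-refl }
    where
    open State st
    bdry′ : ∀ {u w} → u ∈ remove C v → w ∈ U → w ∉ remove C v → u ~ w → w ∈ˡ v ∷ x ∷ marks L
    bdry′ {u} {w} u∈ w∈U w∉ e′ with w ≟ v
    ... | yes refl = here refl
    ... | no w≢v = there (bdry (proj₁ (∈-remove⁻ u∈)) w∈U (λ w∈ → w∉ (∈-remove⁺ w∈ w≢v)) e′)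

  module Boundary {C L} (st : State C L) where
    open State st

    -- Edges between two boundary vertices are left out, so that every linking path has an
    -- interior; it becomes the middle vertex of a subdivided rung.
    edge? : ∀ (p : V × V) → Dec (proj₁ p ∈ C × proj₂ p ∈ U × proj₁ p ~ proj₂ p)
    edge? (u , v) = (u ∈? C) ×-dec ((v ∈? U) ×-dec (u ~? v))

    E : Edges
    E = filter edge? (cartesianProduct (allFin n) (allFin n))

    E⁺ : ∀ {u v} → u ∈ C → v ∈ U → u ~ v → Step E u v
    E⁺ {u} {v} u∈ v∈ e = inj₁ (∈-filter⁺ edge? (∈-cartesianProduct⁺ (∈-allFin u) (∈-allFin v)) (u∈ , v∈ , e))

    E⁻ : ∀ {u v} → (u , v) ∈ˡ E → u ∈ C × v ∈ U × u ~ v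
    E⁻ m = proj₂ (∈-filter⁻ edge? {xs = cartesianProduct (allFin n) (allFin n)} m)

    step-~ : ∀ {u v} → Step E u v → u ~ v
    step-~ (inj₁ m) = proj₂ (proj₂ (E⁻ m))
    step-~ (inj₂ m) = ~-sym (proj₂ (proj₂ (E⁻ m)))

    step-C : ∀ {u v} → Step E u v → u ∈ C ⊎ v ∈ C
    step-C (inj₁ m) = inj₁ (proj₁ (E⁻ m))
    step-C (inj₂ m) = inj₂ (proj₁ (E⁻ m))

    step-source : ∀ {u v} → Step E u v → u ∈ C ⊎ u ∈ˡ marks L
    step-source (inj₁ m) = inj₁ (proj₁ (E⁻ m))
    step-source {u} (inj₂ m) with u ∈? C
    ... | yes u∈ = inj₁ u∈
    ... | no u∉ = let v∈ , u∈U , e = E⁻ m in inj₂ (bdry v∈ u∈U u∉ e)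

    marks-off : ∀ {v} → v ∈ˡ marks L → v ∉ C
    marks-off v∈ with ∈-map⁻ proj₂ v∈
    ... | (Q , x) , i∈ , refl = All.lookup offC i∈ _ (All.lookup marked i∈)

    -- `C` is replaced by its part on the side of `Keep`, whose marks stay. The bags with marks in
    -- `Move` are prolonged along the paths of `l`, and their marks advance to the separator. Those
    -- that receive no path lose their mark and are merged away by `compress`.
    module Shrink (Keep Move : List V) (marks⊆ : ∀ {x} → x ∈ˡ marks L → x ∈ˡ Keep ⊎ x ∈ˡ Move)
      (Move⊆ : ∀ {x} → x ∈ˡ Move → x ∈ˡ marks L) (Keep⊆ : ∀ {x} → x ∈ˡ Keep → x ∈ˡ marks L)
      (separate : ∀ {x} → x ∈ˡ Keep → x ∈ˡ Move → ⊥)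
      {k} (S : Sep E Keep Move k) (l : Linkage E (mids (σ S)) Move (length (mids (σ S)))) where

      open Linkage l
      open Truncate S

      -- The walk up to its first vertex in `Move`. Stopping there gives `uniq`, so that the path
      -- runs through no other mark of `Move`.
      record Reach (K : Bag) (u : V) : Set₁ where
        field
          W    : Bag
          root : W u
          conn : Conn W
          W⊆K  : ∀ {v} → W v → K v
          z    : V
          z∈   : z ∈ˡ Move
          Wz   : W z
          uniq : ∀ {v} → W v → v ∈ˡ Move → v ≡ z
          W⊆   : ∀ {v} → W v → v ∈ C ⊎ v ∈ˡ marks L

      reach : ∀ {K u b} → b ∈ˡ Move → Walk E K u b → Reach K u
      reach {K} {u} b∈ w with u ∈ˡ? Move
      ... | yes u∈ = record
        { W = _≡ u ; root = refl ; conn = conn-singleton u ; W⊆K = λ { refl → source w }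
        ; z = u ; z∈ = u∈ ; Wz = refl ; uniq = λ { refl _ → refl } ; W⊆ = λ { refl → inj₂ (Move⊆ u∈) } }
      reach b∈ (nil _) | no u∉ = ⊥-elim (u∉ b∈)
      reach {u = u} b∈ (cons {v = v} k s w) | no u∉ with reach b∈ w
      ... | r = record
        { W = λ x → x ≡ u ⊎ W x ; root = inj₁ refl
        ; conn = conn-∪-touch (conn-singleton u) conn (u , v , refl , root , step-~ s)
        ; W⊆K = λ { (inj₁ refl) → k ; (inj₂ x) → W⊆K x }
        ; z = z ; z∈ = z∈ ; Wz = inj₂ Wz
        ; uniq = λ { (inj₁ refl) m → ⊥-elim (u∉ m) ; (inj₂ x) m → uniq x m }
        ; W⊆ = λ { (inj₁ refl) → step-source s ; (inj₂ x) → W⊆ x } }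
        where open Reach r

      a-onto : ∀ {t} → t ∈ˡ mids (σ S) → ∃[ j ] a j ≡ t
      a-onto = injection-onto a _ a-inj a∈ ℕ.≤-refl

      mid-end : ∀ {j v} → K j v → σ S v ≡ mid → v ≡ a j
      mid-end kv m with a-onto (∈-mids⁺ (σ S) m)
      ... | j′ , refl with disj kv (source (walk j′))
      ... | refl = refl

      reached : ∀ j → Reach (λ v → K j v × σ S v ≢ left) (a j)
      reached j = reach (b∈ j) (suffix′ mid-end (B≢L S (b∈ j)) (walk j))

      module R j = Reach (reached j)

      -- Ext x is the path joining x to a separator vertex, which replaces x as the mark.
      Ext : V → Bag
      Ext x v = ∃[ j ] (R.z j ≡ x × ¬ a j ∈ˡ Keep × R.W j v)

      mark : V → Maybe V
      mark x with x ∈ˡ? Keep | any? (λ j → (R.z j ≟ x) ×-dec ¬? (a j ∈ˡ? Keep))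
      ... | yes _ | _           = just x
      ... | no _  | yes (j , _) = just (a j)
      ... | no _  | no _        = nothing

      ext-root : ∀ {x v} → Ext x v → Ext x x
      ext-root (j , refl , ∉ , _) = j , refl , ∉ , R.Wz j

      z-inj : ∀ {i j} → R.z i ≡ R.z j → i ≡ j
      z-inj {i} {j} eq = disj (proj₁ (R.W⊆K i (R.Wz i))) (subst (K j) (≡sym eq) (proj₁ (R.W⊆K j (R.Wz j))))

      ext-conn : ∀ x → Conn (Ext x)
      ext-conn x f inv (i , eq , ∉ , w) (j , eq′ , _ , w′) with z-inj (trans eq (≡sym eq′))
      ... | refl = R.conn i f (λ p q → inv (i , eq , ∉ , p) (i , eq , ∉ , q)) w w′

      -- By `uniq`, a mark on the path other than `x` would lie in `Keep`. It is not `left`, since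
      -- the path was truncated, nor `right`, since `Keep` avoids that side. If it is `mid` it is
      -- the starting point `a j`, which is not in `Keep`.
      ext⊆ : ∀ {x v} → Ext x v → v ∈ C ⊎ v ≡ x
      ext⊆ (j , refl , ∉ , w) with R.W⊆ j w
      ... | inj₁ v∈C = inj₁ v∈C
      ... | inj₂ m with marks⊆ m
      ...   | inj₂ v∈M = inj₂ (R.uniq j w v∈M)
      ...   | inj₁ v∈K with σ S _ in eq | R.W⊆K j w
      ...     | left  | _ , ≢L = ⊥-elim (≢L eq)
      ...     | mid   | k , _  = ⊥-elim (∉ (subst (_∈ˡ Keep) (mid-end k eq) v∈K))
      ...     | right | _      = ⊥-elim (A≢R S v∈K eq)

      ext-disj : ∀ {x y v} → Ext x v → Ext y v → x ≡ y
      ext-disj (i , refl , _ , w) (j , refl , _ , w′) =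
        cong R.z (disj (proj₁ (R.W⊆K i w)) (proj₁ (R.W⊆K j w′)))

      mark-keep : ∀ {x} → x ∈ˡ Keep → mark x ≡ just x
      mark-keep {x} x∈ with x ∈ˡ? Keep | any? (λ j → (R.z j ≟ x) ×-dec ¬? (a j ∈ˡ? Keep))
      ... | yes _ | _ = refl
      ... | no x∉ | _ = ⊥-elim (x∉ x∈)

      mark-move : ∀ j → ¬ a j ∈ˡ Keep → mark (R.z j) ≡ just (a j)
      mark-move j ∉ with R.z j ∈ˡ? Keep | any? (λ j′ → (R.z j′ ≟ R.z j) ×-dec ¬? (a j′ ∈ˡ? Keep))
      ... | yes z∈ | _ = ⊥-elim (separate z∈ (R.z∈ j))
      ... | no _ | yes (j′ , eq , _) = cong (just ∘ a) (z-inj eq)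
      ... | no _ | no none = ⊥-elim (none (j , refl , ∉))

      mark⁻ : ∀ {x y} → mark x ≡ just y → (x ≡ y × x ∈ˡ Keep) ⊎ ∃[ j ] (R.z j ≡ x × ¬ a j ∈ˡ Keep × y ≡ a j)
      mark⁻ {x} eq with x ∈ˡ? Keep | any? (λ j → (R.z j ≟ x) ×-dec ¬? (a j ∈ˡ? Keep)) | eq
      ... | yes x∈ | _ | refl = inj₁ (refl , x∈)
      ... | no _ | yes (j , e , ∉) | refl = inj₂ (j , e , ∉ , refl)
      ... | no _ | no _ | ()

      open Extend Ext mark ext-root ext-conn

      inL? : ∀ v → Dec (v ∈ C × σ S v ≡ left)
      inL? v = (v ∈? C) ×-dec (σ S v ≟ˢ left)

      C-left : Subset n
      C-left = comprehension inL?

      L′ : List (Bag × V)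
      L′ = compress (map extend L)

      all-extend : ∀ {P : Bag → Set} {L₀} → (∀ {i} → i ∈ˡ L₀ → P (proj₁ (extend i))) → All (P ∘ proj₁) (map extend L₀)
      all-extend h = All.map⁺ (All.tabulate h)

      extended : Chain (map extend L)
      extended = extend-chain chain marked λ {Q} {x} {Q′} {y} i∈ j∈ ap → λ
        { v (inj₁ q) (inj₁ q′) → ap v q q′
        ; v (inj₁ q) (inj₂ e) → [ All.lookup offC i∈ _ q , (λ { refl → ap v q (All.lookup marked j∈) }) ]′ (ext⊆ e)
        ; v (inj₂ e) (inj₁ q′) → [ All.lookup offC j∈ _ q′ , (λ { refl → ap v (All.lookup marked i∈) q′ }) ]′ (ext⊆ e)
        ; v (inj₂ e) (inj₂ e′) → ap y (subst Q (ext-disj e e′) (All.lookup marked i∈)) (All.lookup marked j∈) }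

      mark-in : ∀ {Q x y} → (Q , x) ∈ˡ L → mark x ≡ just y → Q y ⊎ Ext x y
      mark-in i∈ eq with mark⁻ eq
      ... | inj₁ (refl , _) = inj₁ (All.lookup marked i∈)
      ... | inj₂ (j , e , ∉ , refl) = inj₂ (j , e , ∉ , R.root j)

      keep-mark : ∀ {x y} → x ∈ˡ marks L → mark x ≡ just y → y ∈ˡ marks L′
      keep-mark x∈ eq with ∈-map⁻ proj₂ x∈
      ... | (Q , x) , i∈ , refl = compress-marks (subst (λ m → (proj₁ (extend (Q , x)) , m) ∈ˡ map extend L) eq (∈-map⁺ extend i∈))

      -- A neighbour of the new set is not `right`. In the separator it is in `Keep` or is some
      -- `a j`, the new mark of its path. On the left but outside the new set it lies outside `C`,
      -- hence was marked, and by `Keep` because `Move` avoids the left side.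
      bdry′ : ∀ {u v} → u ∈ C-left → v ∈ U → v ∉ C-left → u ~ v → v ∈ˡ marks L′
      bdry′ {u} {v} u∈ v∈U v∉ e with ∈-comprehension⁻ inL? u∈
      ... | u∈C , uL = result
        where
        v≢R : σ S v ≢ right
        v≢R = apart S (E⁺ u∈C v∈U e) uL
        kept : v ∈ˡ Keep → v ∈ˡ marks L′
        kept v∈K = keep-mark (Keep⊆ v∈K) (mark-keep v∈K)
        middle : v ∈ˡ mids (σ S) → v ∈ˡ marks L′
        middle m with v ∈ˡ? Keep
        ... | yes v∈K = kept v∈K
        ... | no v∉K with a-onto m
        ...   | j , refl = keep-mark (Move⊆ (R.z∈ j)) (mark-move j v∉K)
        result : v ∈ˡ marks L′
        result with σ S v in eq
        ... | right = ⊥-elim (v≢R eq)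
        ... | mid = middle (∈-mids⁺ (σ S) eq)
        ... | left with marks⊆ (bdry u∈C v∈U (λ v∈C → v∉ (∈-comprehension⁺ inL? (v∈C , eq))) e)
        ...   | inj₁ v∈K = kept v∈K
        ...   | inj₂ v∈M = ⊥-elim (B≢L S v∈M eq)

      state : State C-left L′
      state = record
        { chain = compress-chain extended
        ; marked = compress-marked (All.map⁺ (All.tabulate λ i∈ _ → mark-in i∈))
        ; inU = compress-all (λ f g v → [ f v , g v ]′)
            (all-extend λ i∈ v → [ All.lookup inU i∈ v , (λ e → [ C⊆U , (λ { refl → All.lookup inU i∈ v (All.lookup marked i∈) }) ]′ (ext⊆ e)) ]′)
        ; offC = compress-all (λ f g v → [ f v , g v ]′)
            (all-extend λ i∈ → λ
              { _ (inj₁ q) v∈ → All.lookup offC i∈ _ q (proj₁ (∈-comprehension⁻ inL? v∈))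
              ; _ (inj₂ (j , _ , _ , w)) v∈ → proj₂ (R.W⊆K j w) (proj₂ (∈-comprehension⁻ inL? v∈)) })
        ; C⊆U = λ v∈ → C⊆U (proj₁ (∈-comprehension⁻ inL? v∈))
        ; bdry = bdry′ }

      short : length L′ ≤ length Keep + length (mids (σ S))
      short = subst (length L′ ≤_) (length-++ Keep)
        (length-chain≤ (Keep ++ mids (σ S)) (State.chain state) (State.marked state) inT)
        where
        inT : ∀ {x} → x ∈ˡ marks L′ → x ∈ˡ Keep ++ mids (σ S)
        inT m with compress-marks⁻ (map extend L) m
        ... | Q , i∈ with ∈-map⁻ extend i∈
        ...   | (Q′ , y) , j∈ , eq with mark⁻ (≡sym (cong proj₂ eq))
        ...     | inj₁ (refl , y∈) = ∈-++⁺ˡ y∈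
        ...     | inj₂ (j , _ , _ , refl) = ∈-++⁺ʳ Keep (a∈ j)

-- Obtaining a ladder or a cut from the search.

module Core {n : ℕ} (_~_ : Fin n → Fin n → Set) (~-sym : ∀ {u v} → u ~ v → v ~ u)
  (_~?_ : ∀ u v → Dec (u ~ v)) (U : Subset n) where

  open Host _~_ ~-sym _~?_
  open Menger n hiding (V)
  open Sep
  open Process _~_ ~-sym _~?_ U

  chain-++ˡ : ∀ {M : Set} (Ys : List (Bag × M)) {Zs} → Chain (Ys ++ Zs) → Chain Ys
  chain-++ˡ [] ch = []
  chain-++ˡ (_ ∷ []) (link c t a ch) = link c tt [] []
  chain-++ˡ (_ ∷ y ∷ Ys) (link c t a ch) = link c t (All.++⁻ˡ (y ∷ Ys) a) (chain-++ˡ (y ∷ Ys) ch)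

  chain-++ʳ : ∀ {M : Set} (Ys : List (Bag × M)) {Zs} → Chain (Ys ++ Zs) → Chain Zs
  chain-++ʳ [] ch = ch
  chain-++ʳ (_ ∷ Ys) ch = chain-++ʳ Ys (chain-tail ch)

  cross-apart : ∀ {M : Set} (Ys : List (Bag × M)) {Zs i j} → Chain (Ys ++ Zs) →
    i ∈ˡ Ys → j ∈ˡ Zs → Apart (proj₁ i) (proj₁ j)
  cross-apart (_ ∷ Ys) (link c t a ch) (here refl) j∈ = All.lookup (All.++⁻ʳ Ys a) j∈
  cross-apart (_ ∷ Ys) (link c t a ch) (there i∈) j∈ = cross-apart Ys ch i∈ j∈

  position : ∀ {L x} → x ∈ˡ marks L → ∃[ q ] proj₂ (lookup L q) ≡ x
  position x∈ with ∈-map⁻ proj₂ x∈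
  ... | i , i∈ , refl = index i∈ , cong proj₂ (≡sym (lookup-index i∈))

  module Link {C Ys Zs} (st : State C (Ys ++ Zs)) where
    open State st
    open Boundary st

    separate : ∀ {x} → x ∈ˡ marks Ys → x ∈ˡ marks Zs → ⊥
    separate y∈ z∈ with ∈-map⁻ proj₂ y∈ | ∈-map⁻ proj₂ z∈
    ... | (Q , x) , i∈ , refl | (Q′ , .x) , j∈ , refl = cross-apart Ys chain i∈ j∈ x
          (All.lookup (All.++⁻ˡ Ys marked) i∈) (All.lookup (All.++⁻ʳ Ys marked) j∈)

    marks⁻ : ∀ {x} → x ∈ˡ marks (Ys ++ Zs) → x ∈ˡ marks Ys ⊎ x ∈ˡ marks Zs
    marks⁻ m = ∈-++⁻ (marks Ys) (subst (_ ∈ˡ_) (map-++ proj₂ Ys Zs) m)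

    Y⊆ : ∀ {x} → x ∈ˡ marks Ys → x ∈ˡ marks (Ys ++ Zs)
    Y⊆ m = subst (_ ∈ˡ_) (≡sym (map-++ proj₂ Ys Zs)) (∈-++⁺ˡ m)

    Z⊆ : ∀ {x} → x ∈ˡ marks Zs → x ∈ˡ marks (Ys ++ Zs)
    Z⊆ m = subst (_ ∈ˡ_) (≡sym (map-++ proj₂ Ys Zs)) (∈-++⁺ʳ (marks Ys) m)

    record Half (K : Bag) (u : V) : Set₁ where
      field
        W    : Bag
        root : W u
        conn : Conn W
        W⊆C  : ∀ {v} → W v → v ∈ C
        W⊆K  : ∀ {v} → W v → K v
        z    : V
        z∈   : z ∈ˡ marks Zs
        Kz   : K z
        zW   : Touch W (_≡ z)

    record Rung (K : Bag) : Set₁ where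
      field
        {start} : V
        half : Half K start
        y    : V
        y∈   : y ∈ˡ marks Ys
        Ky   : K y
        yW   : Touch (Half.W half) (_≡ y)
      open Half half public

    -- The walk is read from its end. A `Half` is a piece inside `C` ending next to a mark of `Zs`;
    -- another mark of `Zs` restarts it and a mark of `Ys` completes the rung, whose interior
    -- therefore lies in `C`.
    progress : ∀ {K u b} → b ∈ˡ marks Zs → Walk E K u b → Rung K ⊎ Half K u ⊎ u ∈ˡ marks Zs
    progress b∈ (nil _) = inj₂ (inj₂ b∈)
    progress {u = u} b∈ (cons {v = v} k s w) with progress b∈ w
    ... | inj₁ r = inj₁ r
    -- Every edge of `E` has an end in `C`, so a vertex before a mark of `Zs` is available as
    -- interior of the rung.
    ... | inj₂ (inj₂ v∈Z) with step-C s
    ...   | inj₂ v∈C = ⊥-elim (marks-off (Z⊆ v∈Z) v∈C)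
    ...   | inj₁ u∈C = inj₂ (inj₁ (record
      { W = _≡ u ; root = refl ; conn = conn-singleton u ; W⊆C = λ { refl → u∈C } ; W⊆K = λ { refl → k }
      ; z = v ; z∈ = v∈Z ; Kz = source w ; zW = u , v , refl , refl , step-~ s }))
    progress {u = u} b∈ (cons {v = v} k s w) | inj₂ (inj₁ h) with step-source s
    ... | inj₁ u∈C = inj₂ (inj₁ (record
      { W = λ x → x ≡ u ⊎ W x ; root = inj₁ refl
      ; conn = conn-∪-touch (conn-singleton u) conn (u , v , refl , root , step-~ s)
      ; W⊆C = λ { (inj₁ refl) → u∈C ; (inj₂ x) → W⊆C x }
      ; W⊆K = λ { (inj₁ refl) → k ; (inj₂ x) → W⊆K x }
      ; z = z ; z∈ = z∈ ; Kz = Kz ; zW = touch-⊆ inj₂ id zW }))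
      where open Half h
    ... | inj₂ m with marks⁻ m
    ...   | inj₂ u∈Z = inj₂ (inj₂ u∈Z)
    ...   | inj₁ u∈Y = inj₁ (record
      { half = h ; y = u ; y∈ = u∈Y ; Ky = k ; yW = v , u , Half.root h , refl , ~-sym (step-~ s) })

    module Rungs {k} (l : Linkage E (marks Ys) (marks Zs) k) (len : length Ys ≤ k) where
      open Linkage l using (K; a∈; b∈; walk; disj)

      abstract
        rungOf : ∀ i → Rung (K i)
        rungOf i with progress (b∈ i) (walk i)
        ... | inj₁ r = r
        ... | inj₂ (inj₁ h) = ⊥-elim (marks-off (Y⊆ (a∈ i)) (Half.W⊆C h (Half.root h)))
        ... | inj₂ (inj₂ a∈Z) = ⊥-elim (separate (a∈ i) a∈Z)

      module R i = Rung (rungOf i)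

      y-inj : ∀ {i j} → R.y i ≡ R.y j → i ≡ j
      y-inj {i} {j} eq = disj (R.Ky i) (subst (K j) (≡sym eq) (R.Ky j))

      Yₙ Zₙ : ℕ
      Yₙ = length Ys
      Zₙ = length Zs

      bagY : Fin Yₙ → Bag
      bagY s = proj₁ (lookup Ys s)

      bagZ : Fin Zₙ → Bag
      bagZ s = proj₁ (lookup Zs s)

      markY : ∀ s → bagY s (proj₂ (lookup Ys s))
      markY s = All.lookup (All.++⁻ˡ Ys marked) (∈-lookup s)

      markZ : ∀ s → bagZ s (proj₂ (lookup Zs s))
      markZ s = All.lookup (All.++⁻ʳ Ys marked) (∈-lookup s)

      chainY : FunChain Yₙ bagY
      chainY = funChain (chain-++ˡ Ys chain)

      chainZ : FunChain Zₙ bagZ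
      chainZ = funChain (chain-++ʳ Ys chain)

      abstract
        -- The `k` rungs start at different marks of `Ys`, of which there are at most `k`; so each
        -- bag of `Ys` carries a rung.
        at : ∀ (s : Fin Yₙ) → ∃[ i ] R.y i ≡ proj₂ (lookup Ys s)
        at s = injection-onto R.y (marks Ys) y-inj R.y∈ (subst (_≤ k) (≡sym (length-map proj₂ Ys)) len)
                 (∈-map⁺ proj₂ (∈-lookup s))

      rung : Fin Yₙ → Fin k
      rung s = proj₁ (at s)

      rung-inj : ∀ {s t} → rung s ≡ rung t → s ≡ t
      rung-inj {s} {t} eq = FunChain.disj chainY (markY s)
        (subst (bagY t) (trans (≡sym (proj₂ (at t))) (trans (cong R.y (≡sym eq)) (proj₂ (at s)))) (markY t))

      abstract
        landing : ∀ s → ∃[ q ] proj₂ (lookup Zs q) ≡ R.z (rung s)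
        landing s = position (R.z∈ (rung s))

      f : Fin Yₙ → Fin Zₙ
      f s = proj₁ (landing s)

      f-mark : ∀ s → proj₂ (lookup Zs (f s)) ≡ R.z (rung s)
      f-mark s = proj₂ (landing s)

      f-inj : ∀ {s t} → f s ≡ f t → s ≡ t
      f-inj {s} {t} eq = rung-inj (disj (R.Kz (rung s)) (subst (K (rung t))
        (trans (≡sym (f-mark t)) (trans (cong (proj₂ ∘ lookup Zs) (≡sym eq)) (f-mark s))) (R.Kz (rung t))))

      module Assemble {N} (p : Fin N → Fin Yₙ) (f-mono : ∀ {i j} → toℕ i < toℕ j → toℕ (f (p i)) < toℕ (f (p j)))
        (QY : Fin N → Bag) (fcY : FunChain N QY) (⊆QY : ∀ {i v} → bagY (p i) v → QY i v)
        (QY⊆ : ∀ {i v} → QY i v → ∃[ s ] bagY s v) where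

        module SZ = SubChain chainZ (f ∘ p) f-mono

        QZ : Fin N → Bag
        QZ = SZ.merged

        fp-inj : ∀ {i j} → f (p i) ≡ f (p j) → i ≡ j
        fp-inj {i} {j} eq with ℕ.<-cmp (toℕ i) (toℕ j)
        ... | tri< i<j _ _ = ⊥-elim (ℕ.<-irrefl (cong toℕ eq) (f-mono i<j))
        ... | tri≈ _ e _ = toℕ-injective e
        ... | tri> _ _ j<i = ⊥-elim (ℕ.<-irrefl (cong toℕ (≡sym eq)) (f-mono j<i))

        part : Maybe Bool → Fin N → Bag
        part (just true) = QY
        part (just false) = QZ
        part nothing i = R.W (rung (p i))

        offY : ∀ {i v} → QY i v → v ∉ C
        offY q = let s , q′ = QY⊆ q in All.lookup (All.++⁻ˡ Ys offC) (∈-lookup s) _ q′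

        offZ : ∀ {i v} → QZ i v → v ∉ C
        offZ (s , _ , q) = All.lookup (All.++⁻ʳ Ys offC) (∈-lookup s) _ q

        cross : ∀ {i j v} → QY i v → QZ j v → ⊥
        cross q (t , _ , q″) = let s , q′ = QY⊆ q in cross-apart Ys chain (∈-lookup s) (∈-lookup t) _ q′ q″

        ladder : Ladder N
        ladder = record
          { part = part
          ; conn = λ { (just true) → FunChain.conn fcY ; (just false) → SZ.merged-conn ; nothing i → R.conn (rung (p i)) }
          ; disj = λ {a} {b} → parts-disj a b
          ; rail = λ { true → FunChain.touch fcY ; false → SZ.merged-touch }
          ; rung = λ
            { true i → touch-⊆ id (λ { refl → ⊆QY (subst (bagY (p i)) (≡sym (proj₂ (at (p i)))) (markY (p i))) }) (R.yW (rung (p i)))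
            ; false i → touch-⊆ id (λ { refl → SZ.merged⊇ (subst (bagZ (f (p i))) (f-mark (p i)) (markZ (f (p i)))) }) (R.zW (rung (p i))) }
          ; inU = λ
            { {just true} q → let s , q′ = QY⊆ q in All.lookup (All.++⁻ˡ Ys inU) (∈-lookup s) _ q′
            ; {just false} (s , _ , q) → All.lookup (All.++⁻ʳ Ys inU) (∈-lookup s) _ q
            ; {nothing} {i} w → C⊆U (R.W⊆C (rung (p i)) w) }
          }
          where
          parts-disj : ∀ a b {i j v} → part a i v → part b j v → a ≡ b × i ≡ j
          parts-disj (just true) (just true) q q′ = refl , FunChain.disj fcY q q′
          parts-disj (just true) (just false) q q′ = ⊥-elim (cross q q′)
          parts-disj (just true) nothing {j = j} q w = ⊥-elim (offY q (R.W⊆C (rung (p j)) w))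
          parts-disj (just false) (just true) q q′ = ⊥-elim (cross q′ q)
          parts-disj (just false) (just false) q q′ = refl , FunChain.disj SZ.subChain q q′
          parts-disj (just false) nothing {j = j} q w = ⊥-elim (offZ q (R.W⊆C (rung (p j)) w))
          parts-disj nothing (just true) {i} w q = ⊥-elim (offY q (R.W⊆C (rung (p i)) w))
          parts-disj nothing (just false) {i} w q = ⊥-elim (offZ q (R.W⊆C (rung (p i)) w))
          parts-disj nothing nothing {i} {j} w w′ =
            refl , fp-inj (cong f (rung-inj (disj (R.W⊆K (rung (p i)) w) (R.W⊆K (rung (p j)) w′))))

      _◁_ _▶_ : Fin Yₙ → Fin Yₙ → Set
      s ◁ t = toℕ s < toℕ t × toℕ (f s) < toℕ (f t)
      s ▶ t = toℕ t < toℕ s × toℕ (f s) < toℕ (f t)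

      open ErdősSzekeres {_◁_ = _◁_} {_▶_} (λ (a , b) (c , d) → ℕ.<-trans a c , ℕ.<-trans b d)

      -- With the positions listed downwards, `f` increases along both outcomes of Erdős-Szekeres: a
      -- ◁-list follows the chain `Ys`, a ▶-list runs against it. Hence only the rail from `Ys` may
      -- have to be reversed.
      descending : List (Fin Yₙ)
      descending = Data.List.tabulate opposite

      opposite-< : ∀ {m} {i j : Fin m} → toℕ i < toℕ j → toℕ (opposite j) < toℕ (opposite i)
      opposite-< {m} {i} {j} lt = subst₂ _<_ (≡sym (opposite-prop j)) (≡sym (opposite-prop i))
        (ℕ.∸-monoʳ-< (s≤s lt) (toℕ<n j))

      comparable : AllPairs Comparable descending
      comparable = AllPairs.tabulate⁺-< λ {i} {j} i<j → compare (opposite i) (opposite j) (opposite-< i<j)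
        where
        compare : ∀ s t → toℕ t < toℕ s → Comparable s t
        compare s t t<s with ℕ.<-cmp (toℕ (f s)) (toℕ (f t))
        ... | tri< lt _ _ = inj₂ (t<s , lt)
        ... | tri≈ _ eq _ = ⊥-elim (ℕ.<-irrefl (cong toℕ (≡sym (f-inj (toℕ-injective eq)))) t<s)
        ... | tri> _ _ gt = inj₁ (t<s , gt)

      ladderOf : ∀ a → a * a < length Ys → Ladder (suc a)
      ladderOf a lt with erdős-szekeres a a descending comparable (subst (a * a <_) (≡sym (length-tabulate opposite)) lt)
      ... | inj₁ (ys , len , _ , asc) = subst Ladder len (Assemble.ladder (lookup ys)
        (λ {i} {j} i<j → proj₂ (lookup-AllPairs asc i j i<j)) S.merged S.subChain S.merged⊇ (λ (s , _ , q) → s , q))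
        where module S = SubChain chainY (lookup ys) (λ {i} {j} i<j → proj₁ (lookup-AllPairs asc i j i<j))
      ... | inj₂ (ys , len , desc) = subst Ladder len (Assemble.ladder (lookup ys)
        (λ {i} {j} i<j → proj₂ (lookup-AllPairs desc i j i<j)) S.merged S.subChain
        (λ {i} {v} q → S.merged⊇ (subst (λ s → bagY s v) (≡sym (opposite-involutive (lookup ys i))) q))
        (λ (s , _ , q) → opposite s , q))
        where module S = SubChain (reverseChain chainY) (opposite ∘ lookup ys)
                (λ {i} {j} i<j → opposite-< (proj₁ (lookup-AllPairs desc i j i<j)))

  -- `Z` serves twice: it separates `C` from the rest of `U`, and `C₁` from `C₂` inside `C`.
  record Cut (Heavy : Subset n → Set) (N : ℕ) : Set where
    field
      C C₁ C₂  : Subset n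
      Z        : List V
      heavy    : Heavy C
      light₁   : ¬ Heavy C₁
      light₂   : ¬ Heavy C₂
      C⊆U      : C ⊆ U
      C₁⊆C     : C₁ ⊆ C
      C₂⊆C     : C₂ ⊆ C
      disjoint : ∀ {v} → v ∈ C₁ → v ∈ C₂ → ⊥
      cover    : ∀ {v} → v ∈ C → v ∈ˡ Z ⊎ (v ∈ C₁ ⊎ v ∈ C₂)
      no-edge  : ∀ {u v} → u ∈ C₁ → v ∈ C₂ → u ~ v → ⊥
      bdry     : ∀ {u v} → u ∈ C → v ∈ U → v ∉ C → u ~ v → v ∈ˡ Z
      small    : length Z ≤ N

  module _ (Heavy : Subset n → Set) (heavy? : ∀ C → Dec (Heavy C)) (heavy-nonempty : ∀ {C} → Heavy C → Nonempty C)
    (a M : ℕ) (a²<M : a * a < M) where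

    Outcome : Set₁
    Outcome = Ladder (suc a) ⊎ Cut Heavy (M + M + M)

    Shrunk : Subset n → Set₁
    Shrunk C = Σ[ C′ ∈ Subset n ] Σ[ L′ ∈ List (Bag × V) ] (State C′ L′ × Heavy C′ × C′ ⊆ C × length L′ < M + M)

    -- When one side of the separation is heavy, the `M` marks of its half stay and those of the
    -- other half give way to fewer than `M` separator vertices, so the chain is again shorter than
    -- `M + M`.
    full-chain : ∀ {C L} → State C L → Heavy C → length L ≡ M + M → Outcome ⊎ Shrunk C
    full-chain {C} {L} st hC len = go (subst (State C) (≡sym (take++drop≡id M L)) st)
      where
      Ys = take M L
      Zs = drop M L
      lenY : length Ys ≡ M
      lenY = trans (length-take M L) (ℕ.m≤n⇒m⊓n≡m (subst (M ≤_) (≡sym len) (ℕ.m≤m+n M M)))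
      lenZ : length Zs ≡ M
      lenZ = trans (length-drop M L) (trans (cong (_∸ M) len) (ℕ.m+n∸n≡m M M))
      marks-length : ∀ {L m} → length L ≡ m → length (marks L) ≡ m
      marks-length {L} eq = trans (length-map proj₂ L) eq
      go : State C (Ys ++ Zs) → Outcome ⊎ Shrunk C
      go st with mengerTight (Boundary.E st) (marks Ys) (marks Zs) M
      ... | inj₁ l = inj₁ (inj₁ (Link.Rungs.ladderOf st l (ℕ.≤-reflexive lenY) a (subst (a * a <_) (≡sym lenY) a²<M)))
      ... | inj₂ t = verdict (heavy? L₁.C-left) (heavy? L₂.C-left)
        where
        open Boundary st
        module T = TightSep t
        S = T.sep
        module L₁ = Shrink (marks Ys) (marks Zs) (Link.marks⁻ st) (Link.Z⊆ st) (Link.Y⊆ st) (Link.separate st) S T.toB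
        flipped-mids : mids (σ (flipSep S)) ≡ mids (σ S)
        flipped-mids = filter-≐ _ _ (flipSide-to , λ eq → cong flipSide eq) (allFin n)
        module L₂ = Shrink (marks Zs) (marks Ys) ([ inj₂ , inj₁ ]′ ∘ Link.marks⁻ st) (Link.Y⊆ st) (Link.Z⊆ st)
          (λ z y → Link.separate st y z) (flipSep S)
          (subst (λ m → Linkage E m (marks Ys) (length m)) (≡sym flipped-mids) T.toA)
        order<M : length (mids (σ S)) < M
        order<M = order S
        verdict : Dec (Heavy L₁.C-left) → Dec (Heavy L₂.C-left) → Outcome ⊎ Shrunk C
        verdict (yes h) _ = inj₂ (L₁.C-left , L₁.L′ , L₁.state , h , (λ v∈ → proj₁ (∈-comprehension⁻ L₁.inL? v∈))
          , ℕ.≤-<-trans L₁.short (ℕ.+-mono-≤-< (ℕ.≤-reflexive (marks-length {Ys} lenY)) order<M))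
        verdict (no _) (yes h) = inj₂ (L₂.C-left , L₂.L′ , L₂.state , h , (λ v∈ → proj₁ (∈-comprehension⁻ L₂.inL? v∈))
          , ℕ.≤-<-trans L₂.short (ℕ.+-mono-≤-< (ℕ.≤-reflexive (marks-length {Zs} lenZ))
              (subst (λ m → length m < M) (≡sym flipped-mids) order<M)))
        verdict (no l₁) (no l₂) = inj₁ (inj₂ (record
          { C = C ; C₁ = L₁.C-left ; C₂ = L₂.C-left ; Z = marks (Ys ++ Zs) ++ mids (σ S)
          ; heavy = hC ; light₁ = l₁ ; light₂ = l₂ ; C⊆U = State.C⊆U st
          ; C₁⊆C = λ v∈ → proj₁ (∈-comprehension⁻ L₁.inL? v∈) ; C₂⊆C = λ v∈ → proj₁ (∈-comprehension⁻ L₂.inL? v∈)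
          ; disjoint = λ v∈₁ v∈₂ → left≢right (proj₂ (∈-comprehension⁻ L₁.inL? v∈₁)) (flipSide-to (proj₂ (∈-comprehension⁻ L₂.inL? v∈₂)))
          ; cover = cover
          ; no-edge = λ u∈ v∈ e → let u∈C , uL = ∈-comprehension⁻ L₁.inL? u∈ ; v∈C , vR = ∈-comprehension⁻ L₂.inL? v∈
                        in apart S (E⁺ u∈C (State.C⊆U st v∈C) e) uL (flipSide-to vR)
          ; bdry = λ u∈ v∈ v∉ e → ∈-++⁺ˡ (State.bdry st u∈ v∈ v∉ e)
          ; small = subst (_≤ M + M + M) (≡sym (length-++ (marks (Ys ++ Zs))))
              (ℕ.+-mono-≤ (ℕ.≤-reflexive (marks-length {Ys ++ Zs} (trans (length-++ Ys) (cong₂ _+_ lenY lenZ)))) (ℕ.<⇒≤ order<M))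
          }))
          where
          left≢right : ∀ {s} → s ≡ left → s ≡ right → ⊥
          left≢right refl ()
          cover : ∀ {v} → v ∈ C → v ∈ˡ marks (Ys ++ Zs) ++ mids (σ S) ⊎ (v ∈ L₁.C-left ⊎ v ∈ L₂.C-left)
          cover {v} v∈ with σ S v in eq
          ... | left = inj₂ (inj₁ (∈-comprehension⁺ L₁.inL? (v∈ , eq)))
          ... | mid = inj₁ (∈-++⁺ʳ (marks (Ys ++ Zs)) (∈-mids⁺ (σ S) eq))
          ... | right = inj₂ (inj₂ (∈-comprehension⁺ L₂.inL? (v∈ , cong flipSide eq)))

    search : ∀ {C L} → Acc _<_ ∣ C ∣ → State C L → Heavy C → length L < M + M → Outcome
    search {C} {L} (acc rec) st hC short = branch (heavy? (remove C v))
      where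
      open Grown (grow st (heavy-nonempty hC)) renaming (short to short′)
      branch : Dec (Heavy (remove C v)) → Outcome
      -- Losing `v` makes `C` light, so `v` together with the marks is already a cut, with an empty
      -- second piece.
      branch (no light) = inj₂ (record
        { C = C ; C₁ = remove C v ; C₂ = empty ; Z = v ∷ marks L ; heavy = hC ; light₁ = light
        ; light₂ = λ h → ∉⊥ (proj₂ (heavy-nonempty h)) ; C⊆U = State.C⊆U st
        ; C₁⊆C = proj₁ ∘ ∈-remove⁻ ; C₂⊆C = λ v∈ → ⊥-elim (∉⊥ v∈) ; disjoint = λ _ v∈ → ∉⊥ v∈
        ; cover = cover ; no-edge = λ _ v∈ → ⊥-elim (∉⊥ v∈) ; bdry = λ u∈ v∈ v∉ e → there (State.bdry st u∈ v∈ v∉ e)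
        ; small = ℕ.≤-trans (subst (λ m → suc m ≤ M + M) (≡sym (length-map proj₂ L)) short) (ℕ.m≤m+n (M + M) M) })
        where
        cover : ∀ {x} → x ∈ C → x ∈ˡ v ∷ marks L ⊎ (x ∈ remove C v ⊎ x ∈ empty)
        cover {x} x∈ with x ≟ v
        ... | yes refl = inj₁ (here refl)
        ... | no ne = inj₂ (inj₁ (∈-remove⁺ x∈ ne))
      branch (yes h) with length L′ <? M + M
      ... | yes lt = search (rec (∣remove∣ v∈C)) state h lt
      ... | no ≮ with full-chain state h (ℕ.≤-antisym (ℕ.≤-trans short′ short) (ℕ.≮⇒≥ ≮))
      ...   | inj₁ out = out
      ...   | inj₂ (C″ , L″ , st″ , h″ , sub , lt) =
              search (rec (ℕ.≤-<-trans (Sub.p⊆q⇒∣p∣≤∣q∣ sub) (∣remove∣ v∈C))) st″ h″ lt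

    abstract
      ladder-or-cut : Heavy U → Outcome
      ladder-or-cut hU = search (<-wellFounded _) start hU (ℕ.<-≤-trans (ℕ.≤-<-trans z≤n a²<M) (ℕ.m≤m+n M M))
        where
        start : State U []
        start = record
          { chain = [] ; marked = [] ; inU = [] ; offC = [] ; C⊆U = id
          ; bdry = λ _ v∈ v∉ → ⊥-elim (v∉ v∈) }

-- Graphs of pathwidth two as minors of ladders.

module Embedding (H : Defs.Graph) (adj? : ∀ x y → Dec (Defs.Adj H x y)) (pd : Defs.PathDecomposition 2 H)
  {n : ℕ} (_~_ : Fin n → Fin n → Set) (~-sym : ∀ {u v} → u ~ v → v ~ u)
  (_~?_ : ∀ u v → Dec (u ~ v)) (U : Subset n) where

  open Host _~_ ~-sym _~?_
  open Process _~_ ~-sym _~?_ U using (Ladder)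
  open Defs.PathDecomposition pd

  private
    h : ℕ
    h = Defs.n H

    _↔_ : Fin h → Fin h → Set
    _↔_ = Defs.Adj H

  firstBag : ∀ x → ∃[ i ] (x ∈ bag i × (∀ j → x ∈ bag j → toℕ i ≤ toℕ j))
  firstBag x with argmin toℕ (comprehension λ i → x ∈? bag i)
                    (let i , x∈ = vertex x in i , ∈-comprehension⁺ (λ i → x ∈? bag i) x∈)
  ... | i , i∈ , least = i , ∈-comprehension⁻ (λ i → x ∈? bag i) i∈
                       , λ j x∈ → least (∈-comprehension⁺ (λ i → x ∈? bag i) x∈)

  first : Fin h → Fin r
  first x = proj₁ (firstBag x)

  ℓ : Fin h → ℕ
  ℓ x = toℕ (first x)

  Live : Subset h → Fin h → Set
  Live R u = ∃[ w ] (w ∈ R × u ↔ w)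

  live? : ∀ R u → Dec (Live R u)
  live? R u = any? (λ w → (w ∈? R) ×-dec adj? u w)

  -- The edge from `u` to an unplaced `w′` lies in a bag not before the first bag of `w′`, hence not
  -- before that of `w`. As `u` first occurs no later than `w`, `interval` applies.
  live-in-bag : ∀ {R u w} → (∀ {w′} → w′ ∈ R → ℓ w ≤ ℓ w′) → ℓ u ≤ ℓ w → Live R u → u ∈ bag (first w)
  live-in-bag {u = u} {w} least u≤w (w′ , w′∈ , e) with edge u w′ e
  ... | j , u∈j , w′∈j = interval (first u) (first w) j u u≤w
          (ℕ.≤-trans (least w′∈) (proj₂ (proj₂ (firstBag w′)) j w′∈j)) (proj₁ (proj₂ (firstBag u))) u∈j

  module Columns {N : ℕ} (lad : Ladder N) where
    open Ladder lad

    -- After t columns: rail s is currently held by the branch set of occ s, and only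
    -- vertices holding a rail can still have unplaced neighbours (those in R).
    record Partial (t : ℕ) (R : Subset h) : Set₁ where
      field
        B        : Fin h → Bag
        used     : ∀ {x v} → B x v → ∃[ p ] ∃[ i ] (toℕ i < t × part p i v)
        placed   : ∀ {x v} → B x v → x ∉ R
        nonempty : ∀ {x} → x ∉ R → ∃[ v ] B x v
        B-conn   : ∀ {x} → x ∉ R → Conn (B x)
        B-disj   : ∀ {x y v} → B x v → B y v → x ≡ y
        B-edge   : ∀ {x y} → x ∉ R → y ∉ R → x ↔ y → Touch (B x) (B y)
        occ      : Bool → Maybe (Fin h)
        occ∉     : ∀ {s u} → occ s ≡ just u → u ∉ R
        held     : ∀ {s u i v} → occ s ≡ just u → suc (toℕ i) ≡ t → part (just s) i v → B u v
        live     : ∀ {u} → u ∉ R → Live R u → ∃[ s ] occ s ≡ just u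
        sorted   : ∀ {u w} → u ∉ R → w ∈ R → ℓ u ≤ ℓ w

    module Next {t R} (P : Partial t R) (t<N : t < N) {v₀} (v₀∈ : v₀ ∈ R) (least : ∀ {w} → w ∈ R → ℓ v₀ ≤ ℓ w) where
      open Partial P

      R′ : Subset h
      R′ = remove R v₀

      ∉R′ : ∀ {x} → x ∉ R → x ∉ R′
      ∉R′ x∉ x∈ = x∉ (proj₁ (∈-remove⁻ x∈))

      v₀∉R′ : v₀ ∉ R′
      v₀∉R′ v₀∈′ = proj₂ (∈-remove⁻ v₀∈′) refl

      old : ∀ {x} → x ∉ R′ → x ≢ v₀ → x ∉ R
      old x∉ ne x∈ = x∉ (∈-remove⁺ x∈ ne)

      record Takeover : Set where
        field
          occ′       : Bool → Maybe (Fin h)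
          old-or-new : ∀ s → occ′ s ≡ occ s ⊎ occ′ s ≡ just v₀
          live-new   : Live R′ v₀ → ∃[ s ] occ′ s ≡ just v₀
          live-old   : ∀ {u s} → occ s ≡ just u → Live R′ u → ∃[ s′ ] occ′ s′ ≡ just u

      seize : ∀ s → (∀ {u} → occ s ≡ just u → Live R′ u → occ (not s) ≡ just u) → Takeover
      seize true free = record
        { occ′ = λ { true → just v₀ ; false → occ false }
        ; old-or-new = λ { true → inj₂ refl ; false → inj₁ refl }
        ; live-new = λ _ → true , refl
        ; live-old = λ { {s = true} eq l → false , free eq l ; {s = false} eq l → false , eq } }
      seize false free = record
        { occ′ = λ { false → just v₀ ; true → occ true }
        ; old-or-new = λ { false → inj₂ refl ; true → inj₁ refl }
        ; live-new = λ _ → false , refl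
        ; live-old = λ { {s = false} eq l → true , free eq l ; {s = true} eq l → true , eq } }

      -- The first bag of the next vertex `w` would contain `w`, `v₀`, `u₁` and `u₂`, one more than
      -- width two allows. Hence some rail is free whenever `v₀` needs one.
      overfull : ∀ {u₁ u₂} → u₁ ≢ u₂ → u₁ ∉ R → u₂ ∉ R → Live R′ u₁ → Live R′ u₂ → Live R′ v₀ → ⊥
      overfull {u₁} {u₂} ne u₁∉ u₂∉ l₁ l₂ l₀@(w₀ , w₀∈ , _) with argmin ℓ R′ (w₀ , w₀∈)
      ... | w , w∈ , w-least = ℕ.1+n≰n (ℕ.≤-trans (distinct-members distinct members) (width (first w)))
        where
        w∈R = proj₁ (∈-remove⁻ w∈)
        ≢-in-out : ∀ {x y : Fin h} → x ∈ R → y ∉ R → x ≢ y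
        ≢-in-out x∈ y∉ refl = y∉ x∈
        distinct : AllPairs _≢_ (w ∷ v₀ ∷ u₁ ∷ u₂ ∷ [])
        distinct = (proj₂ (∈-remove⁻ w∈) ∷ ≢-in-out w∈R u₁∉ ∷ ≢-in-out w∈R u₂∉ ∷ [])
          ∷ (≢-in-out v₀∈ u₁∉ ∷ ≢-in-out v₀∈ u₂∉ ∷ []) ∷ (ne ∷ []) ∷ [] ∷ []
        members : All (_∈ bag (first w)) (w ∷ v₀ ∷ u₁ ∷ u₂ ∷ [])
        members = proj₁ (proj₂ (firstBag w)) ∷ live-in-bag w-least (least w∈R) l₀
          ∷ live-in-bag w-least (sorted u₁∉ w∈R) l₁ ∷ live-in-bag w-least (sorted u₂∉ w∈R) l₂ ∷ []

      takeover : Takeover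
      takeover with live? R′ v₀
      -- Without unplaced neighbours `v₀` is content with the middle of its rung.
      ... | no dead = record
        { occ′ = occ ; old-or-new = λ _ → inj₁ refl ; live-new = ⊥-elim ∘ dead ; live-old = λ eq _ → _ , eq }
      ... | yes l₀ with occ true in eq₁ | occ false in eq₂
      ...   | nothing | _ = seize true λ eq → absurd (trans (≡sym eq₁) eq)
        where absurd : ∀ {A : Set} {u} → nothing ≡ just {A = Fin h} u → A
              absurd ()
      ...   | just _ | nothing = seize false λ eq → absurd (trans (≡sym eq₂) eq)
        where absurd : ∀ {A : Set} {u} → nothing ≡ just {A = Fin h} u → A
              absurd ()
      ...   | just u₁ | just u₂ with u₁ ≟ u₂ | live? R′ u₁ | live? R′ u₂
      ...     | yes refl | _ | _ = seize true λ eq _ → trans eq₂ (trans (≡sym eq₁) eq)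
      ...     | no _ | no dead | _ = seize true λ eq l → ⊥-elim (dead (subst (Live R′) (just-injective (trans (≡sym eq) eq₁)) l))
      ...     | no _ | yes _ | no dead = seize false λ eq l → ⊥-elim (dead (subst (Live R′) (just-injective (trans (≡sym eq) eq₂)) l))
      ...     | no ne | yes l₁ | yes l₂ = ⊥-elim (overfull ne (occ∉ eq₁) (occ∉ eq₂) l₁ l₂ l₀)

      open Takeover takeover

      i₀ : Fin N
      i₀ = fromℕ< t<N

      i₀≡t : toℕ i₀ ≡ t
      i₀≡t = toℕ-fromℕ< t<N

      -- Column `t` is shared out: the middle of the rung to the new vertex, each rail to its holder
      -- after the takeover.
      Owner : Fin h → Maybe Bool → Set
      Owner x (just s) = occ′ s ≡ just x
      Owner x nothing = x ≡ v₀

      owner-unique : ∀ {x y} p → Owner x p → Owner y p → x ≡ y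
      owner-unique (just s) e e′ = just-injective (trans (≡sym e) e′)
      owner-unique nothing e e′ = trans e (≡sym e′)

      owner∉ : ∀ {x} p → Owner x p → x ∉ R′
      owner∉ nothing refl = v₀∉R′
      owner∉ (just s) e with old-or-new s
      ... | inj₁ same = ∉R′ (occ∉ (trans (≡sym same) e))
      ... | inj₂ new = subst (_∉ R′) (just-injective (trans (≡sym new) e)) v₀∉R′

      B′ : Fin h → Bag
      B′ x v = B x v ⊎ ∃[ p ] (Owner x p × part p i₀ v)

      fresh : ∀ {x p v} → B x v → part p i₀ v → ⊥
      fresh b q with used b
      ... | p′ , i , lt , q′ with proj₂ (disj q q′)
      ...   | refl = ℕ.<-irrefl i₀≡t lt

      -- `B u` is nonempty and lies in columns before `t`, so there is a column `t ∸ 1`, and `held`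
      -- puts its part of rail `s` into `B u`.
      touch-prev : ∀ {s u} → occ s ≡ just u → Touch (B u) (part (just s) i₀)
      touch-prev {s} {u} eq with nonempty (occ∉ eq)
      ... | v , b with used b
      ... | _ , i , lt , _ = touch-⊆ (held eq prev+1) id (rail s (trans i₀≡t (≡sym prev+1)))
        where
        pred<N : t ∸ 1 < N
        pred<N = ℕ.≤-<-trans (ℕ.m∸n≤m t 1) t<N
        prev+1 : suc (toℕ (fromℕ< pred<N)) ≡ t
        prev+1 = trans (cong suc (toℕ-fromℕ< pred<N)) (ℕ.m+[n∸m]≡n (ℕ.≤-trans (s≤s z≤n) lt))

      conn-old : ∀ {x} → x ∉ R → x ≢ v₀ → Conn (B′ x)
      conn-old {x} x∉ ne f inv {u} {v} b b′ = trans (anchored b) (≡sym (anchored b′))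
        where
        base = proj₂ (nonempty x∉)
        anchored : ∀ {u} → B′ x u → f u ≡ f (proj₁ (nonempty x∉))
        anchored (inj₁ b) = B-conn x∉ f (λ k l → inv (inj₁ k) (inj₁ l)) b base
        anchored (inj₂ (nothing , e , _)) = ⊥-elim (ne e)
        anchored (inj₂ (just s , e , q)) with old-or-new s
        ... | inj₂ new = ⊥-elim (ne (just-injective (trans (≡sym e) new)))
        ... | inj₁ same with touch-prev (trans (≡sym same) e)
        ...   | y , z , by , qz , yz = trans
                (conn (just s) i₀ f (λ k l → inv (inj₂ (just s , e , k)) (inj₂ (just s , e , l))) q qz)
                (trans (≡sym (inv (inj₁ by) (inj₂ (just s , e , qz)) yz)) (anchored (inj₁ by)))

      conn-new : Conn (B′ v₀)
      conn-new f inv b b′ = trans (anchored b) (≡sym (anchored b′))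
        where
        hub = rung true i₀
        constant : ∀ {u v} → part nothing i₀ u → part nothing i₀ v → f u ≡ f v
        constant = conn nothing i₀ f (λ k l → inv (inj₂ (nothing , refl , k)) (inj₂ (nothing , refl , l)))
        anchored : ∀ {u} → B′ v₀ u → f u ≡ f (proj₁ hub)
        anchored (inj₁ b) = ⊥-elim (placed b v₀∈)
        anchored (inj₂ (nothing , _ , q)) = constant q (proj₁ (proj₂ (proj₂ hub)))
        anchored (inj₂ (just s , e , q)) with rung s i₀
        ... | y , z , qy , qz , yz = trans
              (conn (just s) i₀ f (λ k l → inv (inj₂ (just s , e , k)) (inj₂ (just s , e , l))) q qz)
              (trans (≡sym (inv (inj₂ (nothing , refl , qy)) (inj₂ (just s , e , qz)) yz))
                (constant qy (proj₁ (proj₂ (proj₂ hub)))))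

      -- As `v₀` was unplaced, `y` was live and held a rail. If `y` keeps it, the rung of column `t`
      -- makes the contact; if `v₀` has seized it, the rail does so between columns `t ∸ 1` and `t`.
      edge-new : ∀ {y} → y ∉ R → y ↔ v₀ → Touch (B′ v₀) (B′ y)
      edge-new {y} y∉ e with live y∉ (v₀ , v₀∈ , e)
      ... | s , eq with old-or-new s
      ...   | inj₁ same = touch-⊆ (λ q → inj₂ (nothing , refl , q)) (λ q → inj₂ (just s , trans same eq , q)) (rung s i₀)
      ...   | inj₂ new = touch-sym (touch-⊆ inj₁ (λ q → inj₂ (just s , new , q)) (touch-prev eq))

      next : Partial (suc t) R′
      next = record
        { B = B′
        ; used = λ
          { (inj₁ b) → let p , i , lt , q = used b in p , i , ℕ.m≤n⇒m≤1+n lt , q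
          ; (inj₂ (p , _ , q)) → p , i₀ , ℕ.≤-reflexive (cong suc i₀≡t) , q }
        ; placed = λ { (inj₁ b) → ∉R′ (placed b) ; (inj₂ (p , e , _)) → owner∉ p e }
        ; nonempty = λ {x} x∉ → nonempty′ x x∉ (x ≟ v₀)
        ; B-conn = λ {x} x∉ → conn′ x x∉ (x ≟ v₀)
        ; B-disj = λ
          { (inj₁ b) (inj₁ b′) → B-disj b b′
          ; (inj₁ b) (inj₂ (_ , _ , q)) → ⊥-elim (fresh b q)
          ; (inj₂ (_ , _ , q)) (inj₁ b) → ⊥-elim (fresh b q)
          ; (inj₂ (p , e , q)) (inj₂ (p′ , e′ , q′)) → owner-unique p e (subst (Owner _) (≡sym (proj₁ (disj q q′))) e′) }
        ; B-edge = λ {x} {y} x∉ y∉ e → edge′ x y x∉ y∉ e (x ≟ v₀) (y ≟ v₀)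
        ; occ = occ′
        ; occ∉ = λ {s} e → owner∉ (just s) e
        ; held = λ {s} {u} {i} {v} e eq q → inj₂ (just s , e , subst (λ i → part (just s) i v)
            (toℕ-injective (trans (ℕ.suc-injective eq) (≡sym i₀≡t))) q)
        ; live = λ {u} u∉ l → live′ u u∉ l (u ≟ v₀)
        ; sorted = λ {u} u∉ w∈ → sorted′ u u∉ w∈ (u ≟ v₀)
        }
        where
        nonempty′ : ∀ x → x ∉ R′ → Dec (x ≡ v₀) → ∃[ v ] B′ x v
        nonempty′ x x∉ (yes eq) = let u , _ , q , _ = rung true i₀ in u , inj₂ (nothing , eq , q)
        nonempty′ x x∉ (no ne) = let v , b = nonempty (old x∉ ne) in v , inj₁ b
        conn′ : ∀ x → x ∉ R′ → Dec (x ≡ v₀) → Conn (B′ x)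
        conn′ x x∉ (yes refl) = conn-new
        conn′ x x∉ (no ne) = conn-old (old x∉ ne) ne
        edge′ : ∀ x y → x ∉ R′ → y ∉ R′ → x ↔ y → Dec (x ≡ v₀) → Dec (y ≡ v₀) → Touch (B′ x) (B′ y)
        edge′ x y x∉ y∉ e (yes refl) (yes refl) = ⊥-elim (Defs.irrefl H e)
        edge′ x y x∉ y∉ e (yes refl) (no ne) = edge-new (old y∉ ne) (Defs.sym H e)
        edge′ x y x∉ y∉ e (no ne) (yes refl) = touch-sym (edge-new (old x∉ ne) e)
        edge′ x y x∉ y∉ e (no ne) (no ne′) = touch-⊆ inj₁ inj₁ (B-edge (old x∉ ne) (old y∉ ne′) e)
        live′ : ∀ u → u ∉ R′ → Live R′ u → Dec (u ≡ v₀) → ∃[ s ] occ′ s ≡ just u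
        live′ u u∉ l (yes refl) = live-new l
        live′ u u∉ l@(w , w∈ , e) (no ne) with live (old u∉ ne) (w , proj₁ (∈-remove⁻ w∈) , e)
        ... | s , eq = live-old eq l
        sorted′ : ∀ u {w} → u ∉ R′ → w ∈ R′ → Dec (u ≡ v₀) → ℓ u ≤ ℓ w
        sorted′ u u∉ w∈ (yes refl) = least (proj₁ (∈-remove⁻ w∈))
        sorted′ u u∉ w∈ (no ne) = sorted (old u∉ ne) (proj₁ (∈-remove⁻ w∈))

    complete : ∀ {t R} → Acc _<_ ∣ R ∣ → t + ∣ R ∣ ≤ N → Partial t R → Σ[ t′ ∈ ℕ ] Σ[ R′ ∈ Subset h ] (Partial t′ R′ × (∀ x → x ∉ R′))
    complete {t} {R} (acc rec) room P with Sub.nonempty? R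
    ... | no none = t , R , P , λ x x∈ → none (x , x∈)
    ... | yes ne with argmin ℓ R ne
    ...   | v , v∈ , least = complete (rec smaller) (ℕ.≤-trans (ℕ.≤-reflexive (≡sym (ℕ.+-suc t _))) (ℕ.≤-trans (ℕ.+-monoʳ-≤ t smaller) room))
              (Next.next P t<N v∈ least)
      where
      smaller = ∣remove∣ v∈
      t<N : t < N
      t<N = ℕ.<-≤-trans (ℕ.m<m+n t (ℕ.≤-trans (s≤s z≤n) smaller)) room

    start : Partial 0 full
    start = record
      { B = λ _ _ → ⊥ ; used = λ () ; placed = λ () ; nonempty = λ x∉ → ⊥-elim (x∉ ∈⊤) ; B-conn = λ x∉ → ⊥-elim (x∉ ∈⊤)
      ; B-disj = λ () ; B-edge = λ x∉ → ⊥-elim (x∉ ∈⊤) ; occ = λ _ → nothing ; occ∉ = λ () ; held = λ ()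
      ; live = λ x∉ → ⊥-elim (x∉ ∈⊤) ; sorted = λ x∉ → ⊥-elim (x∉ ∈⊤) }

-- Minor models of parts of `H`, and packings of them.

module Models (H : Defs.Graph) (adj? : ∀ x y → Dec (Defs.Adj H x y))
  {n : ℕ} (_~_ : Fin n → Fin n → Set) (~-sym : ∀ {u v} → u ~ v → v ~ u)
  (_~?_ : ∀ u v → Dec (u ~ v)) where

  open Host _~_ ~-sym _~?_

  h : ℕ
  h = Defs.n H

  _↔_ : Fin h → Fin h → Set
  _↔_ = Defs.Adj H

  -- Branch sets for the subgraph of `H` induced by `W`. Keeping the index set `Fin h` avoids
  -- renumbering when patterns are restricted or merged.
  record Model (W : Subset h) (U : Subset n) : Set₁ where
    field
      B        : Fin h → Bag
      nonempty : ∀ {x} → x ∈ W → ∃[ v ] B x v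
      conn     : ∀ {x} → x ∈ W → Conn (B x)
      disj     : ∀ {x y v} → x ∈ W → y ∈ W → B x v → B y v → x ≡ y
      edge     : ∀ {x y} → x ∈ W → y ∈ W → x ↔ y → Touch (B x) (B y)
      inU      : ∀ {x v} → x ∈ W → B x v → v ∈ U

  open Model

  record Pack (W : Subset h) (d : ℕ) (U : Subset n) : Set₁ where
    field
      copy   : Fin d → Model W U
      copies : ∀ {s t x y v} → x ∈ W → y ∈ W → B (copy s) x v → B (copy t) y v → s ≡ t

  open Pack

  retarget : ∀ {W U U′} (M : Model W U) → (∀ {x v} → x ∈ W → B M x v → v ∈ U′) → Model W U′
  retarget M h = record { Model M ; inU = h }

  restrict : ∀ {W W′ U} → W′ ⊆ W → Model W U → Model W′ U
  restrict sub M = record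
    { B = B M ; nonempty = λ x∈ → nonempty M (sub x∈) ; conn = λ x∈ → conn M (sub x∈)
    ; disj = λ x∈ y∈ → disj M (sub x∈) (sub y∈) ; edge = λ x∈ y∈ → edge M (sub x∈) (sub y∈)
    ; inU = λ x∈ → inU M (sub x∈) }

  restrictPack : ∀ {W W′ d U} → W′ ⊆ W → Pack W d U → Pack W′ d U
  restrictPack sub P = record
    { copy = λ t → restrict sub (copy P t) ; copies = λ x∈ y∈ → copies P (sub x∈) (sub y∈) }

  shrinkPack : ∀ {W c d U} → c ≤ d → Pack W d U → Pack W c U
  shrinkPack le P = record
    { copy = λ t → copy P (inject≤ t le)
    ; copies = λ x∈ y∈ b b′ → inject≤-injective le le _ _ (copies P x∈ y∈ b b′) }

  singlePack : ∀ {W U} → Model W U → Pack W 1 U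
  singlePack M = record { copy = λ _ → M ; copies = λ { {zero} {zero} _ _ _ _ → refl } }

  emptyPack : ∀ {W U} → (∀ {x} → x ∉ W) → ∀ d → Pack W d U
  emptyPack none d = record
    { copy = λ _ → record
      { B = λ _ _ → ⊥ ; nonempty = λ x∈ → ⊥-elim (none x∈) ; conn = λ x∈ → ⊥-elim (none x∈)
      ; disj = λ x∈ → ⊥-elim (none x∈) ; edge = λ x∈ → ⊥-elim (none x∈) ; inU = λ x∈ → ⊥-elim (none x∈) }
    ; copies = λ x∈ → ⊥-elim (none x∈) }

  pack-+ : ∀ {W c d U₁ U₂ U} → U₁ ⊆ U → U₂ ⊆ U → (∀ {v} → v ∈ U₁ → v ∈ U₂ → ⊥) →
    Pack W c U₁ → Pack W d U₂ → Pack W (c + d) U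
  pack-+ {W} {c} {d} {U₁} {U₂} {U} sub₁ sub₂ apart P₁ P₂ = record
    { copy = λ t → pick (splitAt c t)
    ; copies = λ {s} {t} x∈ y∈ b b′ → trans (≡sym (join-splitAt c d s))
        (trans (cong (join c d) (picks (splitAt c s) (splitAt c t) x∈ y∈ b b′)) (join-splitAt c d t)) }
    where
    pick : Fin c ⊎ Fin d → Model W U
    pick (inj₁ s) = retarget (copy P₁ s) (λ x∈ b → sub₁ (inU (copy P₁ s) x∈ b))
    pick (inj₂ t) = retarget (copy P₂ t) (λ x∈ b → sub₂ (inU (copy P₂ t) x∈ b))
    picks : ∀ s t {x y v} → x ∈ W → y ∈ W → B (pick s) x v → B (pick t) y v → s ≡ t
    picks (inj₁ s) (inj₁ t) x∈ y∈ b b′ = cong inj₁ (copies P₁ x∈ y∈ b b′)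
    picks (inj₁ s) (inj₂ t) x∈ y∈ b b′ = ⊥-elim (apart (inU (copy P₁ s) x∈ b) (inU (copy P₂ t) y∈ b′))
    picks (inj₂ s) (inj₁ t) x∈ y∈ b b′ = ⊥-elim (apart (inU (copy P₁ t) y∈ b′) (inU (copy P₂ s) x∈ b))
    picks (inj₂ s) (inj₂ t) x∈ y∈ b b′ = cong inj₂ (copies P₂ x∈ y∈ b b′)

  module Merge {W₁ W₂ W : Subset h} {U₁ U₂ U : Subset n} (split : ∀ {x} → x ∈ W → x ∉ W₁ → x ∈ W₂)
    (no-edge : ∀ {x y} → x ∈ W₁ → y ∈ W → y ∉ W₁ → x ↔ y → ⊥)
    (sub₁ : U₁ ⊆ U) (sub₂ : U₂ ⊆ U) (apart : ∀ {v} → v ∈ U₁ → v ∈ U₂ → ⊥) where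

    mergeBag : Model W₁ U₁ → Model W₂ U₂ → ∀ x → Dec (x ∈ W₁) → Bag
    mergeBag M₁ M₂ x (yes _) = B M₁ x
    mergeBag M₁ M₂ x (no _) = B M₂ x

    mergeModel : Model W₁ U₁ → Model W₂ U₂ → Model W U
    mergeModel M₁ M₂ = record
      { B = λ x → mergeBag M₁ M₂ x (x ∈? W₁)
      ; nonempty = λ {x} x∈ → ne x∈ (x ∈? W₁)
      ; conn = λ {x} x∈ → cn x∈ (x ∈? W₁)
      ; disj = λ {x} {y} x∈ y∈ → dj x∈ y∈ (x ∈? W₁) (y ∈? W₁)
      ; edge = λ {x} {y} x∈ y∈ → ed x∈ y∈ (x ∈? W₁) (y ∈? W₁)
      ; inU = λ {x} x∈ → iu x∈ (x ∈? W₁) }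
      where
      ne : ∀ {x} → x ∈ W → (d : Dec (x ∈ W₁)) → ∃[ v ] mergeBag M₁ M₂ x d v
      ne x∈ (yes x∈₁) = nonempty M₁ x∈₁
      ne x∈ (no x∉) = nonempty M₂ (split x∈ x∉)
      cn : ∀ {x} → x ∈ W → (d : Dec (x ∈ W₁)) → Conn (mergeBag M₁ M₂ x d)
      cn x∈ (yes x∈₁) = conn M₁ x∈₁
      cn x∈ (no x∉) = conn M₂ (split x∈ x∉)
      iu : ∀ {x v} → x ∈ W → (d : Dec (x ∈ W₁)) → mergeBag M₁ M₂ x d v → v ∈ U
      iu x∈ (yes x∈₁) b = sub₁ (inU M₁ x∈₁ b)
      iu x∈ (no x∉) b = sub₂ (inU M₂ (split x∈ x∉) b)
      dj : ∀ {x y v} → x ∈ W → y ∈ W → (d : Dec (x ∈ W₁)) (e : Dec (y ∈ W₁)) →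
        mergeBag M₁ M₂ x d v → mergeBag M₁ M₂ y e v → x ≡ y
      dj x∈ y∈ (yes x∈₁) (yes y∈₁) b b′ = disj M₁ x∈₁ y∈₁ b b′
      dj x∈ y∈ (yes x∈₁) (no y∉) b b′ = ⊥-elim (apart (inU M₁ x∈₁ b) (inU M₂ (split y∈ y∉) b′))
      dj x∈ y∈ (no x∉) (yes y∈₁) b b′ = ⊥-elim (apart (inU M₁ y∈₁ b′) (inU M₂ (split x∈ x∉) b))
      dj x∈ y∈ (no x∉) (no y∉) b b′ = disj M₂ (split x∈ x∉) (split y∈ y∉) b b′
      ed : ∀ {x y} → x ∈ W → y ∈ W → (d : Dec (x ∈ W₁)) (e : Dec (y ∈ W₁)) → x ↔ y →
        Touch (mergeBag M₁ M₂ x d) (mergeBag M₁ M₂ y e)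
      ed x∈ y∈ (yes x∈₁) (yes y∈₁) e = edge M₁ x∈₁ y∈₁ e
      ed x∈ y∈ (yes x∈₁) (no y∉) e = ⊥-elim (no-edge x∈₁ y∈ y∉ e)
      ed x∈ y∈ (no x∉) (yes y∈₁) e = ⊥-elim (no-edge y∈₁ x∈ x∉ (Defs.sym H e))
      ed x∈ y∈ (no x∉) (no y∉) e = edge M₂ (split x∈ x∉) (split y∈ y∉) e

    mergePack : ∀ {d} → Pack W₁ d U₁ → Pack W₂ d U₂ → Pack W d U
    mergePack P₁ P₂ = record
      { copy = λ t → mergeModel (copy P₁ t) (copy P₂ t)
      ; copies = λ {s} {t} {x} {y} x∈ y∈ → cp x∈ y∈ (x ∈? W₁) (y ∈? W₁) }
      where
      cp : ∀ {s t x y v} → x ∈ W → y ∈ W → (d : Dec (x ∈ W₁)) (e : Dec (y ∈ W₁)) →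
        mergeBag (copy P₁ s) (copy P₂ s) x d v → mergeBag (copy P₁ t) (copy P₂ t) y e v → s ≡ t
      cp x∈ y∈ (yes x∈₁) (yes y∈₁) b b′ = copies P₁ x∈₁ y∈₁ b b′
      cp {s} {t} x∈ y∈ (yes x∈₁) (no y∉) b b′ = ⊥-elim (apart (inU (copy P₁ s) x∈₁ b) (inU (copy P₂ t) (split y∈ y∉) b′))
      cp {s} {t} x∈ y∈ (no x∉) (yes y∈₁) b b′ = ⊥-elim (apart (inU (copy P₁ t) y∈₁ b′) (inU (copy P₂ s) (split x∈ x∉) b))
      cp x∈ y∈ (no x∉) (no y∉) b b′ = copies P₂ (split x∈ x∉) (split y∈ y∉) b b′

  pack-size : ∀ {W d U} → Nonempty W → Pack W d U → d ≤ n
  pack-size (x , x∈) P = injective⇒≤ {f = λ t → proj₁ (nonempty (copy P t) x∈)} λ {s} {t} eq →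
    copies P x∈ x∈ (proj₂ (nonempty (copy P s) x∈)) (subst (B (copy P t) x) (≡sym eq) (proj₂ (nonempty (copy P t) x∈)))

  ConnectedPattern : Subset h → Set
  ConnectedPattern A = ∀ (f : Fin h → Bool) → (∀ {x y} → x ∈ A → y ∈ A → x ↔ y → f x ≡ f y) →
    ∀ {x y} → x ∈ A → y ∈ A → f x ≡ f y

  -- A colouring constant along the edges inside the model is constant on each branch set, so it
  -- descends to the connected pattern `A`. Applied to the side of a cut, it confines a model to one
  -- side.
  localize : ∀ {A U} → Nonempty A → ConnectedPattern A → (M : Model A U) (g : V → Bool) →
    (∀ {x y u v} → x ∈ A → y ∈ A → B M x u → B M y v → u ~ v → g u ≡ g v) →
    ∃[ b ] (∀ {x v} → x ∈ A → B M x v → g v ≡ b)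
  localize {A} (x₀ , x₀∈) connA M g inv = f x₀ , λ {x} x∈ b → trans (mono x∈ b) (connA f f-inv x∈ x₀∈)
    where
    fOf : ∀ x → Dec (x ∈ A) → Bool
    fOf x (yes x∈) = g (proj₁ (nonempty M x∈))
    fOf x (no _) = true
    f : Fin h → Bool
    f x = fOf x (x ∈? A)
    mono : ∀ {x v} → x ∈ A → B M x v → g v ≡ f x
    mono {x} x∈ b with x ∈? A
    ... | yes x∈′ = conn M x∈ g (λ k l → inv x∈ x∈ k l) b (proj₂ (nonempty M x∈′))
    ... | no x∉ = ⊥-elim (x∉ x∈)
    f-inv : ∀ {x y} → x ∈ A → y ∈ A → x ↔ y → f x ≡ f y
    f-inv x∈ y∈ e with edge M x∈ y∈ e
    ... | u , v , bu , bv , uv = trans (≡sym (mono x∈ bu)) (trans (inv x∈ y∈ bu bv uv) (mono y∈ bv))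

  module _ (pd : Defs.PathDecomposition 2 H) (U : Subset n) where
    open Process _~_ ~-sym _~?_ U using (Ladder)
    open Embedding H adj? pd _~_ ~-sym _~?_ U using (module Columns)

    subLadder : ∀ {N m} → Ladder N → (e : Fin m → Fin N) (o : ℕ) → (∀ j → toℕ (e j) ≡ o + toℕ j) → Ladder m
    subLadder lad e o eq = record
      { part = λ a j → L.part a (e j) ; conn = λ a j → L.conn a (e j)
      ; disj = λ p q → proj₁ (L.disj p q) , e-inj (proj₂ (L.disj p q))
      ; rail = λ s {i} {j} next → L.rail s (trans (eq j) (trans (cong (o +_) next) (trans (ℕ.+-suc o _) (cong suc (≡sym (eq i))))))
      ; rung = λ s j → L.rung s (e j) ; inU = L.inU }
      where
      module L = Ladder lad
      e-inj : ∀ {i j} → e i ≡ e j → i ≡ j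
      e-inj {i} {j} q = toℕ-injective (ℕ.+-cancelˡ-≡ o _ _ (trans (≡sym (eq i)) (trans (cong toℕ q) (eq j))))

    ladderModel : (L : Ladder h) → Σ[ M ∈ Model full U ] (∀ {x v} → B M x v → ∃[ p ] ∃[ i ] Ladder.part L p i v)
    ladderModel L with Columns.complete L (<-wellFounded _) (ℕ.≤-reflexive (Sub.∣⊤∣≡n h)) (Columns.start L)
    ... | t , R , P , all = record
      { B = P.B ; nonempty = λ {x} _ → P.nonempty (all x) ; conn = λ {x} _ → P.B-conn (all x)
      ; disj = λ _ _ → P.B-disj ; edge = λ {x} {y} _ _ → P.B-edge (all x) (all y)
      ; inU = λ _ b → let p , i , _ , q = P.used b in Ladder.inU L q }
      , λ b → let p , i , _ , q = P.used b in p , i , q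
      where module P = Columns.Partial P

    ladderPack : ∀ {N} d → d * h ≤ N → Ladder N → Pack full d U
    ladderPack {N} d le L = record
      { copy = λ t → proj₁ (ladderModel (piece t))
      ; copies = λ {s} {t} _ _ b b′ →
          let p , i , q = proj₂ (ladderModel (piece s)) b
              p′ , j , q′ = proj₂ (ladderModel (piece t)) b′
          in combine-injectiveˡ s i t j (inject≤-injective le le _ _ (proj₂ (Ladder.disj L q q′))) }
      where
      piece : Fin d → Ladder h
      -- The copies take consecutive blocks of `h` columns, the one numbered `t` starting at column
      -- `h * toℕ t`.
      piece t = subLadder L (λ j → inject≤ (combine t j) le) (h * toℕ t)
        λ j → trans (toℕ-inject≤ (combine t j) le) (toℕ-combine t j)

-- The arithmetic of the bounds.

module Sizes (h : ℕ) where

  ladderLength : ℕ → ℕ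
  ladderLength d = d * h

  linkSize : ℕ → ℕ
  linkSize d = suc (ladderLength d * ladderLength d)

  cutSize : ℕ → ℕ
  cutSize d = linkSize d + linkSize d + linkSize d

  -- Comes from 3(((k + 1)h)² + 1) by k + 1 ≤ 2k and 1 ≤ k².
  unit : ℕ
  unit = 3 + 12 * (h * h)

  -- One `unit * (k * k)` pays for the cut, the other for the three recursive covers.
  bound : ℕ → ℕ
  bound k = (unit + unit) * (k * k)

  open +-*-Solver using (solve; _:+_; _:*_; _:=_; con)

  cutSize≤ : ∀ {k} → 1 ≤ k → cutSize (suc k) ≤ unit * (k * k)
  cutSize≤ {k} 1≤k = ℕ.≤-trans (ℕ.+-mono-≤ (ℕ.+-mono-≤ step step) step) (ℕ.≤-reflexive
    (solve 2 (λ s t → (s :+ t :* con 4 :* s) :+ (s :+ t :* con 4 :* s) :+ (s :+ t :* con 4 :* s)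
                       := (con 3 :+ con 12 :* t) :* s) refl (k * k) (h * h)))
    where
    doubled : suc k * h ≤ (k + k) * h
    doubled = ℕ.*-monoˡ-≤ h (ℕ.+-monoˡ-≤ k 1≤k)
    step : linkSize (suc k) ≤ k * k + h * h * 4 * (k * k)
    step = ℕ.+-mono-≤ {1} (ℕ.*-mono-≤ 1≤k 1≤k) (ℕ.≤-trans (ℕ.*-mono-≤ doubled doubled) (ℕ.≤-reflexive
      (solve 2 (λ k h → ((k :+ k) :* h) :* ((k :+ k) :* h) := h :* h :* con 4 :* (k :* k)) refl k h)))

  -- As each part is at most k/2, 2(o² + c₁² + c₂²) ≤ k(o + c₁ + c₂) ≤ k².
  halves : ∀ {k o c₁ c₂} → 1 ≤ k → o + o ≤ k → c₁ + c₁ ≤ k → c₂ + c₂ ≤ k → o + (c₁ + c₂) ≤ k →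
    cutSize (suc k) + (bound o + (bound c₁ + bound c₂)) ≤ bound k
  halves {k} {o} {c₁} {c₂} 1≤k ho h₁ h₂ sum = ℕ.≤-trans
    (ℕ.+-mono-≤ (cutSize≤ 1≤k) (ℕ.≤-trans (ℕ.≤-reflexive regroup) (ℕ.*-monoʳ-≤ unit squares)))
    (ℕ.≤-reflexive (≡sym (ℕ.*-distribʳ-+ (k * k) unit unit)))
    where
    regroup : bound o + (bound c₁ + bound c₂) ≡ unit * ((o + o) * o + ((c₁ + c₁) * c₁ + (c₂ + c₂) * c₂))
    regroup = solve 4 (λ e o c d → (e :+ e) :* (o :* o) :+ ((e :+ e) :* (c :* c) :+ (e :+ e) :* (d :* d))
                := e :* ((o :+ o) :* o :+ ((c :+ c) :* c :+ (d :+ d) :* d))) refl unit o c₁ c₂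
    squares : (o + o) * o + ((c₁ + c₁) * c₁ + (c₂ + c₂) * c₂) ≤ k * k
    squares = ℕ.≤-trans (ℕ.+-mono-≤ (ℕ.*-monoˡ-≤ o ho) (ℕ.+-mono-≤ (ℕ.*-monoˡ-≤ c₁ h₁) (ℕ.*-monoˡ-≤ c₂ h₂)))
      (ℕ.≤-trans (ℕ.≤-reflexive (solve 4 (λ k o c d → k :* o :+ (k :* c :+ k :* d) := k :* (o :+ (c :+ d))) refl k o c₁ c₂))
        (ℕ.*-monoʳ-≤ k sum))

  double≤⇒< : ∀ {c k} → 1 ≤ k → c + c ≤ k → c < k
  double≤⇒< {zero} 1≤k _ = 1≤k
  double≤⇒< {suc c} _ le = ℕ.<-≤-trans (ℕ.m<m+n (suc c) (s≤s z≤n)) le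

  -- The price of setting one component aside: a cut, and a cover for each of its two light pieces.
  cost : ℕ → ℕ
  cost d = cutSize d + (bound d + bound d)

  -- 17 = 1 + 2 · 2 · 4: one `unit` for the cut, and two bounds of two units each at k + 1 ≤ 2k.
  cost≤ : ∀ {k} → 1 ≤ k → cost (suc k) ≤ 17 * unit * (k * k)
  cost≤ {k} 1≤k = ℕ.≤-trans (ℕ.+-mono-≤ (cutSize≤ 1≤k) (ℕ.+-mono-≤ doubled doubled)) (ℕ.≤-reflexive
    (solve 2 (λ e k → e :* (k :* k) :+ ((e :+ e) :* ((k :+ k) :* (k :+ k)) :+ (e :+ e) :* ((k :+ k) :* (k :+ k)))
                := con 17 :* e :* (k :* k)) refl unit k))
    where
    doubled : bound (suc k) ≤ (unit + unit) * ((k + k) * (k + k))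
    doubled = ℕ.*-monoʳ-≤ (unit + unit) (ℕ.*-mono-≤ (ℕ.+-monoˡ-≤ k 1≤k) (ℕ.+-monoˡ-≤ k 1≤k))

  n≤2^n : ∀ n → n ≤ 2 ^ n
  n≤2^n zero = z≤n
  n≤2^n (suc n) = ℕ.≤-trans (ℕ.+-mono-≤ (ℕ.m^n>0 2 n) (n≤2^n n))
    (ℕ.≤-reflexive (cong (2 ^ n +_) (≡sym (ℕ.+-identityʳ (2 ^ n)))))

  -- `unit` is at most 15h², 17 · 15 = 255 is below 2 ^ 8, and each of the three factors h is at
  -- most 2 ^ (h * h); hence the exponent 8 + 3.
  total≤ : ∀ {k} → 1 ≤ h → 1 ≤ k → h * cost (suc k) ≤ 2 ^ (11 * (h * h)) * (k * k)
  total≤ {k} 1≤h 1≤k = ℕ.≤-trans (ℕ.*-monoʳ-≤ h (cost≤ 1≤k))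
    (ℕ.≤-trans (ℕ.≤-reflexive (≡sym (ℕ.*-assoc h (17 * unit) (k * k)))) (ℕ.*-monoˡ-≤ (k * k) constants))
    where
    p : ℕ
    p = 2 ^ (h * h)
    1≤h² : 1 ≤ h * h
    1≤h² = ℕ.*-mono-≤ 1≤h 1≤h
    h≤p : h ≤ p
    h≤p = ℕ.≤-trans (ℕ.≤-trans (ℕ.≤-reflexive (≡sym (ℕ.*-identityˡ h))) (ℕ.*-mono-≤ 1≤h (ℕ.≤-refl {h}))) (n≤2^n (h * h))
    power : 2 ^ (8 * (h * h)) * (p * (p * p)) ≡ 2 ^ (11 * (h * h))
    power = ≡sym (trans (cong (2 ^_) (ℕ.*-distribʳ-+ (h * h) 8 3)) (trans (ℕ.^-distribˡ-+-* 2 (8 * (h * h)) (3 * (h * h)))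
      (cong (2 ^ (8 * (h * h)) *_) (trans (ℕ.^-distribˡ-+-* 2 (h * h) (2 * (h * h)))
        (cong (p *_) (trans (ℕ.^-distribˡ-+-* 2 (h * h) (1 * (h * h))) (cong (λ e → p * 2 ^ e) (ℕ.*-identityˡ (h * h)))))))))
    constants : h * (17 * unit) ≤ 2 ^ (11 * (h * h))
    constants = ℕ.≤-trans (ℕ.*-monoʳ-≤ h (ℕ.*-monoʳ-≤ 17 (ℕ.+-monoˡ-≤ (12 * (h * h)) (ℕ.*-monoʳ-≤ 3 1≤h²))))
      (ℕ.≤-trans (ℕ.≤-reflexive (solve 1 (λ h → h :* (con 17 :* (con 3 :* (h :* h) :+ con 12 :* (h :* h)))
                                    := con 255 :* (h :* (h :* h))) refl h))
        (ℕ.≤-trans (ℕ.*-mono-≤ {255} {2 ^ (8 * (h * h))}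
            (ℕ.≤-trans (ℕ.n≤1+n 255) (ℕ.^-monoʳ-≤ 2 {8} {8 * (h * h)} (ℕ.*-monoʳ-≤ 8 1≤h²)))
            (ℕ.*-mono-≤ h≤p (ℕ.*-mono-≤ h≤p h≤p)))
          (ℕ.≤-reflexive power)))

-- Covers for connected patterns.

module ErdősPósa (H : Defs.Graph) (adj? : ∀ x y → Dec (Defs.Adj H x y)) (pd : Defs.PathDecomposition 2 H)
  {n : ℕ} (_~_ : Fin n → Fin n → Set) (~-sym : ∀ {u v} → u ~ v → v ~ u)
  (_~?_ : ∀ u v → Dec (u ~ v)) where

  open Host _~_ ~-sym _~?_
  open Models H adj? _~_ ~-sym _~?_
  open Model
  open Sizes h

  Cut : Subset n → (Subset n → Set) → ℕ → Set
  Cut = Core.Cut _~_ ~-sym _~?_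

  -- `hits` is a refutation because branch sets are undecided predicates, in which a vertex of `Z`
  -- cannot be searched for.
  record Cover (A : Subset h) (U : Subset n) (N : ℕ) : Set₁ where
    field
      Z     : List V
      small : length Z ≤ N
      hits  : (M : Model A U) → (∀ {x v} → x ∈ A → B M x v → ¬ v ∈ˡ Z) → ⊥

  weakenCover : ∀ {A U N N′} → N ≤ N′ → Cover A U N → Cover A U N′
  weakenCover le c = record { Cover c ; small = ℕ.≤-trans (Cover.small c) le }

  module Outside {U : Subset n} {Heavy : Subset n → Set} {N : ℕ} (cut : Cut U Heavy N) where
    open Core.Cut cut

    outside? : ∀ v → Dec (v ∈ U × v ∉ C × ¬ v ∈ˡ Z)
    outside? v = (v ∈? U) ×-dec (¬? (v ∈? C) ×-dec ¬? (v ∈ˡ? Z))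

    O : Subset n
    O = comprehension outside?

    O⊆U : O ⊆ U
    O⊆U v∈ = proj₁ (∈-comprehension⁻ outside? v∈)

    O-off : ∀ {v} → v ∈ O → v ∈ C → ⊥
    O-off v∈ = proj₁ (proj₂ (∈-comprehension⁻ outside? v∈))

    does-∈ : ∀ (p : Subset n) {b v} → does (v ∈? p) ≡ b → (b ≡ true → v ∈ p) × (b ≡ false → v ∉ p)
    does-∈ p {v = v} eq with v ∈? p | eq
    ... | yes v∈ | refl = (λ _ → v∈) , λ ()
    ... | no v∉ | refl = (λ ()) , λ _ → v∉

    does-cong : ∀ (p : Subset n) {u v} → (u ∈ p → v ∈ p) → (v ∈ p → u ∈ p) → does (u ∈? p) ≡ does (v ∈? p)
    does-cong p {u} {v} f g with u ∈? p | v ∈? p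
    ... | yes _ | yes _ = refl
    ... | yes u∈ | no v∉ = ⊥-elim (v∉ (f u∈))
    ... | no u∉ | yes v∈ = ⊥-elim (u∉ (g v∈))
    ... | no _ | no _ = refl

    -- A connected model avoiding Z lies on one side of the cut.
    combine-covers : ∀ {A a b c} → Nonempty A → ConnectedPattern A →
      Cover A O a → Cover A C₁ b → Cover A C₂ c → Cover A U (N + (a + (b + c)))
    combine-covers {A} {a} {b} {c} A≠∅ connA cO c₁ c₂ = record
      { Z = Z ++ (Cover.Z cO ++ (Cover.Z c₁ ++ Cover.Z c₂))
      ; small = subst (_≤ N + (a + (b + c))) (≡sym lengths)
          (ℕ.+-mono-≤ (Core.Cut.small cut) (ℕ.+-mono-≤ (Cover.small cO) (ℕ.+-mono-≤ (Cover.small c₁) (Cover.small c₂))))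
      ; hits = hits′ }
      where
      lengths : length (Z ++ (Cover.Z cO ++ (Cover.Z c₁ ++ Cover.Z c₂))) ≡
        length Z + (length (Cover.Z cO) + (length (Cover.Z c₁) + length (Cover.Z c₂)))
      lengths = trans (length-++ Z) (cong (length Z +_) (trans (length-++ (Cover.Z cO))
        (cong (length (Cover.Z cO) +_) (length-++ (Cover.Z c₁)))))
      hits′ : (M : Model A U) → (∀ {x v} → x ∈ A → B M x v → ¬ v ∈ˡ Z ++ (Cover.Z cO ++ (Cover.Z c₁ ++ Cover.Z c₂))) → ⊥
      hits′ M avoid = inside-or-outside (localize A≠∅ connA M (λ v → does (v ∈? C)) inv)
        where
        Z-free : ∀ {x v} → x ∈ A → B M x v → ¬ v ∈ˡ Z
        Z-free x∈ b m = avoid x∈ b (∈-++⁺ˡ m)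
        closed : ∀ {x y u v} → x ∈ A → y ∈ A → B M x u → B M y v → u ~ v → u ∈ C → v ∈ C
        closed {v = v} x∈ y∈ bu bv e u∈ with v ∈? C
        ... | yes v∈ = v∈
        ... | no v∉ = ⊥-elim (Z-free y∈ bv (bdry u∈ (inU M y∈ bv) v∉ e))
        inv : ∀ {x y u v} → x ∈ A → y ∈ A → B M x u → B M y v → u ~ v → does (u ∈? C) ≡ does (v ∈? C)
        inv x∈ y∈ bu bv e = does-cong C (closed x∈ y∈ bu bv e) (closed y∈ x∈ bv bu (~-sym e))
        within : (∀ {x v} → x ∈ A → B M x v → v ∈ C) → ⊥
        within inC = one-side (localize A≠∅ connA M (λ v → does (v ∈? C₁)) inv₁)
          where
          other : ∀ {x v} → x ∈ A → B M x v → v ∉ C₁ → v ∈ C₂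
          other x∈ b v∉ with cover (inC x∈ b)
          ... | inj₁ m = ⊥-elim (Z-free x∈ b m)
          ... | inj₂ (inj₁ v∈) = ⊥-elim (v∉ v∈)
          ... | inj₂ (inj₂ v∈) = v∈
          stay : ∀ {x y u v} → x ∈ A → y ∈ A → B M x u → B M y v → u ~ v → u ∈ C₁ → v ∈ C₁
          stay {v = v} x∈ y∈ bu bv e u∈ with v ∈? C₁
          ... | yes v∈ = v∈
          ... | no v∉ = ⊥-elim (no-edge u∈ (other y∈ bv v∉) e)
          inv₁ : ∀ {x y u v} → x ∈ A → y ∈ A → B M x u → B M y v → u ~ v → does (u ∈? C₁) ≡ does (v ∈? C₁)
          inv₁ x∈ y∈ bu bv e = does-cong C₁ (stay x∈ y∈ bu bv e) (stay y∈ x∈ bv bu (~-sym e))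
          one-side : ∃[ b ] (∀ {x v} → x ∈ A → B M x v → does (v ∈? C₁) ≡ b) → ⊥
          one-side (true , eq) = Cover.hits c₁ (retarget M (λ x∈ b → proj₁ (does-∈ C₁ (eq x∈ b)) refl))
            (λ x∈ b m → avoid x∈ b (∈-++⁺ʳ Z (∈-++⁺ʳ (Cover.Z cO) (∈-++⁺ˡ m))))
          one-side (false , eq) = Cover.hits c₂ (retarget M (λ x∈ b → other x∈ b (proj₂ (does-∈ C₁ (eq x∈ b)) refl)))
            (λ x∈ b m → avoid x∈ b (∈-++⁺ʳ Z (∈-++⁺ʳ (Cover.Z cO) (∈-++⁺ʳ (Cover.Z c₁) m))))
        inside-or-outside : ∃[ b ] (∀ {x v} → x ∈ A → B M x v → does (v ∈? C) ≡ b) → ⊥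
        inside-or-outside (true , eq) = within (λ x∈ b → proj₁ (does-∈ C (eq x∈ b)) refl)
        inside-or-outside (false , eq) = Cover.hits cO
          (retarget M (λ x∈ b → ∈-comprehension⁺ outside? (inU M x∈ b , proj₂ (does-∈ C (eq x∈ b)) refl , Z-free x∈ b)))
          (λ x∈ b m → avoid x∈ b (∈-++⁺ʳ Z (∈-++⁺ˡ m)))

  ladder-or-cut : ∀ U (Heavy : Subset n → Set) → (∀ C → Dec (Heavy C)) → (∀ {C} → Heavy C → Nonempty C) →
    ∀ d → Heavy U → Pack full d U ⊎ Cut U Heavy (cutSize d)
  ladder-or-cut U Heavy heavy? ne d hU
    with Core.ladder-or-cut _~_ ~-sym _~?_ U Heavy heavy? ne (ladderLength d) (linkSize d) ℕ.≤-refl hU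
  ... | inj₁ lad = inj₁ (ladderPack pd U d (ℕ.n≤1+n _) lad)
  ... | inj₂ cut = inj₂ cut

  pack-nonempty : ∀ {A d U} → Nonempty A → 1 ≤ d → Pack A d U → Nonempty U
  pack-nonempty (x , x∈) (s≤s z≤n) P = let v , b = nonempty (Pack.copy P zero) x∈ in v , inU (Pack.copy P zero) x∈ b

  module Pattern (A : Subset h) (A≠∅ : Nonempty A) (connA : ConnectedPattern A) (ν : Subset n → ℕ)
    (packν : ∀ U → Pack A (ν U) U) (maxν : ∀ {U d} → Pack A d U → d ≤ ν U) where

    superadditive : ∀ {U₁ U₂ U} → U₁ ⊆ U → U₂ ⊆ U → (∀ {v} → v ∈ U₁ → v ∈ U₂ → ⊥) → ν U₁ + ν U₂ ≤ ν U
    superadditive {U₁} {U₂} s₁ s₂ ap = maxν (pack-+ s₁ s₂ ap (packν U₁) (packν U₂))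

    -- Induction on the packing number `k`. Packings of the outside `O` and of `C` add up, so a
    -- heavy `C` leaves `O` at most half of `k`; `C₁` and `C₂` have at most half because they are
    -- light.
    coverBy : ∀ U → Acc _<_ (ν U) → Cover A U (bound (ν U))
    coverBy U (acc rec) with ν U in eq
    ... | zero = record { Z = [] ; small = z≤n ; hits = λ M _ → absurd (subst (1 ≤_) eq (maxν (singlePack M))) }
      where absurd : 1 ≤ 0 → ⊥
            absurd ()
    ... | suc k-1 = answer (ladder-or-cut U Heavy (λ C → k <? ν C + ν C) (λ {C} → heavy-nonempty {C}) (suc k) heavyU)
      where
      k : ℕ
      k = suc k-1
      Heavy : Subset n → Set
      Heavy C = k < ν C + ν C
      heavy-nonempty : ∀ {C} → Heavy C → Nonempty C
      heavy-nonempty {C} hC = pack-nonempty A≠∅ (positive (ν C) hC) (packν C)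
        where positive : ∀ m → k < m + m → 1 ≤ m
              positive (suc m) _ = s≤s z≤n
      heavyU : Heavy U
      heavyU = subst (λ m → k < m + m) (≡sym eq) (ℕ.m<m+n k (s≤s z≤n))
      answer : Pack full (suc k) U ⊎ Cut U Heavy (cutSize (suc k)) → Cover A U (bound k)
      -- Copies of `H` contain copies of `A`, so `suc k` of them exceed the packing number.
      answer (inj₁ P) = ⊥-elim (ℕ.<-irrefl refl (subst (suc k ≤_) eq (maxν {U} (restrictPack (λ _ → ∈⊤) P))))
      answer (inj₂ cut) = weakenCover (halves {o = ν O} {ν C₁} {ν C₂} (s≤s z≤n) O-half half₁ half₂ total)
        (combine-covers A≠∅ connA (coverBy O (rec (double≤⇒< (s≤s z≤n) O-half))) (coverBy C₁ (rec (double≤⇒< (s≤s z≤n) half₁))) (coverBy C₂ (rec (double≤⇒< (s≤s z≤n) half₂))))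
        where
        open Core.Cut cut
        open Outside cut
        sumOC : ν O + ν C ≤ k
        sumOC = subst (ν O + ν C ≤_) eq (superadditive O⊆U C⊆U O-off)
        half₁ : ν C₁ + ν C₁ ≤ k
        half₁ = ℕ.≮⇒≥ light₁
        half₂ : ν C₂ + ν C₂ ≤ k
        half₂ = ℕ.≮⇒≥ light₂
        total : ν O + (ν C₁ + ν C₂) ≤ k
        total = ℕ.≤-trans (ℕ.+-monoʳ-≤ (ν O) (superadditive C₁⊆C C₂⊆C disjoint)) sumOC
        O-half : ν O + ν O ≤ k
        O-half with ℕ.≤-total (ν O) (ν C)
        ... | inj₁ le = ℕ.≤-trans (ℕ.+-monoʳ-≤ (ν O) le) sumOC
        ... | inj₂ ge = ⊥-elim (ℕ.<⇒≱ heavy (ℕ.≤-trans (ℕ.+-monoˡ-≤ (ν C) ge) sumOC))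

    coverPattern : ∀ U → Cover A U (bound (ν U))
    coverPattern U = coverBy U (<-wellFounded _)

-- Disconnected `H`, component by component.

module Disconnected (H : Defs.Graph) (adj? : ∀ x y → Dec (Defs.Adj H x y)) (pd : Defs.PathDecomposition 2 H)
  {n : ℕ} (_~_ : Fin n → Fin n → Set) (~-sym : ∀ {u v} → u ~ v → v ~ u)
  (_~?_ : ∀ u v → Dec (u ~ v)) where

  open Models H adj? _~_ ~-sym _~?_
  open ErdősPósa H adj? pd _~_ ~-sym _~?_
  open Sizes h

  Closed : Subset h → Set
  Closed A = ∀ x y → x ∈ A → x ↔ y → y ∈ A

  Component : Subset h → Set
  Component A = Nonempty A × ConnectedPattern A × Closed A

  closed? : ∀ A → Dec (Closed A)
  closed? A = all? λ x → all? λ y → (x ∈? A) →-dec (adj? x y →-dec (y ∈? A))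

  -- A nonempty closed set with no smaller one inside is connected: a class of a nontrivial
  -- colouring constant along edges would be a smaller one.
  component-within : ∀ W → Acc _<_ ∣ W ∣ → Nonempty W → Closed W → ∃[ A ] (Component A × A ⊆ W)
  component-within W (acc rec) ne cl
    with anySubset? (λ A → (A ⊆? W) ×-dec ((∣ A ∣ <? ∣ W ∣) ×-dec (Sub.nonempty? A ×-dec closed? A)))
  ... | yes (A , sub , lt , neA , clA) = let A′ , comp , sub′ = component-within A (rec lt) neA clA
                                         in A′ , comp , λ x∈ → sub (sub′ x∈)
  ... | no minimal = W , (ne , connected , cl) , id
    where
    connected : ConnectedPattern W
    connected f inv {x} {y} x∈ y∈ with f x Bool.≟ f y
    ... | yes eq = eq
    ... | no neq = ⊥-elim (minimal (class , (λ z∈ → proj₁ (∈-comprehension⁻ class? z∈))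
            , Sub.p⊂q⇒∣p∣<∣q∣ ((λ z∈ → proj₁ (∈-comprehension⁻ class? z∈)) , y , y∈ , λ y∈′ → neq (≡sym (proj₂ (∈-comprehension⁻ class? y∈′))))
            , (x , ∈-comprehension⁺ class? (x∈ , refl)) , closed))
      where
      class? : ∀ z → Dec (z ∈ W × f z ≡ f x)
      class? z = (z ∈? W) ×-dec (f z Bool.≟ f x)
      class : Subset h
      class = comprehension class?
      closed : Closed class
      closed z z′ z∈ e with ∈-comprehension⁻ class? z∈
      ... | z∈W , eq = ∈-comprehension⁺ class? (cl z z′ z∈W e , trans (≡sym (inv z∈W (cl z z′ z∈W e) e)) eq)

  module _ (component? : ∀ A → Dec (Component A)) (ν : Subset h → Subset n → ℕ)
    (packν : ∀ {A} → Component A → ∀ U → Pack A (ν A U) U)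
    (maxν : ∀ {A} → Component A → ∀ {U d} → Pack A d U → d ≤ ν A U)
    (d : ℕ) (1≤d : 1 ≤ d) where

    -- Covering a single component is enough, since a model of `H` restricts to a model of each
    -- component.
    Covered : Subset h → Subset n → Set₁
    Covered W U = Σ[ A ∈ Subset h ] (Component A × A ⊆ W × Cover A U (∣ W ∣ * cost d))

    bound-mono : ∀ {k} → k ≤ d → bound k ≤ bound d
    bound-mono le = ℕ.*-monoʳ-≤ (unit + unit) (ℕ.*-mono-≤ le le)

    light-cover : ∀ {A} → Component A → ∀ U → ¬ d ≤ ν A U → Cover A U (bound d)
    light-cover {A} c@(ne , conn , _) U light = weakenCover (bound-mono (ℕ.<⇒≤ (ℕ.≰⇒> light)))
      (Pattern.coverPattern A ne conn (ν A) (packν c) (maxν c) U)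

    -- A component with `d` copies in `C` is set aside and the rest of `W` is treated in `O`: either
    -- `d` copies found there unite with those in `C`, or a cover of some `A′` in `O` is completed
    -- by the cut and by covers of `A′` in the light pieces. `Heavy` ranges over all components
    -- because `A′` is known only after the recursion.
    pack-or-cover : ∀ W → Acc _<_ ∣ W ∣ → Closed W → ∀ U → Pack W d U ⊎ Covered W U
    pack-or-cover W (acc rec) clW U with Sub.nonempty? W
    ... | no none = inj₁ (emptyPack (λ {x} x∈ → none (x , x∈)) d)
    ... | yes neW = decide (heavy? U)
      where
      Heavy : Subset n → Set
      Heavy C = ∃[ A ] (A ⊆ W × Component A × d ≤ ν A C)
      heavy? : ∀ C → Dec (Heavy C)
      heavy? C = anySubset? (λ A → (A ⊆? W) ×-dec (component? A ×-dec (d ≤? ν A C)))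
      heavy-nonempty : ∀ {C} → Heavy C → Nonempty C
      heavy-nonempty {C} (A , _ , comp , le) = pack-nonempty (proj₁ comp) (ℕ.≤-trans 1≤d le) (packν comp C)
      decide : Dec (Heavy U) → Pack W d U ⊎ Covered W U
      decide (no light) with component-within W (<-wellFounded _) neW clW
      ... | A , comp , sub = inj₂ (A , comp , sub , weakenCover enough (light-cover comp U (λ le → light (A , sub , comp , le))))
        where
        enough : bound d ≤ ∣ W ∣ * cost d
        enough = ℕ.≤-trans (ℕ.≤-trans (ℕ.m≤n+m (bound d) (cutSize d + bound d)) (ℕ.≤-reflexive (ℕ.+-assoc (cutSize d) (bound d) (bound d))))
          (ℕ.≤-trans (ℕ.≤-reflexive (≡sym (ℕ.*-identityˡ (cost d)))) (ℕ.*-monoˡ-≤ (cost d) (ℕ.≤-trans (s≤s z≤n) (∣remove∣ (proj₂ neW)))))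
      decide (yes heavyU) = split (ladder-or-cut U Heavy heavy? heavy-nonempty d heavyU)
        where
        split : Pack full d U ⊎ Cut U Heavy (cutSize d) → Pack W d U ⊎ Covered W U
        split (inj₁ P) = inj₁ (restrictPack (λ _ → ∈⊤) P)
        split (inj₂ cut) with Core.Cut.heavy cut
        ... | A , A⊆W , comp , d≤ν = finish (pack-or-cover W′ (rec smaller) closed′ O)
          where
          open Core.Cut cut
          open Outside cut
          W′? : ∀ x → Dec (x ∈ W × x ∉ A)
          W′? x = (x ∈? W) ×-dec ¬? (x ∈? A)
          W′ : Subset h
          W′ = comprehension W′?
          closed′ : Closed W′
          closed′ x y x∈ e with ∈-comprehension⁻ W′? x∈
          ... | x∈W , x∉A = ∈-comprehension⁺ W′? (clW x y x∈W e , λ y∈A → x∉A (proj₂ (proj₂ comp) y x y∈A (Defs.sym H e)))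
          smaller : ∣ W′ ∣ < ∣ W ∣
          smaller = let x , x∈A = proj₁ comp in Sub.p⊂q⇒∣p∣<∣q∣
            ((λ y∈ → proj₁ (∈-comprehension⁻ W′? y∈)) , x , A⊆W x∈A , λ x∈ → proj₂ (∈-comprehension⁻ W′? x∈) x∈A)
          finish : Pack W′ d O ⊎ Covered W′ O → Pack W d U ⊎ Covered W U
          finish (inj₁ P) = inj₁ (Merge.mergePack (λ x∈ x∉ → ∈-comprehension⁺ W′? (x∈ , x∉))
            (λ {x} {y} x∈ _ y∉ e → y∉ (proj₂ (proj₂ comp) x y x∈ e)) C⊆U O⊆U (λ c o → O-off o c)
            (shrinkPack d≤ν (packν comp C)) P)
          finish (inj₂ (A′ , comp′ , sub′ , cover′)) = inj₂ (A′ , comp′ , A′⊆W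
            , weakenCover total (combine-covers (proj₁ comp′) (proj₁ (proj₂ comp′)) cover′
                (light-cover comp′ C₁ (λ le → light₁ (A′ , A′⊆W , comp′ , le)))
                (light-cover comp′ C₂ (λ le → light₂ (A′ , A′⊆W , comp′ , le)))))
            where
            A′⊆W : A′ ⊆ W
            A′⊆W x∈ = proj₁ (∈-comprehension⁻ W′? (sub′ x∈))
            total : cutSize d + (∣ W′ ∣ * cost d + (bound d + bound d)) ≤ ∣ W ∣ * cost d
            total = ℕ.≤-trans (ℕ.≤-reflexive (trans (cong (cutSize d +_) (ℕ.+-comm (∣ W′ ∣ * cost d) (bound d + bound d)))
              (≡sym (ℕ.+-assoc (cutSize d) (bound d + bound d) (∣ W′ ∣ * cost d))))) (ℕ.*-monoˡ-≤ (cost d) smaller)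

    coverModel : (∀ U → ¬ Pack full d U) → Σ[ Z ∈ List (Fin n) ] (length Z ≤ h * cost d ×
      ((M : Model full full) → (∀ {x v} → Model.B M x v → ¬ v ∈ˡ Z) → ⊥))
    coverModel none with pack-or-cover full (<-wellFounded _) (λ _ _ _ _ → ∈⊤) full
    ... | inj₁ P = ⊥-elim (none full P)
    ... | inj₂ (A , comp , _ , c) = Cover.Z c , subst (λ m → length (Cover.Z c) ≤ m * cost d) (Sub.∣⊤∣≡n h) (Cover.small c)
          , λ M avoid → Cover.hits c (restrict (λ _ → ∈⊤) M) (λ _ → avoid)

-- Finite choice under double negation: lets adjacency, packing numbers and components be
-- treated as decidable in the proof of the (decidable) final inequality.

¬¬-map : ∀ {a b} {A : Set a} {B : Set b} → (A → B) → ¬ ¬ A → ¬ ¬ B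
¬¬-map f ¬¬a ¬b = ¬¬a (¬b ∘ f)

¬¬-dec : ∀ {a} (A : Set a) → ¬ ¬ Dec A
¬¬-dec A ¬d = ¬d (no λ a → ¬d (yes a))

¬¬-Fin : ∀ {a} m {P : Fin m → Set a} → (∀ i → ¬ ¬ P i) → ¬ ¬ (∀ i → P i)
¬¬-Fin zero h ¬all = ¬all λ ()
¬¬-Fin (suc m) h ¬all = h zero λ p → ¬¬-Fin m (h ∘ suc) λ ps → ¬all λ { zero → p ; (suc i) → ps i }

¬¬-Subset : ∀ {a} m {P : Subset m → Set a} → (∀ U → ¬ ¬ P U) → ¬ ¬ (∀ U → P U)
¬¬-Subset zero h ¬all = h [] λ p → ¬all λ { [] → p }
¬¬-Subset (suc m) h ¬all = ¬¬-Subset m (h ∘ (true ∷_)) λ ps → ¬¬-Subset m (h ∘ (false ∷_)) λ qs →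
  ¬all λ { (true ∷ U) → ps U ; (false ∷ U) → qs U }

¬¬-max : ∀ {P : ℕ → Set₁} → P 0 → ∀ b → (∀ d → P d → d ≤ b) → ¬ ¬ (Σ[ k ∈ ℕ ] (P k × (∀ d → P d → d ≤ k)))
¬¬-max p₀ zero bnd ¬max = ¬max (0 , p₀ , bnd)
¬¬-max {P} p₀ (suc b) bnd ¬max = ¬¬-dec (P (suc b)) λ
  { (yes p) → ¬max (suc b , p , bnd)
  ; (no ¬p) → ¬¬-max p₀ b (λ d p → ℕ.≤-pred (ℕ.≤∧≢⇒< (bnd d p) λ { refl → ¬p p })) ¬max }

fromList : ∀ {n} → List (Fin n) → Subset n
fromList [] = empty
fromList (v ∷ vs) = ⁅ v ⁆ ∪ fromList vs

∈-fromList : ∀ {n} {v : Fin n} {vs} → v ∈ˡ vs → v ∈ fromList vs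
∈-fromList {v = v} {_ ∷ vs} (here refl) = Sub.x∈p∪q⁺ (inj₁ (Sub.x∈⁅x⁆ v))
∈-fromList {vs = w ∷ vs} (there m) = Sub.x∈p∪q⁺ (inj₂ (∈-fromList m))

∣⁅v⁆∪p∣≤ : ∀ {n} (v : Fin n) (p : Subset n) → ∣ ⁅ v ⁆ ∪ p ∣ ≤ suc ∣ p ∣
∣⁅v⁆∪p∣≤ zero (b ∷ p) = s≤s (ℕ.≤-trans (ℕ.≤-reflexive (cong ∣_∣ (Sub.∪-identityˡ p))) (Sub.∣p∣≤∣x∷p∣ b p))
∣⁅v⁆∪p∣≤ (suc v) (true ∷ p) = s≤s (∣⁅v⁆∪p∣≤ v p)
∣⁅v⁆∪p∣≤ (suc v) (false ∷ p) = ∣⁅v⁆∪p∣≤ v p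

∣fromList∣ : ∀ {n} (vs : List (Fin n)) → ∣ fromList vs ∣ ≤ length vs
∣fromList∣ {n} [] = ℕ.≤-reflexive (Sub.∣⊥∣≡0 n)
∣fromList∣ (v ∷ vs) = ℕ.≤-trans (∣⁅v⁆∪p∣≤ v (fromList vs)) (s≤s (∣fromList∣ vs))

open Defs using (Graph; n; Adj; Iso; ContractionStep; ContractsTo; done; step; Subgraph; ModelIn; Hits; Packing; IsCoverNumber; IsPackNumber; PathwidthAtMost)

-- Contraction sequences and branch sets.

-- What a contraction leaves behind: its fibres, connected in the cut form also used for `Conn`, and
-- a lift of every edge. That edges between fibres go to edges of `H` is a separate hypothesis of
-- `contract`.
record BranchMap (K H : Graph) : Set where
  field
    φ     : Fin (Graph.n K) → Fin (Graph.n H)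
    onto  : ∀ x → ∃[ u ] φ u ≡ x
    fibre : ∀ (f : Fin (Graph.n K) → Bool) → (∀ {u v} → φ u ≡ φ v → Adj K u v → f u ≡ f v) →
            ∀ {u v} → φ u ≡ φ v → f u ≡ f v
    lift  : ∀ {x y} → Adj H x y → ∃[ u ] ∃[ v ] (φ u ≡ x × φ v ≡ y × Adj K u v)

branchMap : ∀ {K H} → ContractsTo K H → BranchMap K H
branchMap {H = H} (done iso) = record
  { φ = φ ; onto = λ x → proj₁ (surj x) , proj₂ (surj x) refl
  ; fibre = λ f _ eq → cong f (inj eq)
  ; lift = λ {x} {y} e → let u , p = surj x ; v , q = surj y in u , v , p refl , q refl
      , Equivalence.from (adj⇔ u v) (subst₂ (Adj H) (≡sym (p refl)) (≡sym (q refl)) e) }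
  where open Iso iso
branchMap {K} {H} (step {G' = K′} c rest) = record
  { φ = R.φ ∘ φ
  ; onto = λ x → let a , p = R.onto x ; u , q = surj a in u , trans (cong R.φ (q refl)) p
  ; fibre = fibre′
  ; lift = λ e → let a , b , p , q , e′ = R.lift e
                     _ , x , y , p′ , q′ , e″ = Equivalence.to (adj⇔ a b) e′
                 in x , y , trans (cong R.φ p′) p , trans (cong R.φ q′) q , e″ }
  where
  open ContractionStep c
  module R = BranchMap (branchMap rest)
  section : Fin (Graph.n K′) → Fin (Graph.n K)
  section a = proj₁ (surj a)
  φ-section : ∀ a → φ (section a) ≡ a
  φ-section a = proj₂ (surj a) refl
  fibre′ : ∀ (f : Fin (Graph.n K) → Bool) → (∀ {u v} → R.φ (φ u) ≡ R.φ (φ v) → Adj K u v → f u ≡ f v) →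
    ∀ {u v} → R.φ (φ u) ≡ R.φ (φ v) → f u ≡ f v
  fibre′ f inv {x} {y} eq = trans (lifted x) (trans (R.fibre (f ∘ section) inv′ eq) (≡sym (lifted y)))
    where
    same : ∀ x y → φ x ≡ φ y → f x ≡ f y
    same x y eq with Equivalence.to (ident x y) eq
    ... | inj₁ refl = refl
    ... | inj₂ (inj₁ (refl , refl)) = inv (cong R.φ eq) uv
    ... | inj₂ (inj₂ (refl , refl)) = inv (cong R.φ eq) (Graph.sym K uv)
    lifted : ∀ x → f x ≡ f (section (φ x))
    lifted x = same x _ (≡sym (φ-section (φ x)))
    inv′ : ∀ {a b} → R.φ a ≡ R.φ b → Adj K′ a b → f (section a) ≡ f (section b)
    inv′ {a} {b} eq e with Equivalence.to (adj⇔ a b) e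
    ... | _ , x , y , refl , refl , e′ = trans (≡sym (lifted x)) (trans (inv eq e′) (lifted y))

-- As long as some edge lies inside a fibre it is contracted. Once there is none, the indicator
-- function of a vertex is constant along all edges inside fibres, so fibres are singletons and the
-- map is an isomorphism.
contract : ∀ {H} m (_~_ : Fin m → Fin m → Set) (~-sym : ∀ {u v} → u ~ v → v ~ u) (~-irrefl : ∀ {u} → ¬ u ~ u) →
  (∀ u v → Dec (u ~ v)) → (M : BranchMap (record { n = m ; Adj = _~_ ; sym = ~-sym ; irrefl = ~-irrefl }) H) →
  (∀ {u v} → BranchMap.φ M u ≢ BranchMap.φ M v → u ~ v → Adj H (BranchMap.φ M u) (BranchMap.φ M v)) →
  ContractsTo (record { n = m ; Adj = _~_ ; sym = ~-sym ; irrefl = ~-irrefl }) H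
contract {H} m _~_ ~-sym ~-irrefl ~? M project with any? (λ u → any? (λ v → (BranchMap.φ M u ≟ BranchMap.φ M v) ×-dec ~? u v))
... | no none = done (record
  { φ = φ ; inj = inj ; surj = λ x → let u , p = onto x in u , λ { refl → p }
  ; adj⇔ = λ x y → mk⇔ (λ e → project (λ eq → none (x , y , eq , e)) e)
      (λ e → let u , v , p , q , e′ = lift e in subst₂ _~_ (inj p) (inj q) e′) })
  where
  open BranchMap M
  inj : ∀ {u v} → φ u ≡ φ v → u ≡ v
  inj {u} {v} eq with v ≟ u | fibre (λ z → does (z ≟ u)) (λ {x} {y} eq e → ⊥-elim (none (x , y , eq , e))) eq
  ... | yes v≡u | _ = ≡sym v≡u
  ... | no _ | ind with u ≟ u
  ...   | no u≢u = ⊥-elim (u≢u refl)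
  inj {u} {v} eq | no _ | () | yes _
contract {H} zero _~_ ~-sym ~-irrefl ~? M project | yes (() , _)
contract {H} (suc m) _~_ ~-sym ~-irrefl ~? M project | yes (u , v , φu≡φv , uv) = step
  (record { u = u ; v = v ; uv = uv ; φ = q ; surj = λ a → punchIn v a , λ { refl → q-punchIn a }
          ; ident = λ x y → mk⇔ (q-ident x y) (q-ident⁻ x y) ; adj⇔ = λ a b → mk⇔ id id })
  (contract m _≈_ ≈-sym ≈-irrefl ≈? M′ project′)
  where
  open BranchMap M
  v≢u : v ≢ u
  v≢u refl = ~-irrefl uv
  -- The quotient deletes the index `v`, sending `v` to the new index of `u`.
  qOf : ∀ z → Dec (v ≡ z) → Fin m
  qOf z (yes _) = punchOut v≢u
  qOf z (no v≢z) = punchOut v≢z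
  q : Fin (suc m) → Fin m
  q z = qOf z (v ≟ z)
  q-punchIn : ∀ a → q (punchIn v a) ≡ a
  q-punchIn a with v ≟ punchIn v a
  ... | yes eq = ⊥-elim (punchInᵢ≢i v a (≡sym eq))
  ... | no ne = trans (punchOut-cong v refl) (punchOut-punchIn v)
  q-ident : ∀ x y → q x ≡ q y → x ≡ y ⊎ (x ≡ u × y ≡ v) ⊎ (x ≡ v × y ≡ u)
  q-ident x y eq with v ≟ x | v ≟ y
  ... | yes refl | yes refl = inj₁ refl
  ... | yes refl | no v≢y = inj₂ (inj₂ (refl , ≡sym (punchOut-injective v≢u v≢y eq)))
  ... | no v≢x | yes refl = inj₂ (inj₁ (punchOut-injective v≢x v≢u eq , refl))
  ... | no v≢x | no v≢y = inj₁ (punchOut-injective v≢x v≢y eq)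
  qu≡qv : q u ≡ q v
  qu≡qv with v ≟ u | v ≟ v
  ... | yes eq | _ = ⊥-elim (v≢u eq)
  ... | no _ | no ne = ⊥-elim (ne refl)
  ... | no _ | yes _ = punchOut-cong v refl
  q-ident⁻ : ∀ x y → x ≡ y ⊎ (x ≡ u × y ≡ v) ⊎ (x ≡ v × y ≡ u) → q x ≡ q y
  q-ident⁻ x y (inj₁ refl) = refl
  q-ident⁻ x y (inj₂ (inj₁ (refl , refl))) = qu≡qv
  q-ident⁻ x y (inj₂ (inj₂ (refl , refl))) = ≡sym qu≡qv
  _≈_ : Fin m → Fin m → Set
  a ≈ b = a ≢ b × ∃[ x ] ∃[ y ] (q x ≡ a × q y ≡ b × x ~ y)
  ≈-sym : ∀ {a b} → a ≈ b → b ≈ a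
  ≈-sym (ne , x , y , p , p′ , e) = ne ∘ ≡sym , y , x , p′ , p , ~-sym e
  ≈-irrefl : ∀ {a} → ¬ a ≈ a
  ≈-irrefl (ne , _) = ne refl
  ≈? : ∀ a b → Dec (a ≈ b)
  ≈? a b = ¬? (a ≟ b) ×-dec any? (λ x → any? (λ y → (q x ≟ a) ×-dec ((q y ≟ b) ×-dec ~? x y)))
  φ′ : Fin m → Fin (Graph.n H)
  φ′ a = φ (punchIn v a)
  φ′-q : ∀ z → φ′ (q z) ≡ φ z
  φ′-q z with v ≟ z
  ... | yes refl = trans (cong φ (punchIn-punchOut v≢u)) φu≡φv
  ... | no v≢z = cong φ (punchIn-punchOut v≢z)
  M′ : BranchMap (record { n = m ; Adj = _≈_ ; sym = ≈-sym ; irrefl = ≈-irrefl }) H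
  M′ = record
    { φ = φ′
    ; onto = λ x → let z , p = onto x in q z , trans (φ′-q z) p
    ; fibre = λ f inv {a} {b} eq → subst₂ (λ a b → f a ≡ f b) (q-punchIn a) (q-punchIn b)
        (fibre (f ∘ q) (λ {x} {y} eq′ e → inv-q f inv x y eq′ e (q x ≟ q y)) eq)
    ; lift = λ {x} {y} e → let z , w , p , p′ , e′ = lift e in q z , q w , trans (φ′-q z) p , trans (φ′-q w) p′
        , (λ eq → Graph.irrefl H (subst (λ z → Adj H z y) (trans (≡sym p) (trans (≡sym (φ′-q z)) (trans (cong φ′ eq) (trans (φ′-q w) p′)))) e))
        , z , w , refl , refl , e′ }
    where
    inv-q : ∀ (f : Fin m → Bool) → (∀ {a b} → φ′ a ≡ φ′ b → a ≈ b → f a ≡ f b) →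
      ∀ x y → φ x ≡ φ y → x ~ y → Dec (q x ≡ q y) → f (q x) ≡ f (q y)
    inv-q f inv x y eq e (yes same) = cong f same
    inv-q f inv x y eq e (no ne) = inv (trans (φ′-q x) (trans eq (≡sym (φ′-q y)))) (ne , x , y , refl , refl , e)
  project′ : ∀ {a b} → φ′ a ≢ φ′ b → a ≈ b → Adj H (φ′ a) (φ′ b)
  project′ ne (_ , x , y , refl , refl , e) = subst₂ (Adj H) (≡sym (φ′-q x)) (≡sym (φ′-q y))
    (project (λ eq → ne (trans (φ′-q x) (trans eq (≡sym (φ′-q y))))) e)

module Translation (H G : Graph) (adjH? : ∀ x y → Dec (Adj H x y)) (adjG? : ∀ u v → Dec (Adj G u v)) where

  open Host (Adj G) (Graph.sym G) adjG?
  open Models H adjH? (Adj G) (Graph.sym G) adjG?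

  fromModelIn : (M : ModelIn H G) → Σ[ N ∈ Model full full ]
    (∀ {x v} → Model.B N x v → ∃[ w ] Subgraph.ι (ModelIn.sub M) w ≡ v)
  fromModelIn M = record
    { B = λ x v → ∃[ w ] (φ w ≡ x × ι w ≡ v)
    ; nonempty = λ {x} _ → let w , p = onto x in ι w , w , p , refl
    ; conn = λ {x} _ → bag-conn x
    ; disj = λ { _ _ (w , refl , p) (w′ , refl , q) → cong φ (ι-inj (trans p (≡sym q))) }
    ; edge = λ _ _ e → let u , v , p , q , e′ = lift e in ι u , ι v , (u , p , refl) , (v , q , refl) , ι-adj e′
    ; inU = λ _ _ → ∈⊤ }
    , λ (w , _ , p) → w , p
    where
    open Subgraph (ModelIn.sub M)
    open BranchMap (branchMap (ModelIn.model M))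
    bag-conn : ∀ x → Conn (λ v → ∃[ w ] (φ w ≡ x × ι w ≡ v))
    bag-conn x f inv (w , p , refl) (w′ , q , refl) = trans (≡sym (guarded p)) (trans
        (fibre g (λ {u} {v} eq e → g-inv u v eq e (φ u ≟ x)) (trans p (≡sym q))) (guarded q))
      where
      guard : ∀ w → Dec (φ w ≡ x) → Bool
      guard w (yes _) = f (ι w)
      guard w (no _) = true
      -- The colouring is extended by a constant outside the fibre of `x`, where edges inside other
      -- fibres then satisfy the condition.
      g : Fin (Graph.n K) → Bool
      g w = guard w (φ w ≟ x)
      guarded : ∀ {w} → φ w ≡ x → g w ≡ f (ι w)
      guarded {w} p with φ w ≟ x
      ... | yes _ = refl
      ... | no ¬p = ⊥-elim (¬p p)
      unguarded : ∀ {w} → φ w ≢ x → g w ≡ true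
      unguarded {w} ¬p with φ w ≟ x
      ... | yes p = ⊥-elim (¬p p)
      ... | no _ = refl
      g-inv : ∀ u v → φ u ≡ φ v → Adj K u v → Dec (φ u ≡ x) → g u ≡ g v
      g-inv u v eq e (yes p) = trans (guarded p) (trans
        (inv (u , p , refl) (v , trans (≡sym eq) p , refl) (ι-adj e)) (≡sym (guarded (trans (≡sym eq) p))))
      g-inv u v eq e (no ¬p) = trans (unguarded ¬p) (≡sym (unguarded (¬p ∘ trans eq)))

  module ToModelIn (N : Model full full) (bag? : ∀ x v → Dec (Model.B N x v)) where
    open Model N

    inside? : ∀ v → Dec (∃[ x ] B x v)
    inside? v = any? (λ x → bag? x v)

    L : List V
    L = filter inside? (allFin (Graph.n G))

    ι : Fin (length L) → V
    ι = lookup L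

    ι-inj : ∀ {i j} → ι i ≡ ι j → i ≡ j
    ι-inj = lookup-injective (filter⁺ inside? (allFin⁺ (Graph.n G))) _ _

    abstract
      owner : ∀ i → ∃[ x ] B x (ι i)
      owner i = proj₂ (∈-filter⁻ inside? {xs = allFin (Graph.n G)} (∈-lookup i))

    φ : Fin (length L) → Fin h
    φ i = proj₁ (owner i)

    locate : ∀ {x v} → B x v → ∃[ i ] (ι i ≡ v × φ i ≡ x)
    locate {x} {v} b = i , ιi≡v , disj ∈⊤ ∈⊤ (proj₂ (owner i)) (subst (B x) (≡sym ιi≡v) b)
      where
      v∈ : v ∈ˡ L
      v∈ = ∈-filter⁺ inside? (∈-allFin v) (x , b)
      i = index v∈
      ιi≡v : ι i ≡ v
      ιi≡v = ≡sym (lookup-index v∈)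

    -- Edges between branch sets that are not adjacent in `H` are omitted, since contraction would
    -- carry them to edges that `H` lacks.
    _≈_ : Fin (length L) → Fin (length L) → Set
    i ≈ j = Adj G (ι i) (ι j) × (φ i ≡ φ j ⊎ φ i ↔ φ j)

    ≈-sym : ∀ {i j} → i ≈ j → j ≈ i
    ≈-sym (e , inj₁ eq) = Graph.sym G e , inj₁ (≡sym eq)
    ≈-sym (e , inj₂ e′) = Graph.sym G e , inj₂ (Graph.sym H e′)

    ≈-irrefl : ∀ {i} → ¬ i ≈ i
    ≈-irrefl (e , _) = Graph.irrefl G e

    K : Graph
    K = record { n = length L ; Adj = _≈_ ; sym = ≈-sym ; irrefl = ≈-irrefl }

    branches : BranchMap K H
    branches = record
      { φ = φ
      ; onto = λ x → let v , b = nonempty {x} ∈⊤ ; i , _ , p = locate b in i , p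
      ; fibre = fibre
      ; lift = λ {x} {y} e →
          let u , v , bu , bv , uv = edge ∈⊤ ∈⊤ e ; i , p , p′ = locate bu ; j , q , q′ = locate bv
          in i , j , p′ , q′ , subst₂ (Adj G) (≡sym p) (≡sym q) uv , inj₂ (subst₂ _↔_ (≡sym p′) (≡sym q′) e) }
      where
      fibre : ∀ (f : Fin (length L) → Bool) → (∀ {i j} → φ i ≡ φ j → i ≈ j → f i ≡ f j) →
        ∀ {i j} → φ i ≡ φ j → f i ≡ f j
      fibre f inv {i} {j} eq = trans (≡sym (F-ι i)) (trans
        (conn {φ i} ∈⊤ F F-inv (proj₂ (owner i)) (subst (λ x → B x (ι j)) (≡sym eq) (proj₂ (owner j)))) (F-ι j))
        where
        pull : ∀ v → Dec (v ∈ˡ L) → Bool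
        pull v (yes v∈) = f (index v∈)
        pull v (no _) = true
        F : V → Bool
        F v = pull v (v ∈ˡ? L)
        F-ι : ∀ i → F (ι i) ≡ f i
        F-ι i with ι i ∈ˡ? L
        ... | yes v∈ = cong f (ι-inj (≡sym (lookup-index v∈)))
        ... | no v∉ = ⊥-elim (v∉ (∈-lookup i))
        F-inv : ∀ {u v} → B (φ i) u → B (φ i) v → Adj G u v → F u ≡ F v
        F-inv bu bv e with locate bu | locate bv
        ... | s , refl , p | t , refl , q =
          trans (F-ι s) (trans (inv (trans p (≡sym q)) (e , inj₁ (trans p (≡sym q)))) (≡sym (F-ι t)))

    modelIn : ModelIn H G
    modelIn = record
      { sub = record { K = K ; ι = ι ; ι-inj = ι-inj ; ι-adj = proj₁ }
      ; model = contract (length L) _≈_ ≈-sym ≈-irrefl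
          (λ i j → adjG? (ι i) (ι j) ×-dec ((φ i ≟ φ j) ⊎-dec adjH? (φ i) (φ j))) branches
          (λ { ne (_ , inj₁ eq) → ⊥-elim (ne eq) ; ne (_ , inj₂ e) → e }) }

  packing : ∀ {d} (P : Pack full d full) → (∀ t x v → Dec (Model.B (Pack.copy P t) x v)) → Packing H G d
  packing P bag? = record
    { model = λ t → T.modelIn t
    ; disjoint = λ s t s≢t i j eq → s≢t (Pack.copies P ∈⊤ ∈⊤ (proj₂ (T.owner s i))
        (subst (Model.B (Pack.copy P t) _) (≡sym eq) (proj₂ (T.owner t j)))) }
    where module T t = ToModelIn (Pack.copy P t) (bag? t)

  ¬¬-packing : ∀ {d} → Pack full d full → ¬ ¬ Packing H G d
  ¬¬-packing {d} P = ¬¬-map (packing P) (¬¬-Fin d λ t → ¬¬-Fin h λ x → ¬¬-Fin (Graph.n G) λ v → ¬¬-dec _)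

  hits-from : ∀ (Z : List V) → ((M : Model full full) → (∀ {x v} → Model.B M x v → ¬ v ∈ˡ Z) → ⊥) → Hits H G (fromList Z)
  hits-from Z none M with any? (λ w → Subgraph.ι (ModelIn.sub M) w ∈? fromList Z)
  ... | yes hit = hit
  ... | no miss = ⊥-elim (none (proj₁ (fromModelIn M)) λ b v∈ → let w , eq = proj₂ (fromModelIn M) b in
                    miss (w , subst (_∈ fromList Z) (≡sym eq) (∈-fromList v∈)))

-- The two inequalities of the theorem.

pack≤cover : ∀ {H G k m} → IsPackNumber H G k → IsCoverNumber H G m → k ≤ m
pack≤cover {H} {G} {k} {m} (P , _) ((S , size , hits) , _) = subst (k ≤_) size
  (subst (_≤ ∣ S ∣) (length-tabulate pick) (distinct-members
    (AllPairs.tabulate⁺ λ {i} {j} i≢j → Packing.disjoint P i j i≢j _ _) (All.tabulate⁺ λ i → proj₂ (hits (Packing.model P i)))))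
  where
  pick : Fin k → Fin (Graph.n G)
  pick i = Subgraph.ι (ModelIn.sub (Packing.model P i)) (proj₁ (hits (Packing.model P i)))

module _ (H G : Graph) (pd : PathwidthAtMost 2 H) where

  ¬¬-cover≤ : ∀ {k m} → IsPackNumber H G k → IsCoverNumber H G m → ¬ ¬ (m ≤ Graph.n H * Sizes.cost (Graph.n H) (suc k))
  ¬¬-cover≤ {k} {m} (_ , maximal) (_ , minimal) ¬le =
    ¬¬-Fin (Graph.n H) (λ x → ¬¬-Fin (Graph.n H) λ y → ¬¬-dec (Adj H x y)) λ adjH? →
    ¬¬-Fin (Graph.n G) (λ u → ¬¬-Fin (Graph.n G) λ v → ¬¬-dec (Adj G u v)) λ adjG? →
    decided adjH? adjG?
    where
    decided : (∀ x y → Dec (Adj H x y)) → (∀ u v → Dec (Adj G u v)) → ⊥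
    decided adjH? adjG? =
      ¬¬-Subset h (λ A → ¬¬-dec (D.Component A)) λ component? →
      ¬¬-Subset h (λ A → ¬¬-Subset (Graph.n G) λ U → packNumber A U (component? A)) λ ν →
      let Z , small , hits = D.coverModel component? (λ A U → proj₁ (ν A U)) (λ {A} c U → proj₁ (proj₂ (ν A U) c))
                               (λ {A} c {U} {d} → proj₂ (proj₂ (ν A U) c) d) (suc k) (s≤s z≤n)
                               (λ U P → ¬¬-packing (widen P) λ P′ → ℕ.1+n≰n (maximal (suc k) P′))
      in ¬le (ℕ.≤-trans (minimal (fromList Z) (hits-from Z hits)) (ℕ.≤-trans (∣fromList∣ Z) small))
      where
      module D = Disconnected H adjH? pd (Adj G) (Graph.sym G) adjG?
      open Models H adjH? (Adj G) (Graph.sym G) adjG?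
      open Translation H G adjH? adjG?
      widen : ∀ {d U} → Pack full d U → Pack full d full
      widen P = record { copy = λ t → retarget (Pack.copy P t) (λ _ _ → ∈⊤) ; copies = Pack.copies P }
      packNumber : ∀ A U → Dec (D.Component A) →
        ¬ ¬ (Σ[ d ∈ ℕ ] (D.Component A → Pack A d U × (∀ d′ → Pack A d′ U → d′ ≤ d)))
      -- The value 0 is a dummy: packing numbers matter for components only.
      packNumber A U (no ¬c) ¬ν = ¬ν (0 , λ c → ⊥-elim (¬c c))
      packNumber A U (yes c) = ¬¬-map (λ (d , P , most) → d , λ _ → P , most)
        (¬¬-max (record { copy = λ () ; copies = λ { {s = ()} } }) (Graph.n G) (λ d → pack-size (proj₁ c)))

  -- The arithmetic rests on k + 1 ≤ 2k and so starts at 1. For packing number 0 there is no model,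
  -- and the empty set is a cover.
  cover-zero : ∀ {m} → IsPackNumber H G 0 → IsCoverNumber H G m → m ≤ 0
  cover-zero (_ , maximal) (_ , minimal) = subst (_ ≤_) (Sub.∣⊥∣≡0 (Graph.n G)) (minimal empty λ M →
    ⊥-elim (ℕ.1+n≰n (maximal 1 (record { model = λ _ → M ; disjoint = λ { zero zero ne → ⊥-elim (ne refl) } }))))

  cover≤ : ∀ {k m} → 1 ≤ Graph.n H → IsPackNumber H G k → IsCoverNumber H G m →
    m ≤ 2 ^ (11 * (Graph.n H * Graph.n H)) * (k * k) * ⌈log₂ suc k ⌉
  cover≤ {zero} 1≤h ν τ = ℕ.≤-trans (cover-zero ν τ) z≤n
  cover≤ {k@(suc _)} {m} 1≤h ν τ = ℕ.≤-trans
    (decidable-stable (m ≤? _) (¬¬-map (λ le → ℕ.≤-trans le (Sizes.total≤ (Graph.n H) 1≤h (s≤s z≤n))) (¬¬-cover≤ {k} ν τ)))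
    (ℕ.≤-trans (ℕ.≤-reflexive (≡sym (ℕ.*-identityʳ _)))
      -- The logarithm is taken of `suc k`, which is at least 2, so this factor is at least 1 even
      -- for packing number 1.
      (ℕ.*-monoʳ-≤ (2 ^ (11 * (Graph.n H * Graph.n H)) * (k * k)) (⌈log₂⌉-mono-≤ {2} {suc k} (s≤s (s≤s z≤n)))))

theorem1 : ∃[ c ] ((H : Graph) → PathwidthAtMost 2 H → 5 < n H →
    (G : Graph) (k m : ℕ) → IsPackNumber H G k → IsCoverNumber H G m →
    k ≤ m × m ≤ 2 ^ (c * (n H * n H)) * (k * k) * ⌈log₂ suc k ⌉)
theorem1 = 11 , λ H pd 5<h G k m ν τ →
  pack≤cover ν τ , cover≤ H G pd (ℕ.≤-trans (s≤s z≤n) 5<h) ν τ
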